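{- Let $q$ be a prime power, let $n,k,s$ be positive integers with $n \geq 2k$, write $n = mk + r$ with integers $m$ and $0 \leq r < k$, and let $\ell$ be the integer with $[\ell-1] < s \leq [\ell]$, where $[a] = \frac{q^a-1}{q-1}$. Let $Y$ be a largest $s$-EM family of $k$-spaces in $\mathbb{F}_q^n$. If $$16 s \leq \min\left\{ q^{\frac{n-k-\ell+2}{3}},\ q^{\frac{n-k-r}{3}},\ q^{\frac{n}{2}-k+1} \right\},$$ then $Y$ is the union of $s$ intersecting families.
   Context: A $k$-space is a $k$-dimensional subspace of $\mathbb{F}_q^n$. Two subspaces are called disjoint if their intersection is the trivial subspace $\{0\}$; two subspaces "meet" if they are not disjoint. A family of $k$-spaces is an $s$-EM family if it does not contain $s+1$ pairwise disjoint members. A family of $k$-spaces is intersecting if any two of its members meet (intersect nontrivially). "Largest" means of maximum cardinality among all $s$-EM families of $k$-spaces in $\mathbb{F}_q^n$. -}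

module Defs where

open import Level using (Level; _⊔_)
open import Data.Nat using (ℕ; zero; suc)
import Data.Nat as N
open import Data.Fin using (Fin; zero; suc)
open import Data.Product using (Σ; ∃; _×_; _,_)
open import Relation.Nullary using (¬_)
open import Relation.Binary.PropositionalEquality using (_≡_; _≢_)
open import Algebra.Bundles using (CommutativeRing)

-- q-number [a] = 1 + q + ... + q^(a-1)  ( = (q^a - 1)/(q - 1) )
[_]_ : ℕ → ℕ → ℕ
[ zero ] q = 0
[ suc a ] q = q N.^ a N.+ [ a ] q

open import Data.Nat.Primality using (Prime)
IsPrimePower : ℕ → Set
IsPrimePower q = Σ ℕ λ p → Σ ℕ λ e → Prime p × q ≡ p N.^ suc e

module _ {c ℓ : Level} (R : CommutativeRing c ℓ) where
  open CommutativeRing R using (Carrier; _≈_; _+_; _*_; 0#; 1#)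

  IsField : Set (c ⊔ ℓ)
  IsField = (¬ (0# ≈ 1#)) × (∀ x → ¬ (x ≈ 0#) → ∃ λ y → x * y ≈ 1#)

  HasCard : ℕ → Set (c ⊔ ℓ)
  HasCard q = Σ (Fin q → Carrier) λ e →
    (∀ x → ∃ λ i → e i ≈ x) × (∀ i j → e i ≈ e j → i ≡ j)

  Vect : ℕ → Set c
  Vect n = Fin n → Carrier

  _≈ᵥ_ : ∀ {n} → Vect n → Vect n → Set ℓ
  u ≈ᵥ v = ∀ i → u i ≈ v i

  zeroV : ∀ {n} → Vect n
  zeroV _ = 0#

  lincomb : ∀ {n k} → (Fin k → Carrier) → (Fin k → Vect n) → Vect n
  lincomb {k = zero} c b = zeroV
  lincomb {k = suc k} c b x = c zero * b zero x + lincomb (λ i → c (suc i)) (λ i → b (suc i)) x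

  LinIndep : ∀ {n k} → (Fin k → Vect n) → Set (c ⊔ ℓ)
  LinIndep b = ∀ coef → lincomb coef b ≈ᵥ zeroV → ∀ i → coef i ≈ 0#

  record KSpace (n k : ℕ) : Set (c ⊔ ℓ) where
    field
      basis : Fin k → Vect n
      indep : LinIndep basis
  open KSpace public

  _∈ₛ_ : ∀ {n k} → Vect n → KSpace n k → Set (c ⊔ ℓ)
  x ∈ₛ U = ∃ λ coef → x ≈ᵥ lincomb coef (basis U)

  SameSpace : ∀ {n k} → KSpace n k → KSpace n k → Set (c ⊔ ℓ)
  SameSpace U W = (∀ x → x ∈ₛ U → x ∈ₛ W) × (∀ x → x ∈ₛ W → x ∈ₛ U)

  Disjoint : ∀ {n k} → KSpace n k → KSpace n k → Set (c ⊔ ℓ)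
  Disjoint U W = ∀ x → x ∈ₛ U → x ∈ₛ W → x ≈ᵥ zeroV

  Meet : ∀ {n k} → KSpace n k → KSpace n k → Set (c ⊔ ℓ)
  Meet U W = ¬ Disjoint U W

  Family : ℕ → ℕ → ℕ → Set (c ⊔ ℓ)
  Family n k N = Σ (Fin N → KSpace n k) λ Y → ∀ i j → SameSpace (Y i) (Y j) → i ≡ j

  IsEM : ∀ {n k N} → ℕ → Family n k N → Set (c ⊔ ℓ)
  IsEM {N = N} s (Y , _) = (f : Fin (suc s) → Fin N) →
    (∀ a b → f a ≡ f b → a ≡ b) →
    (∀ a b → a ≢ b → Disjoint (Y (f a)) (Y (f b))) → Data.Empty.⊥
    where import Data.Empty

  IsLargestEM : ∀ {n k N} → ℕ → Family n k N → Set (c ⊔ ℓ)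
  IsLargestEM {n} {k} {N} s Y = IsEM s Y × (∀ N' (Z : Family n k N') → IsEM s Z → N' N.≤ N)

  UnionOfIntersecting : ∀ {n k N} → ℕ → Family n k N → Set (c ⊔ ℓ)
  UnionOfIntersecting {N = N} s (Y , _) = Σ (Fin N → Fin s) λ col →
    ∀ i j → i ≢ j → col i ≡ col j → Meet (Y i) (Y j)

-- A k-space is replaced by its ordered bases, that is, by injective linear maps b from U = K^k
-- to V, so that counting reduces to pairwise independence of the values of a random b. Let P be
-- the number of bases of k-spaces through a point. A largest s-EM family Y has almost sP bases,
-- since the union of s pencils is s-EM. By Cauchy–Schwarz a member of Y meets on average little
-- more than P members, so Füredi's greedy partition splits Y into at most s parts, one of which,
-- F, has size about P and only few disjoint pairs. A second application of Cauchy–Schwarz gives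
-- many quadruples b, c, e, e′ in F such that b and c share a hyperplane and e, e′ meet both b and
-- c in a point. But c = b + φ ⊗ z meets e only if φ vanishes at b ∩ e or z lies in b + e, which
-- is rare for e and e′ simultaneously unless e′ contains b ∩ e or lies in b + e. Hence some point,
-- or some (2k-1)-space, is heavy: it is contained in, respectively contains, a positive proportion
-- of P members. Members at a common centre meet pairwise, and the members away from it are
-- (s-1)-EM, because s disjoint ones could be extended by a member at the centre; now induct.

module Submission where

open import Level using (Level; 0ℓ)
open import Algebra.Bundles using (AbelianGroup; CommutativeRing; Ring)
open import Algebra.Structures using (IsAbelianGroup; IsCommutativeRing)
import Algebra.Properties.AbelianGroup as GroupProperties
import Algebra.Properties.Ring as RingProperties
open import Data.Bool using (Bool; true; false; _∧_; _∨_; not; if_then_else_)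
open import Data.Empty using (⊥; ⊥-elim)
open import Data.Fin as Fin using (Fin; zero; suc; toℕ; fromℕ<; inject≤)
import Data.Fin.Properties as Fin
open import Data.List as List using (List; []; _∷_; length; cartesianProductWith)
import Data.List.Properties as List
open import Data.List.Membership.Propositional using (_∈_)
open import Data.List.Membership.Propositional.Properties using (∈-lookup)
open import Data.List.Relation.Unary.All as All using (All; []; _∷_)
import Data.List.Relation.Unary.All.Properties as All
open import Data.List.Relation.Unary.AllPairs as AllPairs using (AllPairs; []; _∷_)
import Data.List.Relation.Unary.AllPairs.Properties as AllPairs
open import Data.List.Relation.Unary.Any as Any using (Any; here; there)
open import Data.List.Relation.Unary.Any.Properties using (lookup-index)
open import Data.Maybe using (just; nothing)
open import Data.Nat as ℕ using (ℕ; zero; suc; z≤n; s≤s)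
import Data.Nat.Properties as ℕ
import Data.Integer as Int
import Data.Integer.Properties as ℤ
open import Data.Product using (Σ; ∃; _×_; _,_; proj₁; proj₂)
open import Data.Sum using (_⊎_; inj₁; inj₂; [_,_]′)
open import Data.Vec using (Vec; []; _∷_; lookup; map; replicate; tabulate; zipWith)
import Data.Vec.Properties as Vec
open import Relation.Binary.Definitions using (DecidableEquality)
open import Relation.Binary.PropositionalEquality hiding ([_])
open import Relation.Nullary using (¬_; Dec; yes; no; does)
open import Relation.Nullary.Decidable using (toWitness)
open import Tactic.RingSolver using (solve-∀)
open import Tactic.RingSolver.Core.AlmostCommutativeRing using (AlmostCommutativeRing; fromCommutativeRing)

-- A family without a heavy centre is refuted by comparing two leading coefficients, 6q + 8 on the
-- left of `light-bound` and 5q + 9 on its right. For q = 2 these are 20 and 19, so every loss has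
-- to be estimated with care, including the deficit of the union of pencils, which is kept below
-- P/4096. No part is singled out: `part-bound` holds for every part and is summed over the whole
-- greedy partition, so that only the total number of disjoint pairs inside parts has to be
-- controlled. Counting runs over all linear maps and not only over the injective ones, because
-- pairwise independence of the values is exact only there. In upper bounds the additional maps do
-- no harm, and in the lower bound for a pencil they cost at most the fraction C/A. Everything is
-- stated over the integers with denominators cleared: probabilities appear multiplied by
-- cardinalities, and Cauchy-Schwarz appears as the nonnegativity of Σ (xα - β)² for an explicit
-- multiplier x.

module Counting where
  open import Data.Integer using (ℤ; 0ℤ; 1ℤ; _+_; _-_; -_; _≤_; _<_; +≤+; +<+; -[1+_]) renaming (+_ to pos)

  -- Sums over finite types

  -- Integer multiplication unfolds to a sign and an absolute value on open terms; keeping it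
  -- opaque stops conversion checking from expanding products.
  infixl 7 _*_
  opaque
    _*_ : ℤ → ℤ → ℤ
    x * y = x Int.* y

    pos-* : ∀ m n → pos (m ℕ.* n) ≡ pos m * pos n
    pos-* = ℤ.pos-*

    *-isCommutativeRing : IsCommutativeRing _≡_ _+_ _*_ -_ 0ℤ 1ℤ
    *-isCommutativeRing = ℤ.+-*-isCommutativeRing

  open IsCommutativeRing *-isCommutativeRing public
    using (*-comm; *-assoc; *-identityˡ; *-identityʳ; zeroˡ; zeroʳ; distribˡ; distribʳ)

  ring : AlmostCommutativeRing 0ℓ 0ℓ
  ring = fromCommutativeRing (record { isCommutativeRing = *-isCommutativeRing })
           λ { (pos 0) → just refl ; _ → nothing }

  0≤sum : ∀ {x y} → 0ℤ ≤ x → 0ℤ ≤ y → 0ℤ ≤ x + y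
  0≤sum = ℤ.+-mono-≤

  0≤pos : ∀ {n} → 0ℤ ≤ pos n
  0≤pos = +≤+ ℕ.z≤n

  0≤diff : ∀ {x y} → x ≤ y → 0ℤ ≤ y - x
  0≤diff = ℤ.i≤j⇒0≤j-i

  ≤-by : ∀ {x y r} → 0ℤ ≤ r → y - x ≡ r → x ≤ y
  ≤-by p refl = ℤ.0≤i-j⇒j≤i p

  0≤prod : ∀ {x y} → 0ℤ ≤ x → 0ℤ ≤ y → 0ℤ ≤ x * y
  0≤prod {pos x} {pos y} _ _ = subst (0ℤ ≤_) (pos-* x y) 0≤pos

  0<prod : ∀ {x y} → 0ℤ < x → 0ℤ < y → 0ℤ < x * y
  0<prod {pos (ℕ.suc m)} {pos (ℕ.suc n)} _ _ = subst (0ℤ <_) (pos-* (ℕ.suc m) (ℕ.suc n)) (+<+ (ℕ.s≤s ℕ.z≤n))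
  0<prod {pos ℕ.zero} (+<+ ()) _
  0<prod {pos (ℕ.suc m)} {pos ℕ.zero} _ (+<+ ())

  opaque
    unfolding _*_

    0≤square : ∀ x → 0ℤ ≤ x * x
    0≤square (pos n)  = 0≤prod {pos n} {pos n} 0≤pos 0≤pos
    0≤square -[1+ n ] = 0≤pos

    *-cancelˡ : ∀ {c x y} → 0ℤ < c → c * x ≤ c * y → x ≤ y
    *-cancelˡ {c} {x} {y} (+<+ {n = ℕ.suc m} _) p = ℤ.*-cancelˡ-≤-pos x y (pos (ℕ.suc m)) p

    *-diff : ∀ c x y → c * y - c * x ≡ c * (y - x)
    *-diff = solve-∀ ring

  *-monoˡ : ∀ {c x y} → 0ℤ ≤ c → x ≤ y → c * x ≤ c * y
  *-monoˡ {c} {x} {y} c≥0 x≤y = ≤-by (0≤prod c≥0 (0≤diff x≤y)) (*-diff c x y)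

  *-monoʳ : ∀ {c x y} → 0ℤ ≤ c → x ≤ y → x * c ≤ y * c
  *-monoʳ {c} {x} {y} c≥0 x≤y = subst₂ _≤_ (*-comm c x) (*-comm c y) (*-monoˡ c≥0 x≤y)

  *-cancelˡ-≡ : ∀ {c x y} → 0ℤ < c → c * x ≡ c * y → x ≡ y
  *-cancelˡ-≡ c>0 p = ℤ.≤-antisym (*-cancelˡ c>0 (ℤ.≤-reflexive p)) (*-cancelˡ c>0 (ℤ.≤-reflexive (sym p)))

  <⇒0≤ : ∀ {x} → 0ℤ < x → 0ℤ ≤ x
  <⇒0≤ = ℤ.<⇒≤

  χ : Bool → ℤ
  χ true  = 1ℤ
  χ false = 0ℤ

  0≤χ : ∀ b → 0ℤ ≤ χ b
  0≤χ true  = 0≤pos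
  0≤χ false = 0≤pos

  χ≤1 : ∀ b → χ b ≤ 1ℤ
  χ≤1 true  = ℤ.≤-refl
  χ≤1 false = 0≤pos

  χ-∧ : ∀ a b → χ (a ∧ b) ≡ χ a * χ b
  χ-∧ true  b = sym (*-identityˡ (χ b))
  χ-∧ false b = sym (zeroˡ (χ b))

  χ-not : ∀ a → χ (not a) ≡ 1ℤ - χ a
  χ-not true  = refl
  χ-not false = refl

  χ-mono : ∀ {a b} → (a ≡ true → b ≡ true) → χ a ≤ χ b
  χ-mono {false} {b} _ = 0≤χ b
  χ-mono {true} h rewrite h refl = ℤ.≤-refl

  iff : ∀ {a b} → (a ≡ true → b ≡ true) → (b ≡ true → a ≡ true) → a ≡ b
  iff {true}  {b}     p q = sym (p refl)
  iff {false} {true}  p q = q refl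
  iff {false} {false} p q = refl

  ∧-intro : ∀ {a b} → a ≡ true → b ≡ true → a ∧ b ≡ true
  ∧-intro refl refl = refl

  ∧-elimˡ : ∀ {a b} → a ∧ b ≡ true → a ≡ true
  ∧-elimˡ {true} _ = refl

  ∧-elimʳ : ∀ {a b} → a ∧ b ≡ true → b ≡ true
  ∧-elimʳ {true} p = p

  not-elim : ∀ {a} → not a ≡ true → a ≡ false
  not-elim {false} _ = refl

  not-intro : ∀ {a} → a ≡ false → not a ≡ true
  not-intro refl = refl

  true≢false : ∀ {a : Bool} {X : Set} → a ≡ true → a ≡ false → X
  true≢false refl ()

  bool-cases : ∀ b → b ≡ true ⊎ b ≡ false
  bool-cases true  = inj₁ refl
  bool-cases false = inj₂ refl

  ≢true⇒false : ∀ {a} → (a ≡ true → ⊥) → a ≡ false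
  ≢true⇒false {true}  h = ⊥-elim (h refl)
  ≢true⇒false {false} h = refl

  ∑ : ∀ {A : Set} → List A → (A → ℤ) → ℤ
  ∑ []       f = 0ℤ
  ∑ (x ∷ xs) f = f x + ∑ xs f

  module _ {A : Set} where

    ∑-cong : ∀ (xs : List A) {f g} → (∀ x → f x ≡ g x) → ∑ xs f ≡ ∑ xs g
    ∑-cong []       h = refl
    ∑-cong (x ∷ xs) h = cong₂ _+_ (h x) (∑-cong xs h)

    ∑-mono : ∀ (xs : List A) {f g} → (∀ x → f x ≤ g x) → ∑ xs f ≤ ∑ xs g
    ∑-mono []       h = ℤ.≤-refl
    ∑-mono (x ∷ xs) h = ℤ.+-mono-≤ (h x) (∑-mono xs h)

    ∑-zero : ∀ (xs : List A) → ∑ xs (λ _ → 0ℤ) ≡ 0ℤ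
    ∑-zero []       = refl
    ∑-zero (x ∷ xs) = trans (ℤ.+-identityˡ _) (∑-zero xs)

    ∑-+ : ∀ (xs : List A) f g → ∑ xs (λ x → f x + g x) ≡ ∑ xs f + ∑ xs g
    ∑-+ []       f g = refl
    ∑-+ (x ∷ xs) f g = trans (cong ((f x + g x) +_) (∑-+ xs f g)) (eq (f x) (g x) (∑ xs f) (∑ xs g))
      where
      opaque
        unfolding _*_
        eq : ∀ a b c d → a + b + (c + d) ≡ a + c + (b + d)
        eq = solve-∀ ring

    ∑-* : ∀ (xs : List A) c f → ∑ xs (λ x → c * f x) ≡ c * ∑ xs f
    ∑-* []       c f = sym (zeroʳ c)
    ∑-* (x ∷ xs) c f = trans (cong (c * f x +_) (∑-* xs c f)) (sym (distribˡ c (f x) (∑ xs f)))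

  ∑-swap : ∀ {A B : Set} (xs : List A) (ys : List B) (f : A → B → ℤ) →
           ∑ xs (λ x → ∑ ys (f x)) ≡ ∑ ys (λ y → ∑ xs (λ x → f x y))
  ∑-swap []       ys f = sym (∑-zero ys)
  ∑-swap (x ∷ xs) ys f = trans (cong (∑ ys (f x) +_) (∑-swap xs ys f))
                               (sym (∑-+ ys (f x) (λ y → ∑ xs (λ x → f x y))))

  -- `once` states that `elems` lists every element exactly once. It has the form of a sum so that
  -- the δ-identities for sums follow from it directly.
  record Enum (A : Set) : Set where
    field
      elems : List A
      _≟_   : DecidableEquality A

    infix 4 _==_
    _==_ : A → A → Bool
    x == y = does (x ≟ y)

    field
      once : ∀ a → ∑ elems (λ x → χ (x == a)) ≡ 1ℤ

  open Enum {{...}} public using (_≟_; _==_)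

  module _ {A : Set} {{E : Enum A}} where

    ==⇒≡ : ∀ {x y : A} → (x == y) ≡ true → x ≡ y
    ==⇒≡ {x} {y} p with x ≟ y
    ... | yes q = q
    ==⇒≡ () | no _

    ≡⇒== : ∀ {x y : A} → x ≡ y → (x == y) ≡ true
    ≡⇒== {x} {y} p with x ≟ y
    ... | yes _ = refl
    ... | no q = ⊥-elim (q p)

    ≢⇒== : ∀ {x y : A} → ¬ x ≡ y → (x == y) ≡ false
    ≢⇒== {x} {y} p with x ≟ y
    ... | yes q = ⊥-elim (p q)
    ... | no _ = refl

  opaque
    infix 2 sum
    -- Opaque, so that sums over product and vector types are compared as wholes and do not unfold
    -- to nested lists; `sum-×`, `sum-[]` and `sum-∷` open them on demand.
    sum : ∀ {A : Set} {{E : Enum A}} → (A → ℤ) → ℤ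
    sum {{E}} = ∑ (Enum.elems E)

    sum-def : ∀ {A : Set} (E : Enum A) (f : A → ℤ) → sum {{E}} f ≡ ∑ (Enum.elems E) f
    sum-def E f = refl

    syntax sum (λ x → e) = ∑[ x ] e

  module _ {A : Set} {{E : Enum A}} where

    private
      xs₀ : List A
      xs₀ = Enum.elems E

    opaque
     unfolding sum
     sum-cong : {f g : A → ℤ} → (∀ x → f x ≡ g x) → sum f ≡ sum g
     sum-cong = ∑-cong xs₀

     sum-mono : {f g : A → ℤ} → (∀ x → f x ≤ g x) → sum f ≤ sum g
     sum-mono = ∑-mono xs₀

     sum-zero : {f : A → ℤ} → (∀ x → f x ≡ 0ℤ) → sum f ≡ 0ℤ
     sum-zero h = trans (sum-cong h) (∑-zero xs₀)

    sum-nonneg : {f : A → ℤ} → (∀ x → 0ℤ ≤ f x) → 0ℤ ≤ sum f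
    sum-nonneg h = subst (_≤ sum _) (sum-zero {f = λ _ → 0ℤ} (λ _ → refl)) (sum-mono h)

    opaque
     unfolding sum
     sum-+ : (f g : A → ℤ) → sum (λ x → f x + g x) ≡ sum f + sum g
     sum-+ = ∑-+ xs₀

     sum-*ˡ : ∀ c (f : A → ℤ) → sum (λ x → c * f x) ≡ c * sum f
     sum-*ˡ = ∑-* xs₀

     sum-once : ∀ a → sum {{E}} (λ x → χ (Enum._==_ E x a)) ≡ 1ℤ
     sum-once = Enum.once E

    sum-*ʳ : ∀ c (f : A → ℤ) → sum (λ x → f x * c) ≡ sum f * c
    sum-*ʳ c f = trans (sum-cong (λ x → *-comm (f x) c)) (trans (sum-*ˡ c f) (*-comm c (sum f)))

    sum-neg : (f : A → ℤ) → sum (λ x → - f x) ≡ - sum f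
    sum-neg f = trans (sum-cong (λ x → neg (f x))) (trans (sum-*ˡ (- 1ℤ) f) (sym (neg (sum f))))
       where
       opaque
         unfolding _*_
         neg : ∀ x → - x ≡ - 1ℤ * x
         neg = solve-∀ ring

    sum-- : (f g : A → ℤ) → sum (λ x → f x - g x) ≡ sum f - sum g
    sum-- f g = trans (sum-+ f (λ x → - g x)) (cong (sum f +_) (sum-neg g))

    sum-δ : ∀ a (f : A → ℤ) → sum (λ x → χ (x == a) * f x) ≡ f a
    sum-δ a f = trans (sum-cong pt) (trans (sum-*ʳ (f a) (λ x → χ (x == a)))
                  (trans (cong (_* f a) (sum-once a)) (*-identityˡ (f a))))
      where
      pt : ∀ x → χ (x == a) * f x ≡ χ (x == a) * f a
      pt x with x ≟ a
      ... | yes refl = refl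
      ... | no _ = trans (zeroˡ (f x)) (sym (zeroˡ (f a)))

    sum-δ′ : ∀ a (f : A → ℤ) → sum (λ x → χ (a == x) * f x) ≡ f a
    sum-δ′ a f = trans (sum-cong (λ x → cong (λ b → χ b * f x)
                   (iff (λ p → ≡⇒== (sym (==⇒≡ p))) (λ p → ≡⇒== (sym (==⇒≡ p)))))) (sum-δ a f)

    ∈-elems : ∀ a → a ∈ xs₀
    ∈-elems a = go xs₀ (Enum.once E a)
      where
      go : ∀ xs → ∑ xs (λ x → χ (x == a)) ≡ 1ℤ → a ∈ xs
      go (x ∷ xs) p with x ≟ a
      ... | yes refl = here refl
      ... | no _ = there (go xs (trans (sym (ℤ.+-identityˡ _)) p))

    find : (R : A → Bool) → (Σ A λ a → R a ≡ true) ⊎ (∀ a → R a ≡ false)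
    find R = [ inj₁ , (λ h → inj₂ (λ a → h a (∈-elems a))) ]′ (go xs₀)
      where
      go : ∀ xs → (Σ A λ a → R a ≡ true) ⊎ (∀ a → a ∈ xs → R a ≡ false)
      go [] = inj₂ (λ _ ())
      go (x ∷ xs) with R x in eq
      ... | true = inj₁ (x , eq)
      ... | false with go xs
      ...   | inj₁ r = inj₁ r
      ...   | inj₂ h = inj₂ λ { a (here refl) → eq ; a (there m) → h a m }

    opaque
     ex : (A → Bool) → Bool
     ex R with find R
     ... | inj₁ _ = true
     ... | inj₂ _ = false

     ex-intro : ∀ R a → R a ≡ true → ex R ≡ true
     ex-intro R a p with find R
     ... | inj₁ _ = refl
     ... | inj₂ h = true≢false p (h a)

     ex-elim : ∀ R → ex R ≡ true → Σ A λ a → R a ≡ true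
     ex-elim R p with find R
     ... | inj₁ r = r
     ex-elim R () | inj₂ _

    at-most-one : ∀ (R : A → Bool) p → (∀ a → R a ≡ true → p ≡ true) →
                  (∀ a b → R a ≡ true → R b ≡ true → a ≡ b) → sum (λ x → χ (R x)) ≤ χ p
    at-most-one R p h uniq with find R
    ... | inj₁ (a , Ra) rewrite h a Ra =
          subst (sum (λ x → χ (R x)) ≤_) (sum-once a)
            (sum-mono (λ x → χ-mono {R x} {x == a} (λ Rx → ≡⇒== (uniq x a Rx Ra))))
    ... | inj₂ none = subst (_≤ χ p) (sym (sum-zero (λ x → cong χ (none x)))) (0≤χ p)

    single≤ : ∀ (f : A → ℤ) → (∀ x → 0ℤ ≤ f x) → ∀ a → f a ≤ sum f
    single≤ f f≥0 a = subst (_≤ sum f) (sum-δ a f)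
      (sum-mono (λ x → le (f≥0 x) (x == a)))
      where
      le : ∀ {y} → 0ℤ ≤ y → ∀ b → χ b * y ≤ y
      le {y} _ true  = ℤ.≤-reflexive (*-identityˡ y)
      le {y} p false = subst (_≤ y) (sym (zeroˡ y)) p

  module _ {A B : Set} {{EA : Enum A}} {{EB : Enum B}} where

    opaque
     unfolding sum
     sum-swap : (f : A → B → ℤ) → (∑[ x ] ∑[ y ] f x y) ≡ (∑[ y ] ∑[ x ] f x y)
     sum-swap = ∑-swap (Enum.elems EA) (Enum.elems EB)

    sum-sum-* : (f : A → ℤ) (g : B → ℤ) → (∑[ x ] ∑[ y ] f x * g y) ≡ sum f * sum g
    sum-sum-* f g = trans (sum-cong (λ x → sum-*ˡ (f x) g)) (sum-*ʳ (sum g) f)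

    sum-inv : (σ : A → B) (τ : B → A) → (∀ x → τ (σ x) ≡ x) → (∀ y → σ (τ y) ≡ y) →
              ∀ f → (∑[ x ] f (σ x)) ≡ sum f
    sum-inv σ τ τσ στ f = begin
      (∑[ x ] f (σ x))                        ≡⟨ sum-cong (λ x → sym (sum-δ (σ x) f)) ⟩
      (∑[ x ] ∑[ y ] χ (y == σ x) * f y)      ≡⟨ sum-swap _ ⟩
      (∑[ y ] ∑[ x ] χ (y == σ x) * f y)      ≡⟨ sum-cong (λ y → trans (sum-cong (λ x → cong (λ b → χ b * f y) (flip y x))) (sum-δ (τ y) (λ _ → f y))) ⟩
      sum f ∎
      where
      open ≡-Reasoning
      flip : ∀ y x → (y == σ x) ≡ (x == τ y)
      flip y x = iff (λ p → ≡⇒== (trans (sym (τσ x)) (cong τ (sym (==⇒≡ p)))))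
                     (λ p → ≡⇒== (trans (sym (στ y)) (cong σ (sym (==⇒≡ p)))))

    -- The graph of `ι` is counted from the side of `B`: above each `b` lies at most one `a` with
    -- `Q a`, and only if `P b` holds.
    count-inj : (ι : A → B) (Q : A → Bool) (P : B → Bool) → (∀ a → Q a ≡ true → P (ι a) ≡ true) →
                (∀ a a′ → Q a ≡ true → Q a′ ≡ true → ι a ≡ ι a′ → a ≡ a′) →
                (∑[ a ] χ (Q a)) ≤ (∑[ b ] χ (P b))
    count-inj ι Q P h inj = begin
      (∑[ a ] χ (Q a))                         ≡⟨ sum-cong (λ a → sym (sum-δ (ι a) (λ _ → χ (Q a)))) ⟩
      (∑[ a ] ∑[ b ] χ (b == ι a) * χ (Q a))   ≡⟨ sum-swap _ ⟩
      (∑[ b ] ∑[ a ] χ (b == ι a) * χ (Q a))   ≡⟨ sum-cong (λ b → sum-cong (λ a → sym (χ-∧ (b == ι a) (Q a)))) ⟩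
      (∑[ b ] ∑[ a ] χ ((b == ι a) ∧ Q a))     ≤⟨ sum-mono (λ b → at-most-one (λ a → (b == ι a) ∧ Q a) (P b) (hit b) (uniq b)) ⟩
      (∑[ b ] χ (P b)) ∎
      where
      open ℤ.≤-Reasoning
      hit : ∀ b a → (b == ι a) ∧ Q a ≡ true → P b ≡ true
      hit b a p with ==⇒≡ {x = b} {ι a} (∧-elimˡ p)
      ... | refl = h a (∧-elimʳ {ι a == ι a} p)
      uniq : ∀ b a a′ → (b == ι a) ∧ Q a ≡ true → (b == ι a′) ∧ Q a′ ≡ true → a ≡ a′
      uniq b a a′ p q = inj a a′ (∧-elimʳ {b == ι a} p) (∧-elimʳ {b == ι a′} q)
                          (trans (sym (==⇒≡ (∧-elimˡ p))) (==⇒≡ (∧-elimˡ q)))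

  ∑-++ : ∀ {A : Set} (xs ys : List A) f → ∑ (xs List.++ ys) f ≡ ∑ xs f + ∑ ys f
  ∑-++ []       ys f = sym (ℤ.+-identityˡ _)
  ∑-++ (x ∷ xs) ys f = trans (cong (f x +_) (∑-++ xs ys f)) (sym (ℤ.+-assoc (f x) (∑ xs f) (∑ ys f)))

  ∑-map : ∀ {A B : Set} (g : A → B) xs f → ∑ (List.map g xs) f ≡ ∑ xs (λ x → f (g x))
  ∑-map g []       f = refl
  ∑-map g (x ∷ xs) f = cong (f (g x) +_) (∑-map g xs f)

  ∑-cart : ∀ {A B C : Set} (p : A → B → C) xs ys f →
           ∑ (cartesianProductWith p xs ys) f ≡ ∑ xs (λ x → ∑ ys (λ y → f (p x y)))
  ∑-cart p []       ys f = refl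
  ∑-cart p (x ∷ xs) ys f = trans (∑-++ (List.map (p x) ys) _ f)
                             (cong₂ _+_ (∑-map (p x) ys f) (∑-cart p xs ys f))

  ∑-∑-* : ∀ {A B : Set} (xs : List A) (ys : List B) (f : A → ℤ) (g : B → ℤ) →
          ∑ xs (λ x → ∑ ys (λ y → f x * g y)) ≡ ∑ xs f * ∑ ys g
  ∑-∑-* xs ys f g = trans (∑-cong xs (λ x → trans (∑-* ys (f x) g) (*-comm (f x) (∑ ys g))))
                      (trans (∑-* xs (∑ ys g) f) (*-comm (∑ ys g) (∑ xs f)))

  opaque
   instance
     enum-× : ∀ {A B : Set} {{_ : Enum A}} {{_ : Enum B}} → Enum (A × B)
     enum-× {A} {B} {{EA}} {{EB}} = record
       { elems = cartesianProductWith _,_ (Enum.elems EA) (Enum.elems EB)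
       ; _≟_   = _≟×_
       ; once  = λ { (a , b) → begin
           ∑ (cartesianProductWith _,_ (Enum.elems EA) (Enum.elems EB)) (λ x → χ (does (x ≟× (a , b))))
             ≡⟨ ∑-cart _,_ (Enum.elems EA) (Enum.elems EB) _ ⟩
           ∑ (Enum.elems EA) (λ x → ∑ (Enum.elems EB) (λ y → χ (does ((x , y) ≟× (a , b)))))
             ≡⟨ ∑-cong (Enum.elems EA) (λ x → ∑-cong (Enum.elems EB) (λ y → pt x y a b)) ⟩
           ∑ (Enum.elems EA) (λ x → ∑ (Enum.elems EB) (λ y → χ (x == a) * χ (y == b)))
             ≡⟨ ∑-∑-* (Enum.elems EA) (Enum.elems EB) _ _ ⟩
           ∑ (Enum.elems EA) (λ x → χ (x == a)) * ∑ (Enum.elems EB) (λ y → χ (y == b))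
             ≡⟨ trans (cong₂ _*_ (Enum.once EA a) (Enum.once EB b)) (*-identityˡ 1ℤ) ⟩
           1ℤ ∎ }
       }
       where
       open ≡-Reasoning
       _≟×_ : DecidableEquality (A × B)
       (x , y) ≟× (a , b) with x ≟ a | y ≟ b
       ... | yes refl | yes refl = yes refl
       ... | yes _ | no q = no λ { refl → q refl }
       ... | no p | _ = no λ { refl → p refl }
       pt : ∀ x y a b → χ (does ((x , y) ≟× (a , b))) ≡ χ (x == a) * χ (y == b)
       pt x y a b with x ≟ a | y ≟ b
       ... | yes refl | yes refl = sym (*-identityˡ 1ℤ)
       ... | yes refl | no _ = sym (*-identityˡ 0ℤ)
       ... | no _ | q = sym (zeroˡ (χ (does q)))

     enum-Vec : ∀ {A : Set} {n} {{_ : Enum A}} → Enum (Vec A n)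
     enum-Vec {n = ℕ.zero} = record
       { elems = [] ∷ [] ; _≟_ = λ { [] [] → yes refl } ; once = λ { [] → refl } }
     enum-Vec {A} {ℕ.suc n} {{EA}} = record
       { elems = cartesianProductWith _∷_ (Enum.elems EA) (Enum.elems EV)
       ; _≟_   = _≟∷_
       ; once  = λ { (a ∷ b) → begin
           ∑ (cartesianProductWith _∷_ (Enum.elems EA) (Enum.elems EV)) (λ x → χ (does (x ≟∷ (a ∷ b))))
             ≡⟨ ∑-cart _∷_ (Enum.elems EA) (Enum.elems EV) _ ⟩
           ∑ (Enum.elems EA) (λ x → ∑ (Enum.elems EV) (λ y → χ (does ((x ∷ y) ≟∷ (a ∷ b)))))
             ≡⟨ ∑-cong (Enum.elems EA) (λ x → ∑-cong (Enum.elems EV) (λ y → pt x y a b)) ⟩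
           ∑ (Enum.elems EA) (λ x → ∑ (Enum.elems EV) (λ y → χ (x == a) * χ (Enum._==_ EV y b)))
             ≡⟨ ∑-∑-* (Enum.elems EA) (Enum.elems EV) _ _ ⟩
           ∑ (Enum.elems EA) (λ x → χ (x == a)) * ∑ (Enum.elems EV) (λ y → χ (Enum._==_ EV y b))
             ≡⟨ trans (cong₂ _*_ (Enum.once EA a) (Enum.once EV b)) (*-identityˡ 1ℤ) ⟩
           1ℤ ∎ }
       }
       where
       open ≡-Reasoning
       EV : Enum (Vec A n)
       EV = enum-Vec {n = n}
       _≟∷_ : DecidableEquality (Vec A (ℕ.suc n))
       (x ∷ y) ≟∷ (a ∷ b) with x ≟ a | Enum._≟_ EV y b
       ... | yes refl | yes refl = yes refl
       ... | yes _ | no q = no λ { refl → q refl }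
       ... | no p | _ = no λ { refl → p refl }
       pt : ∀ x y a b → χ (does ((x ∷ y) ≟∷ (a ∷ b))) ≡ χ (x == a) * χ (Enum._==_ EV y b)
       pt x y a b with x ≟ a | Enum._≟_ EV y b
       ... | yes refl | yes refl = sym (*-identityˡ 1ℤ)
       ... | yes refl | no _ = sym (*-identityˡ 0ℤ)
       ... | no _ | q = sym (zeroˡ (χ (does q)))

  opaque
    unfolding sum enum-× enum-Vec

    sum-× : ∀ {A B : Set} {{EA : Enum A}} {{EB : Enum B}} (f : A × B → ℤ) → sum f ≡ (∑[ x ] ∑[ y ] f (x , y))
    sum-× {{EA}} {{EB}} = ∑-cart _,_ (Enum.elems EA) (Enum.elems EB)

    sum-[] : ∀ {A : Set} {{_ : Enum A}} (f : Vec A 0 → ℤ) → sum f ≡ f []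
    sum-[] f = ℤ.+-identityʳ (f [])

    sum-∷ : ∀ {A : Set} {n} {{EA : Enum A}} (f : Vec A (ℕ.suc n) → ℤ) → sum f ≡ (∑[ x ] ∑[ y ] f (x ∷ y))
    sum-∷ {n = n} {{EA}} = ∑-cart _∷_ (Enum.elems EA) (Enum.elems (enum-Vec {n = n}))

  card : (A : Set) → {{Enum A}} → ℤ
  card A = sum {A} (λ _ → 1ℤ)

  sum-const : ∀ {A : Set} {{_ : Enum A}} c → sum {A} (λ _ → c) ≡ card A * c
  sum-const {A} c = trans (sum-cong {A} (λ _ → sym (*-identityˡ c))) (sum-*ʳ {A} c (λ _ → 1ℤ))

  -- Finite vector spaces

  -- Equality is propositional, so that scalars and vectors form an `Enum`. The field of the
  -- theorem, which comes with an equivalence relation, is brought into this form in `FieldModel`.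
  record FiniteField : Set₁ where
    infixl 6 _+ᵏ_
    infixl 7 _*ᵏ_
    field
      K      : Set
      _+ᵏ_   : K → K → K
      _*ᵏ_   : K → K → K
      -ᵏ_    : K → K
      0ᵏ 1ᵏ  : K
      isCommutativeRing : IsCommutativeRing _≡_ _+ᵏ_ _*ᵏ_ -ᵏ_ 0ᵏ 1ᵏ
      inverse : ∀ x → ¬ x ≡ 0ᵏ → ∃ λ y → x *ᵏ y ≡ 1ᵏ
      0≢1    : ¬ 0ᵏ ≡ 1ᵏ
      enumK  : Enum K

  module Linear (𝔽 : FiniteField) where
    open FiniteField 𝔽 public
    module K = IsCommutativeRing isCommutativeRing

    ring-K : Ring _ _
    ring-K = record { isRing = K.isRing }

    module K′ = RingProperties ring-K

    instance
      enum-K : Enum K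
      enum-K = enumK

    record VSpace : Set₁ where
      infixl 6 _⊕_
      infixr 7 _·_
      field
        Carrier : Set
        _⊕_     : Carrier → Carrier → Carrier
        ⊖_      : Carrier → Carrier
        𝟎       : Carrier
        _·_     : K → Carrier → Carrier
        isAbelianGroup : IsAbelianGroup _≡_ _⊕_ 𝟎 ⊖_
        ·-distribˡ : ∀ c x y → c · (x ⊕ y) ≡ c · x ⊕ c · y
        ·-distribʳ : ∀ c d x → (c +ᵏ d) · x ≡ c · x ⊕ d · x
        ·-assoc    : ∀ c d x → (c *ᵏ d) · x ≡ c · d · x
        ·-identity : ∀ x → 1ᵏ · x ≡ x
        enumV      : Enum Carrier

      abelianGroup : AbelianGroup _ _
      abelianGroup = record { isAbelianGroup = isAbelianGroup }

    module VS (V : VSpace) where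
      open VSpace V public
      open IsAbelianGroup isAbelianGroup public using ()
        renaming (assoc to ⊕-assoc; comm to ⊕-comm; identityˡ to ⊕-identityˡ; identityʳ to ⊕-identityʳ;
                  inverseˡ to ⊕-inverseˡ; inverseʳ to ⊕-inverseʳ)
      open GroupProperties abelianGroup public using ()
        renaming (∙-cancelˡ to ⊕-cancelˡ; ∙-cancelʳ to ⊕-cancelʳ; inverseʳ-unique to ⊖-unique; ⁻¹-involutive to ⊖-involutive)

      private
        instance
          enum-V : Enum Carrier
          enum-V = enumV

      ·-zeroˡ : ∀ x → 0ᵏ · x ≡ 𝟎
      ·-zeroˡ x = ⊕-cancelˡ (0ᵏ · x) (0ᵏ · x) 𝟎
        (trans (sym (·-distribʳ 0ᵏ 0ᵏ x)) (trans (cong (_· x) (K.+-identityˡ 0ᵏ)) (sym (⊕-identityʳ _))))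

      ·-zeroʳ : ∀ c → c · 𝟎 ≡ 𝟎
      ·-zeroʳ c = ⊕-cancelˡ (c · 𝟎) (c · 𝟎) 𝟎
        (trans (sym (·-distribˡ c 𝟎 𝟎)) (trans (cong (c ·_) (⊕-identityˡ 𝟎)) (sym (⊕-identityʳ _))))

      ·-neg : ∀ c x → (-ᵏ c) · x ≡ ⊖ (c · x)
      ·-neg c x = ⊖-unique (c · x) ((-ᵏ c) · x)
        (trans (sym (·-distribʳ c (-ᵏ c) x)) (trans (cong (_· x) (K.-‿inverseʳ c)) (·-zeroˡ x)))

      ⊕-exchange : ∀ a b c d → (a ⊕ b) ⊕ (c ⊕ d) ≡ (a ⊕ c) ⊕ (b ⊕ d)
      ⊕-exchange a b c d = begin
        (a ⊕ b) ⊕ (c ⊕ d) ≡⟨ ⊕-assoc a b (c ⊕ d) ⟩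
        a ⊕ (b ⊕ (c ⊕ d)) ≡⟨ cong (a ⊕_) (sym (⊕-assoc b c d)) ⟩
        a ⊕ ((b ⊕ c) ⊕ d) ≡⟨ cong (λ z → a ⊕ (z ⊕ d)) (⊕-comm b c) ⟩
        a ⊕ ((c ⊕ b) ⊕ d) ≡⟨ cong (a ⊕_) (⊕-assoc c b d) ⟩
        a ⊕ (c ⊕ (b ⊕ d)) ≡⟨ sym (⊕-assoc a c (b ⊕ d)) ⟩
        (a ⊕ c) ⊕ (b ⊕ d) ∎
        where open ≡-Reasoning

      ⊖⊕ : ∀ a b → (a ⊕ ⊖ b) ⊕ b ≡ a
      ⊖⊕ a b = trans (⊕-assoc a (⊖ b) b) (trans (cong (a ⊕_) (⊕-inverseˡ b)) (⊕-identityʳ a))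

      ⊕⊖ : ∀ a b → (a ⊕ b) ⊕ ⊖ b ≡ a
      ⊕⊖ a b = trans (⊕-assoc a b (⊖ b)) (trans (cong (a ⊕_) (⊕-inverseʳ b)) (⊕-identityʳ a))

      unscale : ∀ {c d} → c *ᵏ d ≡ 1ᵏ → ∀ x → d · c · x ≡ x
      unscale {c} {d} p x = trans (sym (·-assoc d c x))
        (trans (cong (_· x) (trans (K.*-comm d c) p)) (·-identity x))

      sum-shift : ∀ a (f : Carrier → ℤ) → (∑[ x ] f (x ⊕ a)) ≡ sum f
      sum-shift a = sum-inv (_⊕ a) (_⊕ ⊖ a) (λ x → ⊕⊖ x a) (λ x → ⊖⊕ x a)

      sum-scale : ∀ {c} → ¬ c ≡ 0ᵏ → ∀ (f : Carrier → ℤ) → (∑[ x ] f (c · x)) ≡ sum f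
      sum-scale {c} c≢0 with inverse c c≢0
      ... | d , cd = sum-inv (c ·_) (d ·_) (unscale cd) (unscale (trans (K.*-comm d c) cd))

      nz : Carrier → Bool
      nz x = not (x == 𝟎)

      nz-intro : ∀ {x} → ¬ x ≡ 𝟎 → nz x ≡ true
      nz-intro p = not-intro (≢⇒== p)

      nz-elim : ∀ {x} → nz x ≡ true → ¬ x ≡ 𝟎
      nz-elim p q = true≢false (≡⇒== q) (not-elim p)

      nonzero-scalar : ∀ {c x} → ¬ c · x ≡ 𝟎 → ¬ c ≡ 0ᵏ
      nonzero-scalar {c} {x} p refl = p (·-zeroˡ x)

      scale-nonzero : ∀ {c x} → ¬ c ≡ 0ᵏ → ¬ x ≡ 𝟎 → ¬ c · x ≡ 𝟎
      scale-nonzero {c} {x} c≢0 x≢0 p with inverse c c≢0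
      ... | d , cd = x≢0 (trans (sym (unscale cd x)) (trans (cong (d ·_) p) (·-zeroʳ d)))

      scalar-inj : ∀ {c d x} → ¬ x ≡ 𝟎 → c · x ≡ d · x → c ≡ d
      scalar-inj {c} {d} {x} x≢0 p with (c +ᵏ -ᵏ d) ≟ 0ᵏ
      ... | yes q = trans (sym (trans (K.+-assoc c (-ᵏ d) d) (trans (cong (c +ᵏ_) (K.-‿inverseˡ d)) (K.+-identityʳ c))))
                      (trans (cong (_+ᵏ d) q) (K.+-identityˡ d))
      ... | no q = ⊥-elim (scale-nonzero q x≢0 (trans (·-distribʳ c (-ᵏ d) x)
                     (trans (cong (c · x ⊕_) (·-neg d x)) (trans (cong (_⊕ ⊖ (d · x)) p) (⊕-inverseʳ (d · x))))))

      -- For `x` nonzero the value `false` expresses linear independence of `x` and `y`; zero counts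
      -- as a multiple.
      mult : Carrier → Carrier → Bool
      mult x y = ex λ c → y == c · x

      mult-intro : ∀ {x y} c → y ≡ c · x → mult x y ≡ true
      mult-intro {x} {y} c p = ex-intro (λ c → y == c · x) c (≡⇒== p)

      mult-elim : ∀ {x y} → mult x y ≡ true → ∃ λ c → y ≡ c · x
      mult-elim {x} {y} p with ex-elim (λ c → y == c · x) p
      ... | c , q = c , ==⇒≡ q

      indep-coeff : ∀ {x y} → ¬ x ≡ 𝟎 → mult x y ≡ false → ∀ {c d c′ d′} →
                    c · x ⊕ d · y ≡ c′ · x ⊕ d′ · y → c ≡ c′ × d ≡ d′
      indep-coeff {x} {y} x≢0 p {c} {d} {c′} {d′} eq = scalar-inj x≢0 cx , d≡d′
        where
        open ≡-Reasoning
        move : d · y ⊕ ⊖ (d′ · y) ≡ c′ · x ⊕ ⊖ (c · x)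
        move = ⊕-cancelˡ (c · x) _ _ (begin
          c · x ⊕ (d · y ⊕ ⊖ (d′ · y))          ≡⟨ sym (⊕-assoc _ _ _) ⟩
          (c · x ⊕ d · y) ⊕ ⊖ (d′ · y)          ≡⟨ cong (_⊕ ⊖ (d′ · y)) eq ⟩
          (c′ · x ⊕ d′ · y) ⊕ ⊖ (d′ · y)        ≡⟨ ⊕⊖ _ _ ⟩
          c′ · x                               ≡⟨ sym (⊖⊕ (c′ · x) (c · x)) ⟩
          (c′ · x ⊕ ⊖ (c · x)) ⊕ c · x          ≡⟨ ⊕-comm _ _ ⟩
          c · x ⊕ (c′ · x ⊕ ⊖ (c · x))          ∎)
        scaled : (d +ᵏ -ᵏ d′) · y ≡ (c′ +ᵏ -ᵏ c) · x
        scaled = trans (·-distribʳ d (-ᵏ d′) y) (trans (cong (d · y ⊕_) (·-neg d′ y))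
                   (trans move (sym (trans (·-distribʳ c′ (-ᵏ c) x) (cong (c′ · x ⊕_) (·-neg c x))))))
        d≡d′ : d ≡ d′
        d≡d′ with (d +ᵏ -ᵏ d′) ≟ 0ᵏ
        ... | yes q = trans (sym (trans (K.+-assoc d (-ᵏ d′) d′) (trans (cong (d +ᵏ_) (K.-‿inverseˡ d′)) (K.+-identityʳ d))))
                      (trans (cong (_+ᵏ d′) q) (K.+-identityˡ d′))
        ... | no q with inverse _ q
        ...   | e , qe = true≢false (mult-intro (e *ᵏ (c′ +ᵏ -ᵏ c))
                           (trans (sym (unscale qe y)) (trans (cong (e ·_) scaled) (sym (·-assoc e _ x))))) p
        cx : c · x ≡ c′ · x
        cx = ⊕-cancelʳ (d · y) (c · x) (c′ · x) (trans eq (cong (λ z → c′ · x ⊕ z · y) (sym d≡d′)))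

    𝕂 : VSpace
    𝕂 = record
      { Carrier = K ; _⊕_ = _+ᵏ_ ; ⊖_ = -ᵏ_ ; 𝟎 = 0ᵏ ; _·_ = _*ᵏ_
      ; isAbelianGroup = K.+-isAbelianGroup
      ; ·-distribˡ = K.distribˡ ; ·-distribʳ = λ c d x → K.distribʳ x c d
      ; ·-assoc = K.*-assoc ; ·-identity = K.*-identityˡ ; enumV = enumK }

    module _ (V : VSpace) where
      open VS V

      Pow : ℕ → VSpace
      Pow m = record
        { Carrier = Vec Carrier m ; _⊕_ = zipWith _⊕_ ; ⊖_ = map ⊖_ ; 𝟎 = replicate m 𝟎
        ; _·_ = λ c → map (c ·_)
        ; isAbelianGroup = record
          { isGroup = record
            { isMonoid = record
              { isSemigroup = record
                { isMagma = record { isEquivalence = isEquivalence ; ∙-cong = cong₂ (zipWith _⊕_) }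
                ; assoc = Vec.zipWith-assoc ⊕-assoc }
              ; identity = Vec.zipWith-identityˡ ⊕-identityˡ , Vec.zipWith-identityʳ ⊕-identityʳ }
            ; inverse = Vec.zipWith-inverseˡ ⊕-inverseˡ , Vec.zipWith-inverseʳ ⊕-inverseʳ
            ; ⁻¹-cong = cong (map ⊖_) }
          ; comm = Vec.zipWith-comm ⊕-comm }
        ; ·-distribˡ = distˡ ; ·-distribʳ = distʳ ; ·-assoc = ass ; ·-identity = ident
        ; enumV = enum-Vec {{enumV}} }
        where
        distˡ : ∀ {m} c (x y : Vec Carrier m) → map (c ·_) (zipWith _⊕_ x y) ≡ zipWith _⊕_ (map (c ·_) x) (map (c ·_) y)
        distˡ c []      []      = refl
        distˡ c (a ∷ x) (b ∷ y) = cong₂ _∷_ (·-distribˡ c a b) (distˡ c x y)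
        distʳ : ∀ {m} c d (x : Vec Carrier m) → map ((c +ᵏ d) ·_) x ≡ zipWith _⊕_ (map (c ·_) x) (map (d ·_) x)
        distʳ c d []      = refl
        distʳ c d (a ∷ x) = cong₂ _∷_ (·-distribʳ c d a) (distʳ c d x)
        ass : ∀ {m} c d (x : Vec Carrier m) → map ((c *ᵏ d) ·_) x ≡ map (c ·_) (map (d ·_) x)
        ass c d []      = refl
        ass c d (a ∷ x) = cong₂ _∷_ (·-assoc c d a) (ass c d x)
        ident : ∀ {m} (x : Vec Carrier m) → map (1ᵏ ·_) x ≡ x
        ident []      = refl
        ident (a ∷ x) = cong₂ _∷_ (·-identity a) (ident x)

      -- The tuple is read as the linear map from K^k that sends the standard basis to its entries.
      app : ∀ {k} → Vec Carrier k → Vec K k → Carrier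
      app []      []      = 𝟎
      app (v ∷ b) (c ∷ u) = c · v ⊕ app b u

    dot : ∀ {k} → Vec K k → Vec K k → K
    dot = app 𝕂

    module _ (V : VSpace) where
      open VS V
      private
        module U {k} = VS (Pow 𝕂 k)
        module M {k} = VS (Pow V k)

      app-⊕ʳ : ∀ {k} (b : Vec Carrier k) u u′ → app V b (u U.⊕ u′) ≡ app V b u ⊕ app V b u′
      app-⊕ʳ []      []      []        = sym (⊕-identityˡ 𝟎)
      app-⊕ʳ (v ∷ b) (c ∷ u) (c′ ∷ u′) =
        trans (cong₂ _⊕_ (·-distribʳ c c′ v) (app-⊕ʳ b u u′)) (⊕-exchange _ _ _ _)

      app-·ʳ : ∀ {k} (b : Vec Carrier k) d u → app V b (d U.· u) ≡ d · app V b u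
      app-·ʳ []      d []      = sym (·-zeroʳ d)
      app-·ʳ (v ∷ b) d (c ∷ u) = trans (cong₂ _⊕_ (·-assoc d c v) (app-·ʳ b d u)) (sym (·-distribˡ d _ _))

      app-⊕ˡ : ∀ {k} (b b′ : Vec Carrier k) u → app V (b M.⊕ b′) u ≡ app V b u ⊕ app V b′ u
      app-⊕ˡ []      []        []      = sym (⊕-identityˡ 𝟎)
      app-⊕ˡ (v ∷ b) (v′ ∷ b′) (c ∷ u) =
        trans (cong₂ _⊕_ (·-distribˡ c v v′) (app-⊕ˡ b b′ u)) (⊕-exchange _ _ _ _)

      app-·ˡ : ∀ {k} (b : Vec Carrier k) d u → app V (d M.· b) u ≡ d · app V b u
      app-·ˡ []      d []      = sym (·-zeroʳ d)
      app-·ˡ (v ∷ b) d (c ∷ u) = trans (cong₂ _⊕_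
        (trans (sym (·-assoc c d v)) (trans (cong (_· v) (K.*-comm c d)) (·-assoc d c v))) (app-·ˡ b d u))
        (sym (·-distribˡ d _ _))

      app-0ʳ : ∀ {k} (b : Vec Carrier k) → app V b U.𝟎 ≡ 𝟎
      app-0ʳ []      = refl
      app-0ʳ (v ∷ b) = trans (cong₂ _⊕_ (·-zeroˡ v) (app-0ʳ b)) (⊕-identityˡ 𝟎)

      app-⊖ʳ : ∀ {k} (b : Vec Carrier k) u → app V b (U.⊖ u) ≡ ⊖ app V b u
      app-⊖ʳ b u = ⊖-unique _ _ (trans (sym (app-⊕ʳ b u (U.⊖ u))) (trans (cong (app V b) (U.⊕-inverseʳ u)) (app-0ʳ b)))

      app-head : ∀ {k} h (t : Vec Carrier k) → app V (h ∷ t) (1ᵏ ∷ U.𝟎) ≡ h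
      app-head h t = trans (cong₂ _⊕_ (·-identity h) (app-0ʳ t)) (⊕-identityʳ h)

      app-tail : ∀ {k} h (t : Vec Carrier k) w → app V (h ∷ t) (0ᵏ ∷ w) ≡ app V t w
      app-tail h t w = trans (cong (_⊕ app V t w) (·-zeroˡ h)) (⊕-identityˡ (app V t w))

      app-∘ : ∀ {j k} (b : Vec Carrier k) (t : Vec (Vec K k) j) u → app V (map (app V b) t) u ≡ app V b (app (Pow 𝕂 k) t u)
      app-∘ b []      []      = sym (app-0ʳ b)
      app-∘ b (x ∷ t) (c ∷ u) = trans (cong₂ _⊕_ (sym (app-·ʳ b c x)) (app-∘ b t u)) (sym (app-⊕ʳ b (c U.· x) (app (Pow 𝕂 _) t u)))

      -- The rank-one map φ ⊗ z, see `app-outer`. Adding it to a tuple preserves the values on the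
      -- kernel of `φ`.
      outer : ∀ {k} → Vec K k → Carrier → Vec Carrier k
      outer φ z = map (_· z) φ

      app-outer : ∀ {k} (φ : Vec K k) z u → app V (outer φ z) u ≡ dot φ u · z
      app-outer []      z []      = sym (·-zeroˡ z)
      app-outer (d ∷ φ) z (c ∷ u) =
        trans (cong₂ _⊕_ (sym (·-assoc c d z)) (app-outer φ z u)) (sym (·-distribʳ (c *ᵏ d) (dot φ u) z))

      outer-⊕ : ∀ {k} (φ : Vec K k) z w → outer φ (z ⊕ w) ≡ outer φ z M.⊕ outer φ w
      outer-⊕ []      z w = refl
      outer-⊕ (c ∷ φ) z w = cong₂ _∷_ (·-distribˡ c z w) (outer-⊕ φ z w)

    private
      module U {k} = VS (Pow 𝕂 k)

    dual₁ : ∀ {k} (u : Vec K k) → ¬ u ≡ U.𝟎 → ∃ λ φ → dot φ u ≡ 1ᵏ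
    dual₁ [] u≢0 = ⊥-elim (u≢0 refl)
    dual₁ (c ∷ u) u≢0 with c ≟ 0ᵏ
    ... | yes refl with dual₁ u (λ { refl → u≢0 refl })
    ...   | φ , p = 0ᵏ ∷ φ , trans (cong₂ _+ᵏ_ (K.zeroˡ 0ᵏ) p) (K.+-identityˡ 1ᵏ)
    dual₁ (c ∷ u) u≢0 | no c≢0 with inverse c c≢0
    ... | d , cd = d ∷ U.𝟎 , trans (cong₂ _+ᵏ_ cd (dot-0ˡ u)) (K.+-identityʳ 1ᵏ)
      where
      dot-0ˡ : ∀ {k} (u : Vec K k) → dot U.𝟎 u ≡ 0ᵏ
      dot-0ˡ []      = refl
      dot-0ˡ (c ∷ u) = trans (cong₂ _+ᵏ_ (K.zeroʳ c) (dot-0ˡ u)) (K.+-identityˡ 0ᵏ)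

    -- Gram-Schmidt for functionals: `ψ₀` is dual to what remains of `u′` after its `φ₀`-multiple of
    -- `u` is subtracted. Then `ψ₀` is corrected by `φ₀` to vanish at `u`, and `φ₀` by `ψ` to vanish
    -- at `u′`.
    dual₂ : ∀ {k} (u u′ : Vec K k) → ¬ u ≡ U.𝟎 → U.mult u u′ ≡ false →
            ∃ λ φ → ∃ λ ψ → (dot φ u ≡ 1ᵏ × dot φ u′ ≡ 0ᵏ) × (dot ψ u ≡ 0ᵏ × dot ψ u′ ≡ 1ᵏ)
    dual₂ u u′ u≢0 ind with dual₁ u u≢0
    ... | φ₀ , φ₀u with dual₁ (u′ U.⊕ (-ᵏ dot φ₀ u′) U.· u) r≢0
      where
      r≢0 : ¬ u′ U.⊕ (-ᵏ dot φ₀ u′) U.· u ≡ U.𝟎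
      r≢0 p = true≢false (U.mult-intro {x = u} {y = u′} (dot φ₀ u′) (begin
        u′                                       ≡⟨ sym (U.⊕⊖ u′ _) ⟩
        (u′ U.⊕ (-ᵏ dot φ₀ u′) U.· u) U.⊕ U.⊖ ((-ᵏ dot φ₀ u′) U.· u) ≡⟨ cong (λ z → z U.⊕ U.⊖ ((-ᵏ dot φ₀ u′) U.· u)) p ⟩
        U.𝟎 U.⊕ U.⊖ ((-ᵏ dot φ₀ u′) U.· u)      ≡⟨ U.⊕-identityˡ _ ⟩
        U.⊖ ((-ᵏ dot φ₀ u′) U.· u)              ≡⟨ cong U.⊖_ (U.·-neg _ u) ⟩
        U.⊖ (U.⊖ (dot φ₀ u′ U.· u))             ≡⟨ U.⊖-involutive _ ⟩
        dot φ₀ u′ U.· u ∎)) ind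
        where open ≡-Reasoning
    ...   | ψ₀ , ψ₀r = φ , ψ , (φu , φu′) , (ψu , ψu′)
      where
      a b : K
      a = dot ψ₀ u
      b = dot φ₀ u′
      ψ φ : Vec K _
      ψ = ψ₀ U.⊕ (-ᵏ a) U.· φ₀
      φ = φ₀ U.⊕ (-ᵏ b) U.· ψ
      expand : ∀ x c y w → dot (x U.⊕ c U.· y) w ≡ dot x w +ᵏ c *ᵏ dot y w
      expand x c y w = trans (app-⊕ˡ 𝕂 x (c U.· y) w) (cong (dot x w +ᵏ_) (app-·ˡ 𝕂 y c w))
      ψu : dot ψ u ≡ 0ᵏ
      ψu = trans (expand ψ₀ (-ᵏ a) φ₀ u) (trans (cong (λ z → a +ᵏ (-ᵏ a) *ᵏ z) φ₀u)
             (trans (cong (a +ᵏ_) (K.*-identityʳ (-ᵏ a))) (K.-‿inverseʳ a)))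
      ψu′ : dot ψ u′ ≡ 1ᵏ
      ψu′ = begin
        dot ψ u′                       ≡⟨ expand ψ₀ (-ᵏ a) φ₀ u′ ⟩
        dot ψ₀ u′ +ᵏ (-ᵏ a) *ᵏ b       ≡⟨ cong (dot ψ₀ u′ +ᵏ_) swap ⟩
        dot ψ₀ u′ +ᵏ (-ᵏ b) *ᵏ a       ≡⟨ sym (trans (app-⊕ʳ 𝕂 ψ₀ u′ _) (cong (dot ψ₀ u′ +ᵏ_) (app-·ʳ 𝕂 ψ₀ (-ᵏ b) u))) ⟩
        dot ψ₀ (u′ U.⊕ (-ᵏ b) U.· u)   ≡⟨ ψ₀r ⟩
        1ᵏ ∎
        where
        open ≡-Reasoning
        swap : (-ᵏ a) *ᵏ b ≡ (-ᵏ b) *ᵏ a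
        swap = trans (sym (K′.-‿distribˡ-* a b)) (trans (cong -ᵏ_ (K.*-comm a b)) (K′.-‿distribˡ-* b a))
      φu : dot φ u ≡ 1ᵏ
      φu = trans (expand φ₀ (-ᵏ b) ψ u) (trans (cong₂ (λ y z → y +ᵏ (-ᵏ b) *ᵏ z) φ₀u ψu)
             (trans (cong (1ᵏ +ᵏ_) (K.zeroʳ (-ᵏ b))) (K.+-identityʳ 1ᵏ)))
      φu′ : dot φ u′ ≡ 0ᵏ
      φu′ = trans (expand φ₀ (-ᵏ b) ψ u′) (trans (cong (λ z → b +ᵏ (-ᵏ b) *ᵏ z) ψu′)
              (trans (cong (b +ᵏ_) (K.*-identityʳ (-ᵏ b))) (K.-‿inverseʳ b)))

    module _ (M W : VSpace) where
      private
        module M = VS M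
        module W = VS W
        instance
          enum-M : Enum M.Carrier
          enum-M = M.enumV
          enum-W : Enum W.Carrier
          enum-W = W.enumV

      -- All fibres of a surjective homomorphism have the same size. Shifting `b` by a preimage of
      -- `w` turns the sum into that of ψ(L b + w), and summation over all `w` makes the inner sum
      -- independent of `b`.
      equidistribution : (L : M.Carrier → W.Carrier) → (∀ b b′ → L (b M.⊕ b′) ≡ L b W.⊕ L b′) →
        (∀ w → ∃ λ b → L b ≡ w) → ∀ (ψ : W.Carrier → ℤ) →
        card W.Carrier * (∑[ b ] ψ (L b)) ≡ card M.Carrier * sum ψ
      equidistribution L add surj ψ = begin
        card W.Carrier * (∑[ b ] ψ (L b))            ≡⟨ sym (sum-const {W.Carrier} (∑[ b ] ψ (L b))) ⟩
        (∑[ w ] ∑[ b ] ψ (L b))                      ≡⟨ sum-cong {W.Carrier} translate ⟩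
        (∑[ w ] ∑[ b ] ψ (L b W.⊕ w))                ≡⟨ sum-swap {W.Carrier} {M.Carrier} (λ w b → ψ (L b W.⊕ w)) ⟩
        (∑[ b ] ∑[ w ] ψ (L b W.⊕ w))                ≡⟨ sum-cong {M.Carrier} (λ b → trans (sum-cong {W.Carrier} (λ w → cong ψ (W.⊕-comm (L b) w))) (W.sum-shift (L b) ψ)) ⟩
        (∑[ b ] sum ψ)                               ≡⟨ sum-const {M.Carrier} (sum ψ) ⟩
        card M.Carrier * sum ψ                       ∎
        where
        open ≡-Reasoning
        translate : ∀ w → (∑[ b ] ψ (L b)) ≡ (∑[ b ] ψ (L b W.⊕ w))
        translate w with surj w
        ... | b₀ , refl = trans (sym (M.sum-shift b₀ (λ b → ψ (L b)))) (sum-cong {M.Carrier} (λ b → cong ψ (add b b₀)))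

    infixr 8 _^_
    _^_ : ℤ → ℕ → ℤ
    x ^ zero  = 1ℤ
    x ^ suc n = x * x ^ n

    card-Vec : ∀ (A : Set) {{_ : Enum A}} n → card (Vec A n) ≡ card A ^ n
    card-Vec A zero    = sum-[] (λ _ → 1ℤ)
    card-Vec A (suc n) = trans (sum-∷ (λ _ → 1ℤ))
      (trans (sum-const {A} (card (Vec A n))) (cong (card A *_) (card-Vec A n)))

  χ-square : ∀ b → χ b * χ b ≡ χ b
  χ-square true  = *-identityˡ 1ℤ
  χ-square false = zeroˡ 0ℤ

  opaque
    unfolding _*_

    quad-expand : ∀ x a b → (x * a - b) * (x * a - b) ≡ x * x * (a * a) + - pos 2 * x * (a * b) + b * b
    quad-expand = solve-∀ ring

  module _ {A : Set} {{_ : Enum A}} where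

    -- Cauchy-Schwarz without roots or quotients: the squares of x α - β are summed and expanded.
    -- The multiplier `x` is left to each application.
    quadratic-nonneg : ∀ (α β : A → ℤ) x →
      0ℤ ≤ x * x * (∑[ a ] α a * α a) + - pos 2 * x * (∑[ a ] α a * β a) + (∑[ a ] β a * β a)
    quadratic-nonneg α β x = subst (0ℤ ≤_) eq (sum-nonneg (λ a → 0≤square (x * α a - β a)))
      where
      open ≡-Reasoning
      eq : (∑[ a ] (x * α a - β a) * (x * α a - β a)) ≡
           x * x * (∑[ a ] α a * α a) + - pos 2 * x * (∑[ a ] α a * β a) + (∑[ a ] β a * β a)
      eq = begin
        (∑[ a ] (x * α a - β a) * (x * α a - β a))
          ≡⟨ sum-cong (λ a → quad-expand x (α a) (β a)) ⟩
        (∑[ a ] (x * x * (α a * α a) + - pos 2 * x * (α a * β a) + β a * β a))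
          ≡⟨ sum-+ (λ a → x * x * (α a * α a) + - pos 2 * x * (α a * β a)) (λ a → β a * β a) ⟩
        (∑[ a ] (x * x * (α a * α a) + - pos 2 * x * (α a * β a))) + (∑[ a ] β a * β a)
          ≡⟨ cong (_+ (∑[ a ] β a * β a)) (trans (sum-+ (λ a → x * x * (α a * α a)) (λ a → - pos 2 * x * (α a * β a)))
               (cong₂ _+_ (sum-*ˡ (x * x) (λ a → α a * α a)) (sum-*ˡ (- pos 2 * x) (λ a → α a * β a)))) ⟩
        x * x * (∑[ a ] α a * α a) + - pos 2 * x * (∑[ a ] α a * β a) + (∑[ a ] β a * β a) ∎

    sum-split : ∀ (f : A → ℤ) c → (∑[ a ] f a - c) ≡ sum f - card A * c
    sum-split f c = trans (sum-- f (λ _ → c)) (cong (λ z → sum f - z) (sum-const {A} c))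

    1≤card : A → 1ℤ ≤ card A
    1≤card a = single≤ (λ _ → 1ℤ) (λ _ → 0≤pos) a

    0<card : A → 0ℤ < card A
    0<card a = ℤ.<-≤-trans (+<+ (s≤s z≤n)) (1≤card a)

  -- First and second moments of a random tuple

  module Moments (𝔽 : FiniteField) (V : Linear.VSpace 𝔽) (k′ : ℕ) where
    open Linear 𝔽
    open VS V

    instance
      enum-V : Enum Carrier
      enum-V = enumV

    k : ℕ
    k = suc k′

    U M : Set
    U = Vec K k
    M = Vec Carrier k

    module U = VS (Pow 𝕂 k)
    module M = VS (Pow V k)

    infix 8 _⟨_⟩
    _⟨_⟩ : M → U → Carrier
    b ⟨ u ⟩ = app V b u

    -- N₁ counts the nonzero vectors of U. Up to a factor close to 1, P is the number of ordered
    -- bases of the k-spaces through a given point.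
    q A A′ C N₁ a P h : ℤ
    q  = card K
    A  = card Carrier
    A′ = A ^ k′
    C  = card U
    N₁ = ∑[ u ] χ (U.nz u)
    a  = (q - 1ℤ) * A
    P  = N₁ * A′
    h  = (q - 1ℤ) * P

    cardM : card M ≡ A * A′
    cardM = card-Vec Carrier k

    ^-pos : ∀ {x} → 0ℤ < x → ∀ n → 0ℤ < x ^ n
    ^-pos p zero    = +<+ (s≤s z≤n)
    ^-pos p (suc n) = 0<prod p (^-pos p n)

    count-nz : ∀ (W : VSpace) → let open VS W renaming (Carrier to W₀; nz to nz₀; enumV to enumW) in
               sum {{enumW}} (λ x → χ (nz₀ x)) ≡ card W₀ {{enumW}} - 1ℤ
    count-nz W = trans (sum-cong (λ x → χ-not (x == W.𝟎))) (trans (sum-- (λ _ → 1ℤ) (λ x → χ (x == W.𝟎)))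
        (cong (λ z → card W.Carrier - z) (sum-once W.𝟎)))
      where
      module W = VS W
      instance
        enum-W : Enum W.Carrier
        enum-W = W.enumV

    N₁≡ : N₁ ≡ C - 1ℤ
    N₁≡ = count-nz (Pow 𝕂 k)

    0<q-1 : 0ℤ < q - 1ℤ
    0<q-1 = subst (0ℤ <_) (count-nz 𝕂) (ℤ.<-≤-trans (+<+ (s≤s z≤n)) le)
      where
      module KK = VS 𝕂
      le : 1ℤ ≤ (∑[ x ] χ (KK.nz x))
      le = subst (_≤ (∑[ x ] χ (KK.nz x))) (cong χ (KK.nz-intro (λ p → 0≢1 (sym p)))) (single≤ (λ x → χ (KK.nz x)) (λ x → 0≤χ _) 1ᵏ)

    0<q : 0ℤ < q
    0<q = 0<card 0ᵏ

    0<A : 0ℤ < A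
    0<A = 0<card 𝟎

    0<C : 0ℤ < C
    0<C = 0<card U.𝟎

    0<N₁ : 0ℤ < N₁
    0<N₁ = ℤ.<-≤-trans (+<+ (s≤s z≤n)) (subst (_≤ N₁) (cong χ (U.nz-intro {1ᵏ ∷ VS.𝟎 (Pow 𝕂 k′)} (λ p → 0≢1 (sym (hd p)))))
             (single≤ (λ u → χ (U.nz u)) (λ u → 0≤χ (U.nz u)) (1ᵏ ∷ VS.𝟎 (Pow 𝕂 k′))))
      where
      hd : ∀ {x y : K} {n} {xs ys : Vec K n} → x ∷ xs ≡ y ∷ ys → x ≡ y
      hd refl = refl

    0<A′ : 0ℤ < A′
    0<A′ = ^-pos 0<A k′

    0<P : 0ℤ < P
    0<P = 0<prod 0<N₁ 0<A′

    0<a : 0ℤ < a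
    0<a = 0<prod 0<q-1 0<A

    0<h : 0ℤ < h
    0<h = 0<prod 0<q-1 0<P

    0≤q-1 : 0ℤ ≤ q - 1ℤ
    0≤q-1 = <⇒0≤ 0<q-1

    eval-one : ∀ {u} → ¬ u ≡ U.𝟎 → ∀ (ψ : Carrier → ℤ) → A * (∑[ b ] ψ (b ⟨ u ⟩)) ≡ card M * sum ψ
    eval-one {u} u≢0 = equidistribution (Pow V k) V (_⟨ u ⟩) (λ b b′ → app-⊕ˡ V b b′ u) surj
      where
      surj : ∀ w → ∃ λ b → b ⟨ u ⟩ ≡ w
      surj w with dual₁ u u≢0
      ... | φ , φu = outer V φ w , trans (app-outer V φ w u) (trans (cong (_· w) φu) (·-identity w))

    -- Pairwise independence of the values of a random tuple: with functionals dual to `u` and `u′`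
    -- a tuple can be built for any prescribed pair of values, so evaluation at both vectors is onto
    -- V².
    eval-two : ∀ {u u′} → ¬ u ≡ U.𝟎 → U.mult u u′ ≡ false → ∀ (ψ ξ : Carrier → ℤ) →
               A * A * (∑[ b ] ψ (b ⟨ u ⟩) * ξ (b ⟨ u′ ⟩)) ≡ card M * (sum ψ * sum ξ)
    eval-two {u} {u′} u≢0 ind ψ ξ = begin
      A * A * (∑[ b ] ψ (b ⟨ u ⟩) * ξ (b ⟨ u′ ⟩))
        ≡⟨ cong (_* (∑[ b ] ψ (b ⟨ u ⟩) * ξ (b ⟨ u′ ⟩))) (sym (trans (card-Vec Carrier 2) (cong (A *_) (*-identityʳ A)))) ⟩
      card (Vec Carrier 2) * (∑[ b ] Ψ (b ⟨ u ⟩ ∷ b ⟨ u′ ⟩ ∷ []))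
        ≡⟨ equidistribution (Pow V k) (Pow V 2) (λ b → b ⟨ u ⟩ ∷ b ⟨ u′ ⟩ ∷ [])
             (λ b b′ → cong₂ (λ x y → x ∷ y ∷ []) (app-⊕ˡ V b b′ u) (app-⊕ˡ V b b′ u′)) surj Ψ ⟩
      card M * sum Ψ
        ≡⟨ cong (card M *_) (trans (sum-∷ Ψ) (trans (sum-cong (λ v → trans (sum-∷ (λ w → Ψ (v ∷ w)))
             (sum-cong (λ w → sum-[] (λ e → Ψ (v ∷ w ∷ e)))))) (sum-sum-* ψ ξ))) ⟩
      card M * (sum ψ * sum ξ) ∎
      where
      open ≡-Reasoning
      Ψ : Vec Carrier 2 → ℤ
      Ψ (v ∷ w ∷ []) = ψ v * ξ w
      surj : ∀ w → ∃ λ b → (b ⟨ u ⟩ ∷ b ⟨ u′ ⟩ ∷ []) ≡ w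
      surj (w ∷ w′ ∷ []) = build (dual₂ u u′ u≢0 ind)
        where
        build : (∃ λ φ → ∃ λ φ′ → (dot φ u ≡ 1ᵏ × dot φ u′ ≡ 0ᵏ) × (dot φ′ u ≡ 0ᵏ × dot φ′ u′ ≡ 1ᵏ)) →
                ∃ λ b → (b ⟨ u ⟩ ∷ b ⟨ u′ ⟩ ∷ []) ≡ w ∷ w′ ∷ []
        build (φ , φ′ , (φu , φu′) , (φ′u , φ′u′)) = outer V φ w M.⊕ outer V φ′ w′ ,
          cong₂ (λ x y → x ∷ y ∷ [])
            (trans (val u) (trans (cong₂ (λ c d → c · w ⊕ d · w′) φu φ′u)
              (trans (cong₂ _⊕_ (·-identity w) (·-zeroˡ w′)) (⊕-identityʳ w))))
            (trans (val u′) (trans (cong₂ (λ c d → c · w ⊕ d · w′) φu′ φ′u′)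
              (trans (cong₂ _⊕_ (·-zeroˡ w) (·-identity w′)) (⊕-identityˡ w′))))
          where
          val : ∀ x → app V (outer V φ w M.⊕ outer V φ′ w′) x ≡ dot φ x · w ⊕ dot φ′ x · w′
          val x = trans (app-⊕ˡ V (outer V φ w) (outer V φ′ w′) x) (cong₂ _⊕_ (app-outer V φ w x) (app-outer V φ′ w′ x))

    G : (U → Bool) → (Carrier → ℤ) → M → ℤ
    G S g b = ∑[ u ] χ (S u) * g (b ⟨ u ⟩)

    module _ (g : Carrier → ℤ) (sum-g : sum g ≡ 0ℤ) (g-scale : ∀ c v → ¬ c ≡ 0ᵏ → g (c · v) ≡ g v)
             (S : U → Bool) (S-nz : ∀ u → S u ≡ true → ¬ u ≡ U.𝟎) where
      private
        E B : ℤ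
        E = ∑[ v ] g v * g v
        B = card M * E

        I : U → U → ℤ
        I u u′ = ∑[ b ] g (b ⟨ u ⟩) * g (b ⟨ u′ ⟩)

        -- The number of nonzero scalars taking `u` to `u′`. It stands in for the indicator of
        -- proportionality because its sum over `u′` is q - 1 at once.
        m : U → U → ℤ
        m u u′ = ∑[ c ] χ (VS.nz 𝕂 c) * χ (u′ == c U.· u)

        0≤B : 0ℤ ≤ B
        0≤B = 0≤prod (sum-nonneg {M} (λ _ → 0≤pos)) (sum-nonneg (λ v → 0≤square (g v)))

        0≤m : ∀ u u′ → 0ℤ ≤ m u u′
        0≤m u u′ = sum-nonneg (λ c → 0≤prod (0≤χ _) (0≤χ (u′ == c U.· u)))

        I-indep : ∀ {u u′} → ¬ u ≡ U.𝟎 → U.mult u u′ ≡ false → I u u′ ≡ 0ℤ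
        I-indep u≢0 ind = *-cancelˡ-≡ (0<prod 0<A 0<A) (trans (eval-two u≢0 ind g g)
          (trans (cong (card M *_) (trans (cong (_* sum g) sum-g) (zeroˡ (sum g))))
            (trans (zeroʳ (card M)) (sym (zeroʳ (A * A))))))

        I-mult : ∀ {u u′} c → ¬ u ≡ U.𝟎 → ¬ c ≡ 0ᵏ → u′ ≡ c U.· u → A * I u u′ ≡ B
        I-mult {u} c u≢0 c≢0 refl = trans (cong (A *_) (sum-cong (λ b → cong (g (b ⟨ u ⟩) *_)
          (trans (cong g (app-·ʳ V b c u)) (g-scale c (b ⟨ u ⟩) c≢0))))) (eval-one u≢0 (λ v → g v * g v))

        1≤m : ∀ {u u′} c → ¬ c ≡ 0ᵏ → u′ ≡ c U.· u → 1ℤ ≤ m u u′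
        1≤m {u} {u′} c c≢0 p = subst (_≤ m u u′)
          (trans (cong₂ (λ x y → χ x * χ y) (VS.nz-intro 𝕂 c≢0) (≡⇒== p)) (*-identityˡ 1ℤ))
          (single≤ (λ c → χ (VS.nz 𝕂 c) * χ (u′ == c U.· u)) (λ c → 0≤prod (0≤χ _) (0≤χ (u′ == c U.· u))) c)

        pair-bound : ∀ {u} → ¬ u ≡ U.𝟎 → ∀ u′ → ¬ u′ ≡ U.𝟎 → A * I u u′ ≤ m u u′ * B
        pair-bound {u} u≢0 u′ u′≢0 with bool-cases (U.mult u u′)
        ... | inj₂ ind = subst (_≤ m u u′ * B) (sym (trans (cong (A *_) (I-indep u≢0 ind)) (zeroʳ A))) (0≤prod (0≤m u u′) 0≤B)
        ... | inj₁ dep with U.mult-elim dep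
        ...   | c , p = subst (_≤ m u u′ * B) (trans (*-identityˡ B) (sym (I-mult c u≢0 c≢0 p))) (*-monoʳ 0≤B (1≤m c c≢0 p))
          where
          c≢0 : ¬ c ≡ 0ᵏ
          c≢0 = U.nonzero-scalar (λ z → u′≢0 (trans p z))

        sum-m : ∀ u → (∑[ u′ ] m u u′) ≡ q - 1ℤ
        sum-m u = trans (sum-swap (λ u′ c → χ (VS.nz 𝕂 c) * χ (u′ == c U.· u)))
          (trans (sum-cong (λ c → trans (sum-*ˡ (χ (VS.nz 𝕂 c)) (λ u′ → χ (u′ == c U.· u)))
            (trans (cong (χ (VS.nz 𝕂 c) *_) (sum-once (c U.· u))) (*-identityʳ _)))) (count-nz 𝕂))

        term : ∀ u u′ → A * (χ (S u) * χ (S u′) * I u u′) ≤ χ (S u) * (m u u′ * B)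
        term u u′ with bool-cases (S u)
        ... | inj₂ p = ℤ.≤-reflexive (trans (cong (λ s → A * (χ s * χ (S u′) * I u u′)) p) (trans (z A (χ (S u′)) (I u u′))
                         (sym (trans (cong (λ s → χ s * (m u u′ * B)) p) (zeroˡ _)))))
          where
          opaque
            unfolding _*_
            z : ∀ x y w → x * (0ℤ * y * w) ≡ 0ℤ
            z = solve-∀ ring
        ... | inj₁ p with bool-cases (S u′)
        ...   | inj₂ p′ = subst₂ _≤_ (sym (trans (cong (λ s → A * (χ (S u) * χ s * I u u′)) p′) (z A (χ (S u)) (I u u′))))
                            refl (0≤prod (0≤χ (S u)) (0≤prod (0≤m u u′) 0≤B))
          where
          opaque
            unfolding _*_
            z : ∀ x y w → x * (y * 0ℤ * w) ≡ 0ℤ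
            z = solve-∀ ring
        ...   | inj₁ p′ = subst₂ _≤_
            (sym (trans (cong₂ (λ s s′ → A * (χ s * χ s′ * I u u′)) p p′) (one A (I u u′))))
            (sym (trans (cong (λ s → χ s * (m u u′ * B)) p) (*-identityˡ _)))
            (pair-bound (S-nz u p) u′ (S-nz u′ p′))
          where
          opaque
            unfolding _*_
            one : ∀ x w → x * (1ℤ * 1ℤ * w) ≡ x * w
            one = solve-∀ ring

      G-square : (∑[ b ] G S g b * G S g b) ≡ (∑[ u ] ∑[ u′ ] χ (S u) * χ (S u′) * I u u′)
      G-square = begin
        (∑[ b ] G S g b * G S g b)
          ≡⟨ sum-cong (λ b → sym (sum-sum-* (λ u → χ (S u) * g (b ⟨ u ⟩)) (λ u → χ (S u) * g (b ⟨ u ⟩)))) ⟩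
        (∑[ b ] ∑[ u ] ∑[ u′ ] χ (S u) * g (b ⟨ u ⟩) * (χ (S u′) * g (b ⟨ u′ ⟩)))
          ≡⟨ sum-swap (λ b u → ∑[ u′ ] χ (S u) * g (b ⟨ u ⟩) * (χ (S u′) * g (b ⟨ u′ ⟩))) ⟩
        (∑[ u ] ∑[ b ] ∑[ u′ ] χ (S u) * g (b ⟨ u ⟩) * (χ (S u′) * g (b ⟨ u′ ⟩)))
          ≡⟨ sum-cong (λ u → sum-swap (λ b u′ → χ (S u) * g (b ⟨ u ⟩) * (χ (S u′) * g (b ⟨ u′ ⟩)))) ⟩
        (∑[ u ] ∑[ u′ ] ∑[ b ] χ (S u) * g (b ⟨ u ⟩) * (χ (S u′) * g (b ⟨ u′ ⟩)))
          ≡⟨ sum-cong (λ u → sum-cong (λ u′ → trans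
               (sum-cong (λ b → rearrange (χ (S u)) (g (b ⟨ u ⟩)) (χ (S u′)) (g (b ⟨ u′ ⟩))))
               (sum-*ˡ (χ (S u) * χ (S u′)) (λ b → g (b ⟨ u ⟩) * g (b ⟨ u′ ⟩))))) ⟩
        (∑[ u ] ∑[ u′ ] χ (S u) * χ (S u′) * I u u′) ∎
        where
        open ≡-Reasoning
        opaque
          unfolding _*_
          rearrange : ∀ s x s′ x′ → s * x * (s′ * x′) ≡ s * s′ * (x * x′)
          rearrange = solve-∀ ring

      -- In the expansion of the square only proportional `u` and `u′` survive: for independent ones
      -- `eval-two` produces the factor (Σ g)² = 0. Each `u` has q - 1 nonzero multiples, and at
      -- their images `g` takes the same value by `g-scale`.
      second-moment : A * (∑[ b ] G S g b * G S g b) ≤ (∑[ u ] χ (S u)) * ((q - 1ℤ) * (card M * (∑[ v ] g v * g v)))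
      second-moment = begin
        A * (∑[ b ] G S g b * G S g b)                            ≡⟨ cong (A *_) G-square ⟩
        A * (∑[ u ] ∑[ u′ ] χ (S u) * χ (S u′) * I u u′)          ≡⟨ sym (sum-*ˡ A (λ u → ∑[ u′ ] χ (S u) * χ (S u′) * I u u′)) ⟩
        (∑[ u ] A * (∑[ u′ ] χ (S u) * χ (S u′) * I u u′))        ≡⟨ sum-cong (λ u → sym (sum-*ˡ A (λ u′ → χ (S u) * χ (S u′) * I u u′))) ⟩
        (∑[ u ] ∑[ u′ ] A * (χ (S u) * χ (S u′) * I u u′))        ≤⟨ sum-mono (λ u → sum-mono (term u)) ⟩
        (∑[ u ] ∑[ u′ ] χ (S u) * (m u u′ * B))                   ≡⟨ sum-cong (λ u → trans (sum-*ˡ (χ (S u)) (λ u′ → m u u′ * B))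
                                                                       (cong (χ (S u) *_) (trans (sum-*ʳ B (m u)) (cong (_* B) (sum-m u))))) ⟩
        (∑[ u ] χ (S u) * ((q - 1ℤ) * B))                         ≡⟨ sum-*ʳ ((q - 1ℤ) * B) (λ u → χ (S u)) ⟩
        (∑[ u ] χ (S u)) * ((q - 1ℤ) * B)                         ∎
        where open ℤ.≤-Reasoning

  -- Degrees of points and the two Cauchy-Schwarz inequalities

  module Energy (𝔽 : FiniteField) (V : Linear.VSpace 𝔽) (k′ : ℕ) where
    open Linear 𝔽
    open VS V
    open Moments 𝔽 V k′

    -- For φ ≠ 0 the tuples b and b + φ ⊗ z agree on the hyperplane of U orthogonal to φ.
    T : (M → Bool) → ℤ
    T F = ∑[ φ ] ∑[ z ] ∑[ b ] χ (F b) * χ (F (b M.⊕ outer V φ z))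

    size : (M → Bool) → ℤ
    size F = ∑[ b ] χ (F b)

    -- For injective members and `v` nonzero this is the number of members through `v`; in general
    -- each member is weighted by its nonzero preimages of `v`.
    deg : (M → Bool) → Carrier → ℤ
    deg F v = ∑[ b ] χ (F b) * (∑[ u ] χ (U.nz u) * χ (b ⟨ u ⟩ == v))

    perp : ∀ u → ¬ u ≡ U.𝟎 → q * (∑[ φ ] χ (dot φ u == 0ᵏ)) ≡ C
    perp u u≢0 = trans (equidistribution (Pow 𝕂 k) 𝕂 (λ φ → dot φ u) (λ φ φ′ → app-⊕ˡ 𝕂 φ φ′ u) surj (λ c → χ (c == 0ᵏ)))
        (trans (cong (C *_) (sum-once 0ᵏ)) (*-identityʳ C))
      where
      surj : ∀ c → ∃ λ φ → dot φ u ≡ c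
      surj c with dual₁ u u≢0
      ... | φ , φu = c U.· φ , trans (app-·ˡ 𝕂 φ c u) (trans (cong (c *ᵏ_) φu) (K.*-identityʳ c))

    module _ (F : M → Bool) where
      private
        f : Carrier → ℤ
        f = deg F
        sz : ℤ
        sz = size F

      -- `Ψ` is a rescaled variance of the degree: `g` is `A` times the deviation from the mean N₁
      -- sz / A, and the squares of `g` sum to A Ψ.
      Φ Ψ : ℤ
      Φ = ∑[ v ] f v * f v
      Ψ = A * Φ - (N₁ * sz) * (N₁ * sz)

      -- `deg` is adjoint to evaluation: a weighted sum over points becomes a sum over the members
      -- and their vectors.
      deg-pairing : ∀ (w : Carrier → ℤ) → (∑[ v ] f v * w v) ≡ (∑[ b ] χ (F b) * (∑[ u ] χ (U.nz u) * w (b ⟨ u ⟩)))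
      deg-pairing w = begin
        (∑[ v ] f v * w v)
          ≡⟨ sum-cong (λ v → sym (sum-*ʳ (w v) (λ b → χ (F b) * (∑[ u ] χ (U.nz u) * χ (b ⟨ u ⟩ == v))))) ⟩
        (∑[ v ] ∑[ b ] χ (F b) * (∑[ u ] χ (U.nz u) * χ (b ⟨ u ⟩ == v)) * w v)
          ≡⟨ sum-swap (λ v b → χ (F b) * (∑[ u ] χ (U.nz u) * χ (b ⟨ u ⟩ == v)) * w v) ⟩
        (∑[ b ] ∑[ v ] χ (F b) * (∑[ u ] χ (U.nz u) * χ (b ⟨ u ⟩ == v)) * w v)
          ≡⟨ sum-cong (λ b → trans (sum-cong (λ v → *-assoc (χ (F b)) (∑[ u ] χ (U.nz u) * χ (b ⟨ u ⟩ == v)) (w v)))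
               (trans (sum-*ˡ (χ (F b)) (λ v → (∑[ u ] χ (U.nz u) * χ (b ⟨ u ⟩ == v)) * w v)) (cong (χ (F b) *_) (inner b)))) ⟩
        (∑[ b ] χ (F b) * (∑[ u ] χ (U.nz u) * w (b ⟨ u ⟩))) ∎
        where
        open ≡-Reasoning
        inner : ∀ b → (∑[ v ] (∑[ u ] χ (U.nz u) * χ (b ⟨ u ⟩ == v)) * w v) ≡ (∑[ u ] χ (U.nz u) * w (b ⟨ u ⟩))
        inner b = begin
          (∑[ v ] (∑[ u ] χ (U.nz u) * χ (b ⟨ u ⟩ == v)) * w v)
            ≡⟨ sum-cong (λ v → sym (sum-*ʳ (w v) (λ u → χ (U.nz u) * χ (b ⟨ u ⟩ == v)))) ⟩
          (∑[ v ] ∑[ u ] χ (U.nz u) * χ (b ⟨ u ⟩ == v) * w v)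
            ≡⟨ sum-swap (λ v u → χ (U.nz u) * χ (b ⟨ u ⟩ == v) * w v) ⟩
          (∑[ u ] ∑[ v ] χ (U.nz u) * χ (b ⟨ u ⟩ == v) * w v)
            ≡⟨ sum-cong (λ u → trans (sum-cong (λ v → *-assoc (χ (U.nz u)) (χ (b ⟨ u ⟩ == v)) (w v)))
                 (trans (sum-*ˡ (χ (U.nz u)) (λ v → χ (b ⟨ u ⟩ == v) * w v)) (cong (χ (U.nz u) *_) (sum-δ′ (b ⟨ u ⟩) w)))) ⟩
          (∑[ u ] χ (U.nz u) * w (b ⟨ u ⟩)) ∎

      sum-deg : sum f ≡ N₁ * sz
      sum-deg = begin
        sum f                                               ≡⟨ sum-cong (λ v → sym (*-identityʳ (f v))) ⟩
        (∑[ v ] f v * 1ℤ)                                   ≡⟨ deg-pairing (λ _ → 1ℤ) ⟩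
        (∑[ b ] χ (F b) * (∑[ u ] χ (U.nz u) * 1ℤ))         ≡⟨ sum-*ʳ (∑[ u ] χ (U.nz u) * 1ℤ) (λ b → χ (F b)) ⟩
        sz * (∑[ u ] χ (U.nz u) * 1ℤ)                       ≡⟨ cong (sz *_) (sum-cong (λ u → *-identityʳ (χ (U.nz u)))) ⟩
        sz * N₁                                             ≡⟨ *-comm sz N₁ ⟩
        N₁ * sz                                             ∎
        where open ≡-Reasoning

      deg-scale : ∀ c v → ¬ c ≡ 0ᵏ → f (c · v) ≡ f v
      deg-scale c v c≢0 = sum-cong (λ b → cong (χ (F b) *_) (begin
        (∑[ u ] χ (U.nz u) * χ (b ⟨ u ⟩ == c · v))                    ≡⟨ sym (U.sum-scale c≢0 (λ u → χ (U.nz u) * χ (b ⟨ u ⟩ == c · v))) ⟩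
        (∑[ u ] χ (U.nz (c U.· u)) * χ (b ⟨ c U.· u ⟩ == c · v))      ≡⟨ sum-cong (λ u → cong₂ (λ x y → χ x * χ y) (nz-scale u) (eq-scale b u)) ⟩
        (∑[ u ] χ (U.nz u) * χ (b ⟨ u ⟩ == v))                        ∎))
        where
        open ≡-Reasoning
        nz-scale : ∀ u → U.nz (c U.· u) ≡ U.nz u
        nz-scale u = iff (λ p → U.nz-intro {u} (λ { refl → U.nz-elim {c U.· u} p (U.·-zeroʳ c) }))
                         (λ p → U.nz-intro {c U.· u} (U.scale-nonzero c≢0 (U.nz-elim {u} p)))
        cancel : ∀ x y → c · x ≡ c · y → x ≡ y
        cancel x y p = let d , cd = inverse c c≢0 in
          trans (sym (unscale cd x)) (trans (cong (d ·_) p) (unscale cd y))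
        eq-scale : ∀ b u → (b ⟨ c U.· u ⟩ == c · v) ≡ (b ⟨ u ⟩ == v)
        eq-scale b u = iff (λ p → ≡⇒== (cancel _ _ (trans (sym (app-·ʳ V b c u)) (==⇒≡ p))))
                           (λ p → ≡⇒== (trans (app-·ʳ V b c u) (cong (c ·_) (==⇒≡ p))))

      g : Carrier → ℤ
      g v = A * f v - N₁ * sz

      private
        opaque
          unfolding _*_
          z₁ : ∀ a x → a * x - a * x ≡ 0ℤ
          z₁ = solve-∀ ring
          z₂ : ∀ a f s x → (a * f - s) * x ≡ a * (f * x) - s * x
          z₂ = solve-∀ ring

      sum-g : sum g ≡ 0ℤ
      sum-g = trans (sum-split (λ v → A * f v) (N₁ * sz))
        (trans (cong (λ x → x - A * (N₁ * sz)) (trans (sum-*ˡ A f) (cong (A *_) sum-deg))) (z₁ A (N₁ * sz)))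

      g-scale : ∀ c v → ¬ c ≡ 0ᵏ → g (c · v) ≡ g v
      g-scale c v c≢0 = cong (λ x → A * x - N₁ * sz) (deg-scale c v c≢0)

      sum-fg : (∑[ v ] f v * g v) ≡ Ψ
      sum-fg = begin
        (∑[ v ] f v * g v)                                     ≡⟨ sum-cong (λ v → trans (*-comm (f v) (g v)) (z₂ A (f v) (N₁ * sz) (f v))) ⟩
        (∑[ v ] A * (f v * f v) - N₁ * sz * f v)               ≡⟨ sum-- (λ v → A * (f v * f v)) (λ v → N₁ * sz * f v) ⟩
        (∑[ v ] A * (f v * f v)) - (∑[ v ] N₁ * sz * f v)      ≡⟨ cong₂ _-_ (sum-*ˡ A (λ v → f v * f v)) (trans (sum-*ˡ (N₁ * sz) f) (cong (N₁ * sz *_) sum-deg)) ⟩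
        Ψ ∎
        where open ≡-Reasoning

      sum-gg : (∑[ v ] g v * g v) ≡ A * Ψ
      sum-gg = begin
        (∑[ v ] g v * g v)                                     ≡⟨ sum-cong (λ v → z₂ A (f v) (N₁ * sz) (g v)) ⟩
        (∑[ v ] A * (f v * g v) - N₁ * sz * g v)               ≡⟨ sum-- (λ v → A * (f v * g v)) (λ v → N₁ * sz * g v) ⟩
        (∑[ v ] A * (f v * g v)) - (∑[ v ] N₁ * sz * g v)      ≡⟨ cong₂ _-_ (trans (sum-*ˡ A (λ v → f v * g v)) (cong (A *_) sum-fg))
                                                                   (trans (sum-*ˡ (N₁ * sz) g) (trans (cong (N₁ * sz *_) sum-g) (zeroʳ (N₁ * sz)))) ⟩
        A * Ψ - 0ℤ                                             ≡⟨ ℤ.+-identityʳ (A * Ψ) ⟩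
        A * Ψ ∎
        where open ≡-Reasoning

      private
        opaque
          unfolding _*_
          arrange₁ : ∀ n q1 a a′ ψ → n * (q1 * (a * a′ * (a * ψ))) ≡ a * (q1 * a * (n * a′) * ψ)
          arrange₁ = solve-∀ ring
          arrange₂ : ∀ x s ψ → x * x * s + - pos 2 * x * ψ + x * ψ ≡ x * (x * s - ψ)
          arrange₂ = solve-∀ ring

      -- The indicator of `F` is paired with `G U.nz g`: the inner product is Ψ, and `second-moment`
      -- bounds the square norm of the latter by a P Ψ. With the multiplier x = a P the three terms
      -- become x² sz - 2xΨ + xΨ = x (x sz - Ψ).
      variance-bound : Ψ ≤ a * P * sz
      variance-bound = ℤ.0≤i-j⇒j≤i (*-cancelˡ 0<aP (subst₂ _≤_ (sym (zeroʳ (a * P))) (arrange₂ (a * P) sz Ψ)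
        (ℤ.≤-trans nonneg (ℤ.+-monoʳ-≤ (a * P * (a * P) * sz + - pos 2 * (a * P) * Ψ) GG≤))))
        where
        0<aP : 0ℤ < a * P
        0<aP = 0<prod 0<a 0<P
        GG : ℤ
        GG = ∑[ b ] G U.nz g b * G U.nz g b
        GG≤ : GG ≤ a * P * Ψ
        GG≤ = *-cancelˡ 0<A (subst (A * GG ≤_) (trans (cong₂ (λ x y → N₁ * ((q - 1ℤ) * (x * y))) cardM sum-gg)
                (arrange₁ N₁ (q - 1ℤ) A A′ Ψ)) (second-moment g sum-g g-scale U.nz (λ u → U.nz-elim {u})))
        nonneg : 0ℤ ≤ a * P * (a * P) * sz + - pos 2 * (a * P) * Ψ + GG
        nonneg = subst (0ℤ ≤_) (cong₂ (λ x y → a * P * (a * P) * x + - pos 2 * (a * P) * y + GG)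
          (sum-cong (λ b → χ-square (F b))) (trans (sym (deg-pairing g)) sum-fg))
          (quadratic-nonneg (λ b → χ (F b)) (G U.nz g) (a * P))

      -- Cauchy–Schwarz for the number of members in the coset b + φ ⊗ V, projected onto the
      -- function G (Sφ φ) g, which is constant on these cosets.
      private
        shift : (φ : U) → M → ℤ
        shift φ b = ∑[ z ] χ (F (b M.⊕ outer V φ z))

        Sφ : U → U → Bool
        Sφ φ u = U.nz u ∧ (dot φ u == 0ᵏ)

        Tφ X GGφ : U → ℤ
        Tφ φ = ∑[ z ] ∑[ b ] χ (F b) * χ (F (b M.⊕ outer V φ z))
        X φ = ∑[ b ] χ (F b) * G (Sφ φ) g b
        GGφ φ = ∑[ b ] G (Sφ φ) g b * G (Sφ φ) g b

        G-invariant : ∀ φ z b → G (Sφ φ) g (b M.⊕ outer V φ z) ≡ G (Sφ φ) g b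
        G-invariant φ z b = sum-cong pt
          where
          pt : ∀ u → χ (Sφ φ u) * g ((b M.⊕ outer V φ z) ⟨ u ⟩) ≡ χ (Sφ φ u) * g (b ⟨ u ⟩)
          pt u with bool-cases (Sφ φ u)
          ... | inj₂ p = trans (cong (λ s → χ s * g ((b M.⊕ outer V φ z) ⟨ u ⟩)) p)
                           (trans (zeroˡ _) (sym (trans (cong (λ s → χ s * g (b ⟨ u ⟩)) p) (zeroˡ _))))
          ... | inj₁ p = cong (λ v → χ (Sφ φ u) * g v) (trans (app-⊕ˡ V b (outer V φ z) u)
                           (trans (cong (b ⟨ u ⟩ ⊕_) (trans (app-outer V φ z u)
                             (trans (cong (_· z) (==⇒≡ (∧-elimʳ {U.nz u} p))) (·-zeroˡ z)))) (⊕-identityʳ (b ⟨ u ⟩))))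

        shift-G : ∀ φ → (∑[ b ] shift φ b * G (Sφ φ) g b) ≡ A * X φ
        shift-G φ = begin
          (∑[ b ] shift φ b * G (Sφ φ) g b)
            ≡⟨ sum-cong (λ b → sym (sum-*ʳ (G (Sφ φ) g b) (λ z → χ (F (b M.⊕ outer V φ z))))) ⟩
          (∑[ b ] ∑[ z ] χ (F (b M.⊕ outer V φ z)) * G (Sφ φ) g b)
            ≡⟨ sum-swap (λ b z → χ (F (b M.⊕ outer V φ z)) * G (Sφ φ) g b) ⟩
          (∑[ z ] ∑[ b ] χ (F (b M.⊕ outer V φ z)) * G (Sφ φ) g b)
            ≡⟨ sum-cong (λ z → trans (sum-cong (λ b → cong (χ (F (b M.⊕ outer V φ z)) *_) (sym (G-invariant φ z b))))
                 (M.sum-shift (outer V φ z) (λ b → χ (F b) * G (Sφ φ) g b))) ⟩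
          (∑[ z ] X φ)
            ≡⟨ sum-const {Carrier} (X φ) ⟩
          A * X φ ∎
          where open ≡-Reasoning

        -- The substitution of w + z for `w` and the translation of `b` by φ ⊗ z make every `z`
        -- contribute the same amount.
        shift-shift : ∀ φ → (∑[ b ] shift φ b * shift φ b) ≡ A * Tφ φ
        shift-shift φ = begin
          (∑[ b ] shift φ b * shift φ b)
            ≡⟨ sum-cong (λ b → sym (sum-sum-* (λ z → χ (F (b M.⊕ o z))) (λ z → χ (F (b M.⊕ o z))))) ⟩
          (∑[ b ] ∑[ z ] ∑[ w ] χ (F (b M.⊕ o z)) * χ (F (b M.⊕ o w)))
            ≡⟨ sum-cong (λ b → sum-cong (λ z → sym (trans
                 (sum-cong (λ w → cong (λ y → χ (F (b M.⊕ o z)) * χ (F y)) (slide b z w)))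
                 (sum-shift z (λ w → χ (F (b M.⊕ o z)) * χ (F (b M.⊕ o w))))))) ⟩
          (∑[ b ] ∑[ z ] ∑[ w ] χ (F (b M.⊕ o z)) * χ (F ((b M.⊕ o z) M.⊕ o w)))
            ≡⟨ sum-swap (λ b z → ∑[ w ] χ (F (b M.⊕ o z)) * χ (F ((b M.⊕ o z) M.⊕ o w))) ⟩
          (∑[ z ] ∑[ b ] ∑[ w ] χ (F (b M.⊕ o z)) * χ (F ((b M.⊕ o z) M.⊕ o w)))
            ≡⟨ sum-cong (λ z → M.sum-shift (o z) (λ b → ∑[ w ] χ (F b) * χ (F (b M.⊕ o w)))) ⟩
          (∑[ z ] ∑[ b ] ∑[ w ] χ (F b) * χ (F (b M.⊕ o w)))
            ≡⟨ sum-const {Carrier} (∑[ b ] ∑[ w ] χ (F b) * χ (F (b M.⊕ o w))) ⟩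
          A * (∑[ b ] ∑[ w ] χ (F b) * χ (F (b M.⊕ o w)))
            ≡⟨ cong (A *_) (sum-swap (λ b w → χ (F b) * χ (F (b M.⊕ o w)))) ⟩
          A * Tφ φ ∎
          where
          open ≡-Reasoning
          o : Carrier → M
          o = outer V φ
          slide : ∀ b z w → (b M.⊕ o z) M.⊕ o w ≡ b M.⊕ o (w ⊕ z)
          slide b z w = trans (M.⊕-assoc b (o z) (o w)) (cong (b M.⊕_)
            (trans (sym (outer-⊕ V φ z w)) (cong o (⊕-comm z w))))

        -- Each nonzero `u` lies in the kernel of exactly C/q functionals, so summation over `φ`
        -- restores the sum over all nonzero vectors up to that factor.
        perp-sum : ∀ (w : U → ℤ) → q * (∑[ φ ] ∑[ u ] χ (Sφ φ u) * w u) ≡ C * (∑[ u ] χ (U.nz u) * w u)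
        perp-sum w = begin
          q * (∑[ φ ] ∑[ u ] χ (Sφ φ u) * w u)          ≡⟨ cong (q *_) (sum-swap (λ φ u → χ (Sφ φ u) * w u)) ⟩
          q * (∑[ u ] ∑[ φ ] χ (Sφ φ u) * w u)          ≡⟨ sym (sum-*ˡ q (λ u → ∑[ φ ] χ (Sφ φ u) * w u)) ⟩
          (∑[ u ] q * (∑[ φ ] χ (Sφ φ u) * w u))        ≡⟨ sum-cong pt ⟩
          (∑[ u ] C * (χ (U.nz u) * w u))               ≡⟨ sum-*ˡ C (λ u → χ (U.nz u) * w u) ⟩
          C * (∑[ u ] χ (U.nz u) * w u)                 ∎
          where
          open ≡-Reasoning
          opaque
            unfolding _*_
            ar : ∀ q n d w → q * (n * d * w) ≡ (q * d) * (n * w)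
            ar = solve-∀ ring
            z₀ : ∀ x w → x * (0ℤ * w) ≡ 0ℤ
            z₀ = solve-∀ ring
          pt : ∀ u → q * (∑[ φ ] χ (Sφ φ u) * w u) ≡ C * (χ (U.nz u) * w u)
          pt u with bool-cases (U.nz u)
          ... | inj₁ p = trans (cong (q *_) (trans (sum-*ʳ (w u) (λ φ → χ (Sφ φ u))) (cong (_* w u)
                           (trans (sum-cong (λ φ → χ-∧ (U.nz u) (dot φ u == 0ᵏ))) (sum-*ˡ (χ (U.nz u)) (λ φ → χ (dot φ u == 0ᵏ)))))))
                           (trans (ar q (χ (U.nz u)) (∑[ φ ] χ (dot φ u == 0ᵏ)) (w u)) (cong (_* (χ (U.nz u) * w u)) (perp u (U.nz-elim {u} p))))
          ... | inj₂ p = trans (cong (q *_) (sum-zero (λ φ → trans (cong (λ s → χ (s ∧ (dot φ u == 0ᵏ)) * w u) p) (zeroˡ (w u)))))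
                           (trans (zeroʳ q) (sym (trans (cong (λ s → C * (χ s * w u)) p) (z₀ C (w u)))))

        sum-X : q * (∑[ φ ] X φ) ≡ C * Ψ
        sum-X = begin
          q * (∑[ φ ] X φ)
            ≡⟨ cong (q *_) (sum-swap (λ φ b → χ (F b) * G (Sφ φ) g b)) ⟩
          q * (∑[ b ] ∑[ φ ] χ (F b) * G (Sφ φ) g b)
            ≡⟨ sym (sum-*ˡ q (λ b → ∑[ φ ] χ (F b) * G (Sφ φ) g b)) ⟩
          (∑[ b ] q * (∑[ φ ] χ (F b) * G (Sφ φ) g b))
            ≡⟨ sum-cong (λ b → trans (cong (q *_) (sum-*ˡ (χ (F b)) (λ φ → G (Sφ φ) g b)))
                 (trans (comm₁ q (χ (F b)) (∑[ φ ] G (Sφ φ) g b)) (trans (cong (χ (F b) *_) (perp-sum (λ u → g (b ⟨ u ⟩))))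
                   (comm₁ (χ (F b)) C (∑[ u ] χ (U.nz u) * g (b ⟨ u ⟩)))))) ⟩
          (∑[ b ] C * (χ (F b) * (∑[ u ] χ (U.nz u) * g (b ⟨ u ⟩))))
            ≡⟨ sum-*ˡ C (λ b → χ (F b) * (∑[ u ] χ (U.nz u) * g (b ⟨ u ⟩))) ⟩
          C * (∑[ b ] χ (F b) * (∑[ u ] χ (U.nz u) * g (b ⟨ u ⟩)))
            ≡⟨ cong (C *_) (trans (sym (deg-pairing g)) sum-fg) ⟩
          C * Ψ ∎
          where
          open ≡-Reasoning
          opaque
            unfolding _*_
            comm₁ : ∀ x y z → x * (y * z) ≡ y * (x * z)
            comm₁ = solve-∀ ring

        sum-S : q * (∑[ φ ] ∑[ u ] χ (Sφ φ u)) ≡ C * N₁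
        sum-S = trans (cong (q *_) (sum-cong (λ φ → sum-cong (λ u → sym (*-identityʳ (χ (Sφ φ u)))))))
                  (trans (perp-sum (λ _ → 1ℤ)) (cong (C *_) (sum-cong (λ u → *-identityʳ (χ (U.nz u))))))

        sum-GG : q * (A * (∑[ φ ] GGφ φ)) ≤ A * A * (C * (h * Ψ))
        sum-GG = begin
          q * (A * (∑[ φ ] GGφ φ))                  ≡⟨ cong (q *_) (sym (sum-*ˡ A GGφ)) ⟩
          q * (∑[ φ ] A * GGφ φ)                    ≤⟨ *-monoˡ (<⇒0≤ 0<q) (sum-mono (λ φ → second-moment g sum-g g-scale (Sφ φ) (λ u p → U.nz-elim {u} (∧-elimˡ p)))) ⟩
          q * (∑[ φ ] (∑[ u ] χ (Sφ φ u)) * B)      ≡⟨ cong (q *_) (sum-*ʳ B (λ φ → ∑[ u ] χ (Sφ φ u))) ⟩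
          q * ((∑[ φ ] ∑[ u ] χ (Sφ φ u)) * B)      ≡⟨ trans (sym (*-assoc q _ B)) (cong₂ _*_ sum-S (cong₂ (λ x y → (q - 1ℤ) * (x * y)) cardM sum-gg)) ⟩
          C * N₁ * ((q - 1ℤ) * (A * A′ * (A * Ψ)))  ≡⟨ arr C N₁ (q - 1ℤ) A A′ Ψ ⟩
          A * A * (C * (h * Ψ))                     ∎
          where
          open ℤ.≤-Reasoning
          B : ℤ
          B = (q - 1ℤ) * (card M * (∑[ v ] g v * g v))
          opaque
            unfolding _*_
            arr : ∀ c n q1 a a′ ψ → c * n * (q1 * (a * a′ * (a * ψ))) ≡ a * a * (c * (q1 * (n * a′) * ψ))
            arr = solve-∀ ring

        φ-bound : ∀ φ → 0ℤ ≤ h * h * (A * Tφ φ) + - pos 2 * h * (A * X φ) + GGφ φ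
        φ-bound φ = subst (0ℤ ≤_) (cong₂ (λ x y → h * h * x + - pos 2 * h * y + GGφ φ) (shift-shift φ) (shift-G φ))
                      (quadratic-nonneg (shift φ) (G (Sφ φ) g) h)

        all-φ : 0ℤ ≤ h * h * (A * T F) + - pos 2 * h * (A * (∑[ φ ] X φ)) + (∑[ φ ] GGφ φ)
        all-φ = subst (0ℤ ≤_) eq (sum-nonneg φ-bound)
          where
          open ≡-Reasoning
          eq : (∑[ φ ] (h * h * (A * Tφ φ) + - pos 2 * h * (A * X φ) + GGφ φ)) ≡
               h * h * (A * T F) + - pos 2 * h * (A * (∑[ φ ] X φ)) + (∑[ φ ] GGφ φ)
          eq = trans (sum-+ (λ φ → h * h * (A * Tφ φ) + - pos 2 * h * (A * X φ)) GGφ) (cong (_+ sum GGφ)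
                 (trans (sum-+ (λ φ → h * h * (A * Tφ φ)) (λ φ → - pos 2 * h * (A * X φ))) (cong₂ _+_
                   (trans (sum-*ˡ (h * h) (λ φ → A * Tφ φ)) (cong (h * h *_) (sum-*ˡ A Tφ)))
                   (trans (sum-*ˡ (- pos 2 * h) (λ φ → A * X φ)) (cong (- pos 2 * h *_) (sum-*ˡ A X))))))

        opaque
          unfolding _*_
          final₁ : ∀ q a h t x g → q * (a * (h * h * (a * t) + - pos 2 * h * (a * x) + g)) ≡
                   q * h * h * a * a * t + - pos 2 * h * a * a * (q * x) + q * (a * g)
          final₁ = solve-∀ ring
          final₂ : ∀ q a h t c ψ → q * h * h * a * a * t + - pos 2 * h * a * a * (c * ψ) + a * a * (c * (h * ψ)) ≡
                   a * a * h * (q * (h * t) - c * ψ)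
          final₂ = solve-∀ ring

      -- Summed over `φ`, the inner products amount to A C Ψ / q and the square norms to at most `h`
      -- times as much, so the multiplier `h` lets the last two terms of the quadratic merge.
      -- Degrees that vary thus force many pairs agreeing on a hyperplane.
      adjacency-bound : C * Ψ ≤ q * (h * T F)
      adjacency-bound = ℤ.0≤i-j⇒j≤i (*-cancelˡ (0<prod (0<prod 0<A 0<A) 0<h) (subst (_≤ A * A * h * (q * (h * T F) - C * Ψ))
          (sym (zeroʳ (A * A * h))) (begin
        0ℤ
          ≤⟨ 0≤prod (<⇒0≤ 0<q) (0≤prod (<⇒0≤ 0<A) all-φ) ⟩
        q * (A * (h * h * (A * T F) + - pos 2 * h * (A * (∑[ φ ] X φ)) + (∑[ φ ] GGφ φ)))
          ≡⟨ final₁ q A h (T F) (∑[ φ ] X φ) (∑[ φ ] GGφ φ) ⟩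
        q * h * h * A * A * T F + - pos 2 * h * A * A * (q * (∑[ φ ] X φ)) + q * (A * (∑[ φ ] GGφ φ))
          ≤⟨ ℤ.+-mono-≤ (ℤ.≤-reflexive (cong (λ x → q * h * h * A * A * T F + - pos 2 * h * A * A * x) sum-X)) sum-GG ⟩
        q * h * h * A * A * T F + - pos 2 * h * A * A * (C * Ψ) + A * A * (C * (h * Ψ))
          ≡⟨ final₂ q A h (T F) C Ψ ⟩
        A * A * h * (q * (h * T F) - C * Ψ) ∎)))
        where open ℤ.≤-Reasoning

  -- Pairs and triples of tuples

  choose : ∀ {A : Set} {{_ : Enum A}} → (A → Bool) → A → A
  choose R d with find R
  ... | inj₁ (a , _) = a
  ... | inj₂ _ = d

  choose-correct : ∀ {A : Set} {{_ : Enum A}} (R : A → Bool) d → ex R ≡ true → R (choose R d) ≡ true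
  choose-correct R d p with find R
  ... | inj₁ (a , q) = q
  ... | inj₂ h = true≢false (proj₂ (ex-elim R p)) (h (proj₁ (ex-elim R p)))

  over : ∀ {A : Set} {{_ : Enum A}} → (A → Bool) → (A → ℤ) → ℤ
  over F w = sum λ b → χ (F b) * w b

  module _ {A : Set} {{_ : Enum A}} (F : A → Bool) where

    χ-guard : ∀ {p x y} → (p ≡ true → x ≤ y) → χ p * x ≤ χ p * y
    χ-guard {true}  {x} {y} h = subst₂ _≤_ (sym (*-identityˡ x)) (sym (*-identityˡ y)) (h refl)
    χ-guard {false} {x} {y} h = ℤ.≤-reflexive (trans (zeroˡ x) (sym (zeroˡ y)))

    over-mono : ∀ {w w′} → (∀ b → F b ≡ true → w b ≤ w′ b) → over F w ≤ over F w′
    over-mono h = sum-mono (λ b → χ-guard {F b} (h b))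

    over-cong : ∀ {w w′} → (∀ b → w b ≡ w′ b) → over F w ≡ over F w′
    over-cong h = sum-cong (λ b → cong (χ (F b) *_) (h b))

    over-+ : ∀ w w′ → over F (λ b → w b + w′ b) ≡ over F w + over F w′
    over-+ w w′ = trans (sum-cong (λ b → distribˡ (χ (F b)) (w b) (w′ b))) (sum-+ (λ b → χ (F b) * w b) (λ b → χ (F b) * w′ b))

    over-*ˡ : ∀ c w → over F (λ b → c * w b) ≡ c * over F w
    over-*ˡ c w = trans (sum-cong (λ b → ex-ch (χ (F b)) c (w b))) (sum-*ˡ c (λ b → χ (F b) * w b))
      where
      opaque
        unfolding _*_
        ex-ch : ∀ x y z → x * (y * z) ≡ y * (x * z)
        ex-ch = solve-∀ ring

    over-const : ∀ c → over F (λ _ → c) ≡ (∑[ b ] χ (F b)) * c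
    over-const c = sum-*ʳ c (λ b → χ (F b))

    over-- : ∀ w w′ → over F (λ b → w b - w′ b) ≡ over F w - over F w′
    over-- w w′ = trans (sum-cong (λ b → di (χ (F b)) (w b) (w′ b))) (sum-- (λ b → χ (F b) * w b) (λ b → χ (F b) * w′ b))
      where
      opaque
        unfolding _*_
        di : ∀ x y z → x * (y - z) ≡ x * y - x * z
        di = solve-∀ ring

    over-nonneg : ∀ {w} → (∀ b → 0ℤ ≤ w b) → 0ℤ ≤ over F w
    over-nonneg h = sum-nonneg (λ b → 0≤prod (0≤χ (F b)) (h b))

  over-sum : ∀ {A B : Set} {{_ : Enum A}} {{_ : Enum B}} (F : A → Bool) (w : A → B → ℤ) →
             over F (λ a → ∑[ y ] w a y) ≡ (∑[ y ] over F (λ a → w a y))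
  over-sum F w = trans (sum-cong (λ a → sym (sum-*ˡ (χ (F a)) (w a)))) (sum-swap (λ a y → χ (F a) * w a y))

  over-swap : ∀ {A B : Set} {{_ : Enum A}} {{_ : Enum B}} (F : A → Bool) (F′ : B → Bool) (w : A → B → ℤ) →
              over F (λ a → over F′ (w a)) ≡ over F′ (λ b → over F (λ a → w a b))
  over-swap F F′ w = trans (over-sum F (λ a b → χ (F′ b) * w a b)) (sum-cong (λ b → over-*ˡ F (χ (F′ b)) (λ a → w a b)))

  module Pairs (𝔽 : FiniteField) (V : Linear.VSpace 𝔽) (k′ : ℕ) where
    open Linear 𝔽
    open VS V
    open Moments 𝔽 V k′
    open Energy 𝔽 V k′

    -- The number of vectors in the sum of two disjoint k-spaces.
    D : ℤ
    D = C * C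

    0<D : 0ℤ < D
    0<D = 0<prod 0<C 0<C

    Inj : M → Set
    Inj b = ∀ u → b ⟨ u ⟩ ≡ 𝟎 → u ≡ U.𝟎

    infix 4 _∈im_
    _∈im_ : Carrier → M → Bool
    v ∈im e = ex λ w → e ⟨ w ⟩ == v

    ∈im-intro : ∀ {v} e w → e ⟨ w ⟩ ≡ v → (v ∈im e) ≡ true
    ∈im-intro {v} e w p = ex-intro (λ w → e ⟨ w ⟩ == v) w (≡⇒== p)

    ∈im-elim : ∀ {v} e → (v ∈im e) ≡ true → ∃ λ w → e ⟨ w ⟩ ≡ v
    ∈im-elim {v} e p = let w , r = ex-elim (λ w → e ⟨ w ⟩ == v) p in w , ==⇒≡ r

    ∈im-scale : ∀ {v} e c → (v ∈im e) ≡ true → (c · v ∈im e) ≡ true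
    ∈im-scale e c p = let w , r = ∈im-elim e p in
      ∈im-intro e (c U.· w) (trans (app-·ʳ V e c w) (cong (c ·_) r))

    -- For injective `b` these say that the intersection with the image of `e` has dimension at
    -- least 1, at least 2, and exactly 1.
    meet two one : M → M → Bool
    meet b e = ex λ u → U.nz u ∧ (b ⟨ u ⟩ ∈im e)
    two b e = ex λ u → ex λ u′ → (U.nz u ∧ not (U.mult u u′)) ∧ ((b ⟨ u ⟩ ∈im e) ∧ (b ⟨ u′ ⟩ ∈im e))
    one b e = meet b e ∧ not (two b e)

    meet-intro : ∀ {b e} u → ¬ u ≡ U.𝟎 → (b ⟨ u ⟩ ∈im e) ≡ true → meet b e ≡ true
    meet-intro {b} {e} u u≢0 p = ex-intro (λ u → U.nz u ∧ (b ⟨ u ⟩ ∈im e)) u (∧-intro (U.nz-intro {u} u≢0) p)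

    meet-elim : ∀ {b e} → meet b e ≡ true → ∃ λ u → ¬ u ≡ U.𝟎 × (b ⟨ u ⟩ ∈im e) ≡ true
    meet-elim {b} {e} p = let u , r = ex-elim (λ u → U.nz u ∧ (b ⟨ u ⟩ ∈im e)) p in
      u , U.nz-elim {u} (∧-elimˡ r) , ∧-elimʳ {U.nz u} r

    two-intro : ∀ {b e} u u′ → ¬ u ≡ U.𝟎 → U.mult u u′ ≡ false → (b ⟨ u ⟩ ∈im e) ≡ true → (b ⟨ u′ ⟩ ∈im e) ≡ true → two b e ≡ true
    two-intro {b} {e} u u′ u≢0 ind p p′ =
      ex-intro (λ u → ex λ u′ → (U.nz u ∧ not (U.mult u u′)) ∧ ((b ⟨ u ⟩ ∈im e) ∧ (b ⟨ u′ ⟩ ∈im e))) u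
        (ex-intro (λ u′ → (U.nz u ∧ not (U.mult u u′)) ∧ ((b ⟨ u ⟩ ∈im e) ∧ (b ⟨ u′ ⟩ ∈im e))) u′
          (∧-intro (∧-intro (U.nz-intro {u} u≢0) (not-intro ind)) (∧-intro p p′)))

    two-elim : ∀ {b e} → two b e ≡ true → ∃ λ u → ∃ λ u′ → ¬ u ≡ U.𝟎 × U.mult u u′ ≡ false × (b ⟨ u ⟩ ∈im e) ≡ true × (b ⟨ u′ ⟩ ∈im e) ≡ true
    two-elim {b} {e} p =
      let u , r = ex-elim (λ u → ex λ u′ → (U.nz u ∧ not (U.mult u u′)) ∧ ((b ⟨ u ⟩ ∈im e) ∧ (b ⟨ u′ ⟩ ∈im e))) p
          u′ , s = ex-elim (λ u′ → (U.nz u ∧ not (U.mult u u′)) ∧ ((b ⟨ u ⟩ ∈im e) ∧ (b ⟨ u′ ⟩ ∈im e))) r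
          s₁ = ∧-elimˡ {U.nz u ∧ not (U.mult u u′)} s
          s₂ = ∧-elimʳ {U.nz u ∧ not (U.mult u u′)} s
      in u , u′ , U.nz-elim {u} (∧-elimˡ s₁) , not-elim (∧-elimʳ {U.nz u} s₁) , ∧-elimˡ s₂ , ∧-elimʳ {b ⟨ u ⟩ ∈im e} s₂

    two⇒meet : ∀ b e → two b e ≡ true → meet b e ≡ true
    two⇒meet b e p = let u , u′ , u≢0 , _ , r , _ = two-elim {b} {e} p in meet-intro {b} {e} u u≢0 r

    one-elim : ∀ b e → one b e ≡ true → ∃ λ x → ¬ x ≡ U.𝟎 × (b ⟨ x ⟩ ∈im e) ≡ true ×
               (∀ u → (b ⟨ u ⟩ ∈im e) ≡ true → U.mult x u ≡ true)
    one-elim b e p = let x , x≢0 , r = meet-elim {b} {e} (∧-elimˡ p) in x , x≢0 , r , unique x x≢0 r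
      where
      unique : ∀ x → ¬ x ≡ U.𝟎 → (b ⟨ x ⟩ ∈im e) ≡ true → ∀ u → (b ⟨ u ⟩ ∈im e) ≡ true → U.mult x u ≡ true
      unique x x≢0 r u s with bool-cases (U.mult x u)
      ... | inj₁ t = t
      ... | inj₂ ind = true≢false (two-intro {b} {e} x u x≢0 ind r s) (not-elim (∧-elimʳ {meet b e} p))

    meet-sym : ∀ b e → Inj b → meet b e ≡ true → meet e b ≡ true
    meet-sym b e ib p with meet-elim {b} {e} p
    ... | u , u≢0 , r with ∈im-elim e r
    ...   | w , s = meet-intro {e} {b} w (λ { refl → u≢0 (ib u (trans (sym s) (app-0ʳ V e))) }) (∈im-intro b u (sym s))

    meet-refl : ∀ b → meet b b ≡ true
    meet-refl b = meet-intro {b} {b} e₁ (λ p → 0≢1 (sym (hd p))) (∈im-intro b e₁ refl)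
      where
      e₁ : U
      e₁ = 1ᵏ ∷ VS.𝟎 (Pow 𝕂 k′)
      hd : ∀ {x y : K} {n} {xs ys : Vec K n} → x ∷ xs ≡ y ∷ ys → x ≡ y
      hd refl = refl

    -- For injective tuples, the number of nonzero vectors in both images.
    common : M → M → ℤ
    common b e = ∑[ u ] χ (U.nz u) * (∑[ w ] χ (U.nz w) * χ (e ⟨ w ⟩ == b ⟨ u ⟩))

    Φ-pairs : ∀ F → Φ F ≡ over F (λ b → over F (common b))
    Φ-pairs F = trans (deg-pairing F (deg F)) (over-cong F (λ b → begin
        (∑[ u ] χ (U.nz u) * deg F (b ⟨ u ⟩))
          ≡⟨ over-swap U.nz F (λ u e → ∑[ w ] χ (U.nz w) * χ (e ⟨ w ⟩ == b ⟨ u ⟩)) ⟩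
        over F (common b) ∎))
      where open ≡-Reasoning

    private
      cand : M → M → U × U → Bool
      cand b e (u , w) = U.nz u ∧ (U.nz w ∧ (e ⟨ w ⟩ == b ⟨ u ⟩))

      common-count : ∀ b e → (∑[ p ] χ (cand b e p)) ≡ common b e
      common-count b e = trans (sum-× (λ p → χ (cand b e p))) (sum-cong (λ u → trans
        (sum-cong (λ w → trans (χ-∧ (U.nz u) (U.nz w ∧ (e ⟨ w ⟩ == b ⟨ u ⟩))) (cong (χ (U.nz u) *_) (χ-∧ (U.nz w) (e ⟨ w ⟩ == b ⟨ u ⟩)))))
        (sum-*ˡ (χ (U.nz u)) (λ w → χ (U.nz w) * χ (e ⟨ w ⟩ == b ⟨ u ⟩)))))

      cand-intro : ∀ {b e u w} → Inj b → ¬ u ≡ U.𝟎 → e ⟨ w ⟩ ≡ b ⟨ u ⟩ → cand b e (u , w) ≡ true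
      cand-intro {b} {e} {u} {w} ib u≢0 p = ∧-intro (U.nz-intro {u} u≢0) (∧-intro (U.nz-intro {w}
        (λ { refl → u≢0 (ib u (trans (sym p) (app-0ʳ V e))) })) (≡⇒== p))

    common-meet : ∀ b e → Inj b → meet b e ≡ true → q - 1ℤ ≤ common b e
    common-meet b e ib p with meet-elim {b} {e} p
    ... | x , x≢0 , r with ∈im-elim e r
    ...   | y , s = subst₂ _≤_ (count-nz 𝕂) (common-count b e)
          (count-inj (λ c → c U.· x , c U.· y) (VS.nz 𝕂) (cand b e)
            (λ c c≢0 → cand-intro {b} {e} {c U.· x} {c U.· y} ib (U.scale-nonzero (VS.nz-elim 𝕂 c≢0) x≢0)
              (trans (app-·ʳ V e c y) (trans (cong (c ·_) s) (sym (app-·ʳ V b c x)))))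
            (λ c c′ _ _ eq → U.scalar-inj x≢0 (cong proj₁ eq)))

    private
      comb : ∀ (b : M) x x′ c c′ → b ⟨ c U.· x U.⊕ c′ U.· x′ ⟩ ≡ c · b ⟨ x ⟩ ⊕ c′ · b ⟨ x′ ⟩
      comb b x x′ c c′ = trans (app-⊕ʳ V b (c U.· x) (c′ U.· x′)) (cong₂ _⊕_ (app-·ʳ V b c x) (app-·ʳ V b c′ x′))

    common-two : ∀ b e → Inj b → two b e ≡ true → q * q - 1ℤ ≤ common b e
    common-two b e ib p with two-elim {b} {e} p
    ... | x , x′ , x≢0 , ind , r , r′ with ∈im-elim e r | ∈im-elim e r′
    ...   | y , s | y′ , s′ = subst₂ _≤_ (trans (count-nz (Pow 𝕂 2)) (cong (λ z → z - 1ℤ) (trans (card-Vec K 2) (cong (q *_) (*-identityʳ q)))))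
            (common-count b e) (count-inj ι (VS.nz (Pow 𝕂 2)) (cand b e) hit inj)
      where
      ι : Vec K 2 → U × U
      ι (c ∷ c′ ∷ []) = c U.· x U.⊕ c′ U.· x′ , c U.· y U.⊕ c′ U.· y′
      zero-comb : 0ᵏ U.· x U.⊕ 0ᵏ U.· x′ ≡ U.𝟎
      zero-comb = trans (cong₂ U._⊕_ (U.·-zeroˡ x) (U.·-zeroˡ x′)) (U.⊕-identityˡ U.𝟎)
      hit : ∀ cs → VS.nz (Pow 𝕂 2) cs ≡ true → cand b e (ι cs) ≡ true
      hit (c ∷ c′ ∷ []) nz = cand-intro {b} {e} {c U.· x U.⊕ c′ U.· x′} {c U.· y U.⊕ c′ U.· y′} ib
        (λ z → VS.nz-elim (Pow 𝕂 2) {c ∷ c′ ∷ []} nz (let p₁ , p₂ = U.indep-coeff x≢0 ind (trans z (sym zero-comb)) in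
          cong₂ (λ a b → a ∷ b ∷ []) p₁ p₂))
        (trans (comb e y y′ c c′) (trans (cong₂ (λ v v′ → c · v ⊕ c′ · v′) s s′) (sym (comb b x x′ c c′))))
      inj : ∀ cs ds → VS.nz (Pow 𝕂 2) cs ≡ true → VS.nz (Pow 𝕂 2) ds ≡ true → ι cs ≡ ι ds → cs ≡ ds
      inj (c ∷ c′ ∷ []) (d ∷ d′ ∷ []) _ _ eq = let p₁ , p₂ = U.indep-coeff x≢0 ind (cong proj₁ eq) in
        cong₂ (λ a b → a ∷ b ∷ []) p₁ p₂

    -- A common line contributes q - 1 vectors and a common plane q² - 1 = (q - 1)(1 + q). The
    -- excess in the second case is kept because `part-bound` uses it to pay for pairs that meet in
    -- more than a point.
    common-bound : ∀ b e → Inj b → (q - 1ℤ) * (χ (meet b e) + q * χ (two b e)) ≤ common b e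
    common-bound b e ib with bool-cases (two b e)
    ... | inj₁ p = subst (_≤ common b e) (sym (trans (cong₂ (λ x y → (q - 1ℤ) * (χ x + q * χ y)) (two⇒meet b e p) p) (ar q))) (common-two b e ib p)
      where
      opaque
        unfolding _*_
        ar : ∀ q → (q - 1ℤ) * (1ℤ + q * 1ℤ) ≡ q * q - 1ℤ
        ar = solve-∀ ring
    ... | inj₂ p with bool-cases (meet b e)
    ...   | inj₁ r = subst (_≤ common b e) (sym (trans (cong₂ (λ x y → (q - 1ℤ) * (χ x + q * χ y)) r p) (ar q))) (common-meet b e ib r)
      where
      opaque
        unfolding _*_
        ar : ∀ q → (q - 1ℤ) * (1ℤ + q * 0ℤ) ≡ q - 1ℤ
        ar = solve-∀ ring
    ...   | inj₂ r = subst (_≤ common b e) (sym (trans (cong₂ (λ x y → (q - 1ℤ) * (χ x + q * χ y)) r p) (ar q)))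
              (sum-nonneg (λ u → 0≤prod (0≤χ (U.nz u)) (sum-nonneg (λ w → 0≤prod (0≤χ (U.nz w)) (0≤χ (e ⟨ w ⟩ == b ⟨ u ⟩))))))
      where
      opaque
        unfolding _*_
        ar : ∀ q → (q - 1ℤ) * (0ℤ + q * 0ℤ) ≡ 0ℤ
        ar = solve-∀ ring

    pairs : (M → Bool) → (M → M → Bool) → ℤ
    pairs F R = over F λ b → over F λ e → χ (R b e)

    Injective : (M → Bool) → Set
    Injective F = ∀ b → F b ≡ true → Inj b

    N₁≤C : N₁ ≤ C
    N₁≤C = sum-mono (λ u → χ≤1 (U.nz u))

    N₁²≤D : N₁ * N₁ ≤ D
    N₁²≤D = ℤ.≤-trans (*-monoʳ (<⇒0≤ 0<N₁) N₁≤C) (*-monoˡ (<⇒0≤ 0<C) N₁≤C)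

    module _ (F : M → Bool) (F-inj : Injective F) where
      private
        sz : ℤ
        sz = size F
        opaque
          unfolding _*_
          sq : ∀ n s → (n * s) * (n * s) ≡ n * n * (s * s)
          sq = solve-∀ ring

      Φ-bound : (q - 1ℤ) * (pairs F meet + q * pairs F two) ≤ Φ F
      Φ-bound = subst₂ _≤_ eq (sym (Φ-pairs F))
        (over-mono F (λ b Fb → over-mono F (λ e Fe → common-bound b e (F-inj b Fb))))
        where
        eq : over F (λ b → over F (λ e → (q - 1ℤ) * (χ (meet b e) + q * χ (two b e)))) ≡ (q - 1ℤ) * (pairs F meet + q * pairs F two)
        eq = trans (over-cong F (λ b → trans (over-*ˡ F (q - 1ℤ) (λ e → χ (meet b e) + q * χ (two b e)))
               (cong ((q - 1ℤ) *_) (trans (over-+ F (λ e → χ (meet b e)) (λ e → q * χ (two b e)))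
                 (cong (over F (λ e → χ (meet b e)) +_) (over-*ˡ F q (λ e → χ (two b e))))))))
             (trans (over-*ˡ F (q - 1ℤ) (λ b → over F (λ e → χ (meet b e)) + q * over F (λ e → χ (two b e))))
               (cong ((q - 1ℤ) *_) (trans (over-+ F (λ b → over F (λ e → χ (meet b e))) (λ b → q * over F (λ e → χ (two b e))))
                 (cong (pairs F meet +_) (over-*ˡ F q (λ b → over F (λ e → χ (two b e))))))))

      0≤pairs : ∀ R → 0ℤ ≤ pairs F R
      0≤pairs R = over-nonneg F (λ b → over-nonneg F (λ e → 0≤χ (R b e)))

      size-square≤ : (N₁ * sz) * (N₁ * sz) ≤ D * (sz * sz)
      size-square≤ = subst (_≤ D * (sz * sz)) (sym (sq N₁ sz)) (*-monoʳ (0≤square sz) N₁²≤D)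

      -- A Φ is the sum of Ψ, which is at most a P sz by `variance-bound`, and of (N₁ sz)², which is
      -- at most D sz²; `Φ-bound` compares it with the pairs.
      pair-count-bound : a * (pairs F meet + q * pairs F two) ≤ a * P * sz + D * (sz * sz)
      pair-count-bound = begin
        a * (pairs F meet + q * pairs F two)               ≡⟨ ar₁ (q - 1ℤ) A (pairs F meet + q * pairs F two) ⟩
        A * ((q - 1ℤ) * (pairs F meet + q * pairs F two))  ≤⟨ *-monoˡ (<⇒0≤ 0<A) Φ-bound ⟩
        A * Φ F                                            ≡⟨ ar₂ (A * Φ F) ((N₁ * sz) * (N₁ * sz)) ⟩
        Ψ F + (N₁ * sz) * (N₁ * sz)                        ≤⟨ ℤ.+-mono-≤ (variance-bound F) size-square≤ ⟩
        a * P * sz + D * (sz * sz)                         ∎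
        where
        open ℤ.≤-Reasoning
        opaque
          unfolding _*_
          ar₁ : ∀ x y z → x * y * z ≡ y * (x * z)
          ar₁ = solve-∀ ring
          ar₂ : ∀ x y → x ≡ x - y + y
          ar₂ = solve-∀ ring

      adjacency-count-bound : C * (a * pairs F meet - D * (sz * sz)) ≤ q * (h * T F)
      adjacency-count-bound = ℤ.≤-trans (*-monoˡ (<⇒0≤ 0<C) (begin
        a * pairs F meet - D * (sz * sz)
          ≤⟨ ℤ.+-mono-≤ (subst (_≤ A * Φ F) (sym (ar₁ (q - 1ℤ) A (pairs F meet)))
               (*-monoˡ (<⇒0≤ 0<A) (ℤ.≤-trans (*-monoˡ 0≤q-1 le) Φ-bound))) (ℤ.neg-mono-≤ size-square≤) ⟩
        Ψ F ∎)) (adjacency-bound F)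
        where
        open ℤ.≤-Reasoning
        opaque
          unfolding _*_
          ar₁ : ∀ x y z → x * y * z ≡ y * (x * z)
          ar₁ = solve-∀ ring
        le : pairs F meet ≤ pairs F meet + q * pairs F two
        le = subst (_≤ pairs F meet + q * pairs F two) (ℤ.+-identityʳ (pairs F meet))
               (ℤ.+-monoʳ-≤ (pairs F meet) (0≤prod (<⇒0≤ 0<q) (0≤pairs two)))

  module SubspaceIndex (𝔽 : FiniteField) (W : Linear.VSpace 𝔽) where
    open Linear 𝔽
    open VS W

    private
      instance
        enum-W : Enum Carrier
        enum-W = enumV

    Closed : (Carrier → Bool) → Set
    Closed S = (∀ x y → S x ≡ true → S y ≡ true → S (x ⊕ y) ≡ true) × (∀ c x → S x ≡ true → S (c · x) ≡ true)

    scalar-count : ∀ (Q : Carrier → Bool) → (∑[ p ] χ (Q (proj₂ {A = K} p))) ≡ card K * (∑[ x ] χ (Q x))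
    scalar-count Q = trans (sum-× {A = K} (λ p → χ (Q (proj₂ p)))) (sum-const {K} (∑[ x ] χ (Q x)))

    -- The map (c, x) ↦ c w + x embeds K × (H ∩ H′) into H′: equal values with different scalars
    -- would exhibit a nonzero multiple of `w` as an element of H.
    index-bound : ∀ H H′ → Closed H → Closed H′ → ∀ w → H w ≡ false → H′ w ≡ true →
                  card K * (∑[ x ] χ (H x ∧ H′ x)) ≤ (∑[ x ] χ (H′ x))
    index-bound H H′ (H+ , H·) (H′+ , H′·) w w∉ w∈ = subst (_≤ (∑[ x ] χ (H′ x))) (scalar-count (λ x → H x ∧ H′ x))
      (count-inj (λ p → proj₁ p · w ⊕ proj₂ p) (λ p → H (proj₂ p) ∧ H′ (proj₂ p)) H′
        (λ { (c , x) p → H′+ (c · w) x (H′· c w w∈) (∧-elimʳ {H x} p) })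
        (λ { (c , x) (d , y) p r eq → same c x d y (∧-elimˡ p) (∧-elimˡ r) eq }))
      where
      same : ∀ c x d y → H x ≡ true → H y ≡ true → c · w ⊕ x ≡ d · w ⊕ y → (c , x) ≡ (d , y)
      same c x d y hx hy eq with (c +ᵏ -ᵏ d) ≟ 0ᵏ
      ... | yes z = cong₂ _,_ c≡d (⊕-cancelˡ (c · w) x y (trans eq (cong (λ e → e · w ⊕ y) (sym c≡d))))
        where
        c≡d : c ≡ d
        c≡d = trans (sym (trans (K.+-assoc c (-ᵏ d) d) (trans (cong (c +ᵏ_) (K.-‿inverseˡ d)) (K.+-identityʳ c))))
                (trans (cong (_+ᵏ d) z) (K.+-identityˡ d))
      ... | no z = let i , zi = inverse (c +ᵏ -ᵏ d) z in
          true≢false (subst (λ v → H v ≡ true) (trans (cong (i ·_) (sym diff)) (unscale zi w))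
            (H· i (y ⊕ (-ᵏ 1ᵏ) · x) (H+ y ((-ᵏ 1ᵏ) · x) hy (H· (-ᵏ 1ᵏ) x hx)))) w∉
        where
        open ≡-Reasoning
        diff : (c +ᵏ -ᵏ d) · w ≡ y ⊕ (-ᵏ 1ᵏ) · x
        diff = ⊕-cancelʳ (d · w ⊕ x) _ _ (begin
          (c +ᵏ -ᵏ d) · w ⊕ (d · w ⊕ x)          ≡⟨ sym (⊕-assoc _ (d · w) x) ⟩
          ((c +ᵏ -ᵏ d) · w ⊕ d · w) ⊕ x          ≡⟨ cong (λ v → (v ⊕ d · w) ⊕ x) (trans (·-distribʳ c (-ᵏ d) w) (cong (c · w ⊕_) (·-neg d w))) ⟩
          ((c · w ⊕ ⊖ (d · w)) ⊕ d · w) ⊕ x      ≡⟨ cong (_⊕ x) (⊖⊕ (c · w) (d · w)) ⟩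
          c · w ⊕ x                              ≡⟨ eq ⟩
          d · w ⊕ y                              ≡⟨ ⊕-comm (d · w) y ⟩
          y ⊕ d · w                              ≡⟨ cong (_⊕ d · w) (sym (⊕-identityʳ y)) ⟩
          (y ⊕ 𝟎) ⊕ d · w                        ≡⟨ cong (λ v → (y ⊕ v) ⊕ d · w) (sym cancel) ⟩
          (y ⊕ ((-ᵏ 1ᵏ) · x ⊕ x)) ⊕ d · w        ≡⟨ cong (_⊕ d · w) (sym (⊕-assoc y _ x)) ⟩
          ((y ⊕ (-ᵏ 1ᵏ) · x) ⊕ x) ⊕ d · w        ≡⟨ ⊕-assoc _ x (d · w) ⟩
          (y ⊕ (-ᵏ 1ᵏ) · x) ⊕ (x ⊕ d · w)        ≡⟨ cong ((y ⊕ (-ᵏ 1ᵏ) · x) ⊕_) (⊕-comm x (d · w)) ⟩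
          (y ⊕ (-ᵏ 1ᵏ) · x) ⊕ (d · w ⊕ x)        ∎)
          where
          cancel : (-ᵏ 1ᵏ) · x ⊕ x ≡ 𝟎
          cancel = trans (cong (_⊕ x) (trans (·-neg 1ᵏ x) (cong ⊖_ (·-identity x)))) (⊕-inverseˡ x)

  module Triples (𝔽 : FiniteField) (V : Linear.VSpace 𝔽) (k′ : ℕ) where
    open Linear 𝔽
    open VS V
    open Moments 𝔽 V k′
    open Energy 𝔽 V k′
    open Pairs 𝔽 V k′
    open SubspaceIndex 𝔽 V

    span₂ : M → M → Carrier → Bool
    span₂ b e v = ex λ p → (b ⟨ proj₁ p ⟩ ⊕ e ⟨ proj₂ p ⟩) == v

    span₂-intro : ∀ {b e v} u w → b ⟨ u ⟩ ⊕ e ⟨ w ⟩ ≡ v → span₂ b e v ≡ true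
    span₂-intro {b} {e} {v} u w p = ex-intro (λ p → (b ⟨ proj₁ p ⟩ ⊕ e ⟨ proj₂ p ⟩) == v) (u , w) (≡⇒== p)

    span₂-elim : ∀ {b e v} → span₂ b e v ≡ true → ∃ λ u → ∃ λ w → b ⟨ u ⟩ ⊕ e ⟨ w ⟩ ≡ v
    span₂-elim {b} {e} {v} p = let r , s = ex-elim (λ p → (b ⟨ proj₁ p ⟩ ⊕ e ⟨ proj₂ p ⟩) == v) p in
      proj₁ r , proj₂ r , ==⇒≡ s

    span₂-closed : ∀ b e → Closed (span₂ b e)
    span₂-closed b e = add , scale
      where
      add : ∀ x y → span₂ b e x ≡ true → span₂ b e y ≡ true → span₂ b e (x ⊕ y) ≡ true
      add x y p r = let u , w , s = span₂-elim {b} {e} {x} p ; u′ , w′ , s′ = span₂-elim {b} {e} {y} r in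
        span₂-intro {b} {e} (u U.⊕ u′) (w U.⊕ w′) (trans (cong₂ _⊕_ (app-⊕ʳ V b u u′) (app-⊕ʳ V e w w′))
          (trans (⊕-exchange _ _ _ _) (cong₂ _⊕_ s s′)))
      scale : ∀ c x → span₂ b e x ≡ true → span₂ b e (c · x) ≡ true
      scale c x p = let u , w , s = span₂-elim {b} {e} {x} p in
        span₂-intro {b} {e} (c U.· u) (c U.· w) (trans (cong₂ _⊕_ (app-·ʳ V b c u) (app-·ʳ V e c w))
          (trans (sym (·-distribˡ c _ _)) (cong (c ·_) s)))

    -- Each vector of the sum has at least q representations among the `D` pairs: multiples of the
    -- common vector `b ⟨ x ⟩` = `e ⟨ y ⟩` can be moved from one summand to the other.
    card-span₂ : ∀ b e → meet b e ≡ true → q * (∑[ v ] χ (span₂ b e v)) ≤ D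
    card-span₂ b e p with meet-elim {b} {e} p
    ... | x , x≢0 , r with ∈im-elim e r
    ...   | y , s = subst₂ _≤_ (scalar-count (span₂ b e)) total
            (count-inj ι (λ p → span₂ b e (proj₂ p)) (λ _ → true) (λ _ _ → refl) inj)
      where
      total : (∑[ p ] χ ((λ _ → true) p)) ≡ D
      total = trans (sum-× {A = U} {B = U} (λ _ → 1ℤ)) (sum-const {U} C)
      pre : Carrier → U × U
      pre v = choose (λ p → (b ⟨ proj₁ p ⟩ ⊕ e ⟨ proj₂ p ⟩) == v) (U.𝟎 , U.𝟎)
      pre-correct : ∀ v → span₂ b e v ≡ true → b ⟨ proj₁ (pre v) ⟩ ⊕ e ⟨ proj₂ (pre v) ⟩ ≡ v
      pre-correct v t = ==⇒≡ (choose-correct (λ p → (b ⟨ proj₁ p ⟩ ⊕ e ⟨ proj₂ p ⟩) == v) (U.𝟎 , U.𝟎) t)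
      ι : K × Carrier → U × U
      ι (c , v) = proj₁ (pre v) U.⊕ c U.· x , proj₂ (pre v) U.⊕ (-ᵏ c) U.· y
      value : ∀ c v → span₂ b e v ≡ true → b ⟨ proj₁ (ι (c , v)) ⟩ ⊕ e ⟨ proj₂ (ι (c , v)) ⟩ ≡ v
      value c v t = begin
        b ⟨ proj₁ (pre v) U.⊕ c U.· x ⟩ ⊕ e ⟨ proj₂ (pre v) U.⊕ (-ᵏ c) U.· y ⟩
          ≡⟨ cong₂ _⊕_ (trans (app-⊕ʳ V b _ _) (cong (b ⟨ proj₁ (pre v) ⟩ ⊕_) (app-·ʳ V b c x)))
               (trans (app-⊕ʳ V e _ _) (cong (e ⟨ proj₂ (pre v) ⟩ ⊕_) (app-·ʳ V e (-ᵏ c) y))) ⟩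
        (b ⟨ proj₁ (pre v) ⟩ ⊕ c · b ⟨ x ⟩) ⊕ (e ⟨ proj₂ (pre v) ⟩ ⊕ (-ᵏ c) · e ⟨ y ⟩)
          ≡⟨ ⊕-exchange _ _ _ _ ⟩
        (b ⟨ proj₁ (pre v) ⟩ ⊕ e ⟨ proj₂ (pre v) ⟩) ⊕ (c · b ⟨ x ⟩ ⊕ (-ᵏ c) · e ⟨ y ⟩)
          ≡⟨ cong₂ _⊕_ (pre-correct v t) (trans (cong (λ z → c · b ⟨ x ⟩ ⊕ (-ᵏ c) · z) s)
               (trans (cong (c · b ⟨ x ⟩ ⊕_) (·-neg c (b ⟨ x ⟩))) (⊕-inverseʳ (c · b ⟨ x ⟩)))) ⟩
        v ⊕ 𝟎
          ≡⟨ ⊕-identityʳ v ⟩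
        v ∎
        where open ≡-Reasoning
      inj : ∀ p p′ → span₂ b e (proj₂ p) ≡ true → span₂ b e (proj₂ p′) ≡ true → ι p ≡ ι p′ → p ≡ p′
      inj (c , v) (c′ , v′) t t′ eq = go (trans (sym (value c v t)) (trans (cong (λ z → b ⟨ proj₁ z ⟩ ⊕ e ⟨ proj₂ z ⟩) eq) (value c′ v′ t′))) eq
        where
        go : ∀ {v v′} → v ≡ v′ → ι (c , v) ≡ ι (c′ , v′) → (c , v) ≡ (c′ , v′)
        go {v} refl eq′ = cong (_, v) (U.scalar-inj x≢0 (U.⊕-cancelˡ (proj₁ (pre v)) _ _ (cong proj₁ eq′)))

    -- The two positions of `e′` for which `triple-bound` deteriorates: through a point of b ∩ e, or
    -- inside b + e.
    shareˣ shareᴷ : M → M → M → Bool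
    shareˣ b e e′ = ex λ u → U.nz u ∧ ((b ⟨ u ⟩ ∈im e) ∧ (b ⟨ u ⟩ ∈im e′))
    shareᴷ b e e′ = not (ex λ w → not (span₂ b e (e′ ⟨ w ⟩)))

    Restrict : (M → Bool) → M → M → M → Bool
    Restrict F e e′ b = F b ∧ (one b e ∧ one b e′)

    module _ (b e e′ : M) (p : one b e ≡ true) (p′ : one b e′ ≡ true) where
      private
        o : ∃ λ x → ¬ x ≡ U.𝟎 × (b ⟨ x ⟩ ∈im e) ≡ true × (∀ u → (b ⟨ u ⟩ ∈im e) ≡ true → U.mult x u ≡ true)
        o = one-elim b e p
        o′ : ∃ λ x → ¬ x ≡ U.𝟎 × (b ⟨ x ⟩ ∈im e′) ≡ true × (∀ u → (b ⟨ u ⟩ ∈im e′) ≡ true → U.mult x u ≡ true)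
        o′ = one-elim b e′ p′
        x x′ : U
        x = proj₁ o
        x′ = proj₁ o′
        x≢0 : ¬ x ≡ U.𝟎
        x≢0 = proj₁ (proj₂ o)
        x′≢0 : ¬ x′ ≡ U.𝟎
        x′≢0 = proj₁ (proj₂ o′)

        α α′ : U → Bool
        α φ = dot φ x == 0ᵏ
        α′ φ = dot φ x′ == 0ᵏ
        γ γ′ : Carrier → Bool
        γ = span₂ b e
        γ′ = span₂ b e′

        sα sα′ sαα sγ sγ′ sγγ : ℤ
        sα = ∑[ φ ] χ (α φ)
        sα′ = ∑[ φ ] χ (α′ φ)
        sαα = ∑[ φ ] χ (α φ) * χ (α′ φ)
        sγ = ∑[ z ] χ (γ z)
        sγ′ = ∑[ z ] χ (γ′ z)
        sγγ = ∑[ z ] χ (γ z) * χ (γ′ z)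

      -- A vector v in the kernel of φ is fixed by b ↦ b + φ ⊗ z, so it must be a multiple of x₁;
      -- for the other v the vector z is a combination of b(v) and a vector of e₁.
      neighbour-meets : ∀ {e₁} x₁ → (∀ u → (b ⟨ u ⟩ ∈im e₁) ≡ true → U.mult x₁ u ≡ true) → ∀ φ z →
        meet (b M.⊕ outer V φ z) e₁ ≡ true → (dot φ x₁ == 0ᵏ) ∨ span₂ b e₁ z ≡ true
      neighbour-meets {e₁} x₁ unique φ z m with meet-elim {b M.⊕ outer V φ z} {e₁} m
      ... | v , v≢0 , r with ∈im-elim e₁ r
      ...   | w , s with dot φ v ≟ 0ᵏ
      ...     | yes d = ∨-introˡ (≡⇒== (φx (U.mult-elim {x₁} {v} (unique v (∈im-intro e₁ w
                  (trans s (trans val (trans (cong (λ c → b ⟨ v ⟩ ⊕ c · z) d) (trans (cong (b ⟨ v ⟩ ⊕_) (·-zeroˡ z)) (⊕-identityʳ _))))))))))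
        where
        ∨-introˡ : ∀ {a c} → a ≡ true → a ∨ c ≡ true
        ∨-introˡ refl = refl
        val : (b M.⊕ outer V φ z) ⟨ v ⟩ ≡ b ⟨ v ⟩ ⊕ dot φ v · z
        val = trans (app-⊕ˡ V b (outer V φ z) v) (cong (b ⟨ v ⟩ ⊕_) (app-outer V φ z v))
        φx : (∃ λ c → v ≡ c U.· x₁) → dot φ x₁ ≡ 0ᵏ
        φx (c , refl) with inverse c (U.nonzero-scalar v≢0)
        ... | i , ci = trans (sym (VS.unscale 𝕂 ci (dot φ x₁))) (trans (cong (i *ᵏ_) (trans (sym (app-·ʳ 𝕂 φ c x₁)) d)) (K.zeroʳ i))
      ...     | no d = ∨-introʳ {dot φ x₁ == 0ᵏ} (inv (inverse (dot φ v) d))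
        where
        ∨-introʳ : ∀ {a c} → c ≡ true → a ∨ c ≡ true
        ∨-introʳ {true} refl = refl
        ∨-introʳ {false} refl = refl
        val : (b M.⊕ outer V φ z) ⟨ v ⟩ ≡ b ⟨ v ⟩ ⊕ dot φ v · z
        val = trans (app-⊕ˡ V b (outer V φ z) v) (cong (b ⟨ v ⟩ ⊕_) (app-outer V φ z v))
        inv : (∃ λ i → dot φ v *ᵏ i ≡ 1ᵏ) → span₂ b e₁ z ≡ true
        inv (i , ci) = subst (λ y → span₂ b e₁ y ≡ true) (unscale ci z)
          (proj₂ (span₂-closed b e₁) i (dot φ v · z) (span₂-intro {b} {e₁} (U.⊖ v) w (begin
            b ⟨ U.⊖ v ⟩ ⊕ e₁ ⟨ w ⟩                ≡⟨ cong₂ _⊕_ (app-⊖ʳ V b v) (trans s val) ⟩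
            ⊖ (b ⟨ v ⟩) ⊕ (b ⟨ v ⟩ ⊕ dot φ v · z)   ≡⟨ sym (⊕-assoc _ _ _) ⟩
            (⊖ (b ⟨ v ⟩) ⊕ b ⟨ v ⟩) ⊕ dot φ v · z   ≡⟨ cong (_⊕ dot φ v · z) (⊕-inverseˡ _) ⟩
            𝟎 ⊕ dot φ v · z                       ≡⟨ ⊕-identityˡ _ ⟩
            dot φ v · z ∎)))
          where open ≡-Reasoning

      private
        qα : q * sα ≡ C
        qα = perp x x≢0
        qα′ : q * sα′ ≡ C
        qα′ = perp x′ x′≢0
        qγ : q * sγ ≤ D
        qγ = card-span₂ b e (∧-elimˡ p)
        qγ′ : q * sγ′ ≤ D
        qγ′ = card-span₂ b e′ (∧-elimˡ p′)

        χχ≤ : ∀ s t → χ s * χ t ≤ χ s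
        χχ≤ s t = subst (χ s * χ t ≤_) (*-identityʳ (χ s)) (*-monoˡ (0≤χ s) (χ≤1 t))

        opaque
          unfolding _*_
          w₁ : ∀ q c → q * c ≡ c * (q * 1ℤ)
          w₁ = solve-∀ ring
          w₂ : ∀ q c → c * (q * 1ℤ) + c ≡ c * (1ℤ + q * 1ℤ)
          w₂ = solve-∀ ring
          w₃ : ∀ q c → c ≡ c * (1ℤ + q * 0ℤ)
          w₃ = solve-∀ ring

        -- The exceptional case costs a factor q over the generic one, and 1 + q χ s covers both in
        -- one formula that can be summed.
        weaken : ∀ {X Y} s → 0ℤ ≤ Y → (s ≡ true → X ≤ q * Y) → (s ≡ false → X ≤ Y) → X ≤ Y * (1ℤ + q * χ s)
        weaken {X} {Y} true 0≤Y h _ = ℤ.≤-trans (h refl) (subst (_≤ Y * (1ℤ + q * 1ℤ)) (ℤ.+-identityʳ (q * Y))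
          (subst (q * Y + 0ℤ ≤_) (trans (cong (_+ Y) (w₁ q Y)) (w₂ q Y)) (ℤ.+-monoʳ-≤ (q * Y) 0≤Y)))
        weaken {X} {Y} false _ _ h = subst (X ≤_) (w₃ q Y) (h refl)

        qqαα : q * (q * sαα) ≤ C * (1ℤ + q * χ (shareˣ b e e′))
        qqαα = weaken (shareˣ b e e′) (<⇒0≤ 0<C)
          (λ _ → *-monoˡ (<⇒0≤ 0<q) (ℤ.≤-trans (*-monoˡ (<⇒0≤ 0<q) (sum-mono (λ φ → χχ≤ (α φ) (α′ φ)))) (ℤ.≤-reflexive qα)))
          (λ f → ℤ.≤-reflexive (trans (sym (*-assoc q q sαα)) (trans
            -- A functional is a tuple over the one-dimensional space `𝕂`, so pairwise independence
            -- applies to `φ` as well: C / q² functionals vanish at both points.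
            (Moments.eval-two 𝔽 𝕂 k′ x≢0 (distinct f) (λ c → χ (c == 0ᵏ)) (λ c → χ (c == 0ᵏ)))
            (trans (cong (C *_) (trans (cong₂ _*_ (sum-once 0ᵏ) (sum-once 0ᵏ)) (*-identityˡ 1ℤ))) (*-identityʳ C)))))
          where
          distinct : shareˣ b e e′ ≡ false → U.mult x x′ ≡ false
          distinct f = ≢true⇒false (λ m → let c , x′≡ = U.mult-elim {x} {x′} m in
            true≢false (ex-intro (λ u → U.nz u ∧ ((b ⟨ u ⟩ ∈im e) ∧ (b ⟨ u ⟩ ∈im e′))) x′
              (∧-intro (U.nz-intro {x′} x′≢0) (∧-intro
                (subst (λ y → (y ∈im e) ≡ true) (sym (trans (cong (b ⟨_⟩) x′≡) (app-·ʳ V b c x))) (∈im-scale e c (proj₁ (proj₂ (proj₂ o)))))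
                (proj₁ (proj₂ (proj₂ o′)))))) f)

        -- In the generic case some vector of `e′`, hence of b + e′, lies outside b + e, so by
        -- `index-bound` the intersection of the two sums has index at least q in the second.
        qqγγ : q * (q * sγγ) ≤ D * (1ℤ + q * χ (shareᴷ b e e′))
        qqγγ = weaken (shareᴷ b e e′) (<⇒0≤ 0<D)
          (λ _ → *-monoˡ (<⇒0≤ 0<q) (ℤ.≤-trans (*-monoˡ (<⇒0≤ 0<q) (sum-mono (λ z → χχ≤ (γ z) (γ′ z)))) qγ))
          (λ f → ℤ.≤-trans (*-monoˡ (<⇒0≤ 0<q) (small f)) qγ′)
          where
          small : shareᴷ b e e′ ≡ false → q * sγγ ≤ sγ′
          small f with bool-cases (ex λ w → not (span₂ b e (e′ ⟨ w ⟩)))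
          ... | inj₂ n = true≢false (not-intro n) f
          ... | inj₁ y = let w , nw = ex-elim (λ w → not (span₂ b e (e′ ⟨ w ⟩))) y in
            subst (λ t → q * t ≤ sγ′) (sum-cong (λ z → χ-∧ (γ z) (γ′ z)))
              (index-bound γ γ′ (span₂-closed b e) (span₂-closed b e′) (e′ ⟨ w ⟩) (not-elim nw)
                (span₂-intro {b} {e′} U.𝟎 w (trans (cong (_⊕ e′ ⟨ w ⟩) (app-0ʳ V b)) (⊕-identityˡ _))))

        four : ∀ s t s′ t′ → χ ((s ∨ t) ∧ (s′ ∨ t′)) ≤ χ s * χ s′ + χ s * χ t′ + χ s′ * χ t + χ t * χ t′
        four s t s′ t′ = subst (χ ((s ∨ t) ∧ (s′ ∨ t′)) ≤_)
          (cong₂ _+_ (cong₂ _+_ (cong₂ _+_ (χ-∧ s s′) (χ-∧ s t′)) (χ-∧ s′ t)) (χ-∧ t t′)) (go s t s′ t′)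
          where
          go : ∀ s t s′ t′ → χ ((s ∨ t) ∧ (s′ ∨ t′)) ≤ χ (s ∧ s′) + χ (s ∧ t′) + χ (s′ ∧ t) + χ (t ∧ t′)
          go true  true  true  true  = +≤+ (s≤s z≤n)
          go true  true  true  false = +≤+ (s≤s z≤n)
          go true  true  false true  = +≤+ (s≤s z≤n)
          go true  true  false false = +≤+ z≤n
          go true  false true  true  = +≤+ (s≤s z≤n)
          go true  false true  false = +≤+ (s≤s z≤n)
          go true  false false true  = +≤+ (s≤s z≤n)
          go true  false false false = +≤+ z≤n
          go false true  true  true  = +≤+ (s≤s z≤n)
          go false true  true  false = +≤+ (s≤s z≤n)
          go false true  false true  = +≤+ (s≤s z≤n)
          go false true  false false = +≤+ z≤n
          go false false true  true  = +≤+ z≤n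
          go false false true  false = +≤+ z≤n
          go false false false true  = +≤+ z≤n
          go false false false false = +≤+ z≤n

        cover : U → Carrier → Bool
        cover φ z = (α φ ∨ γ z) ∧ (α′ φ ∨ γ′ z)

        cover-sum : (∑[ φ ] ∑[ z ] χ (cover φ z)) ≤ sαα * A + sα * sγ′ + sα′ * sγ + C * sγγ
        cover-sum = ℤ.≤-trans (sum-mono (λ φ → sum-mono (λ z → four (α φ) (γ z) (α′ φ) (γ′ z)))) (ℤ.≤-reflexive (begin
          (∑[ φ ] ∑[ z ] (χ (α φ) * χ (α′ φ) + χ (α φ) * χ (γ′ z) + χ (α′ φ) * χ (γ z) + χ (γ z) * χ (γ′ z)))
            ≡⟨ sum-cong (λ φ → trans (sum-+ (λ z → χ (α φ) * χ (α′ φ) + χ (α φ) * χ (γ′ z) + χ (α′ φ) * χ (γ z)) (λ z → χ (γ z) * χ (γ′ z)))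
                 (cong (_+ sγγ) (trans (sum-+ (λ z → χ (α φ) * χ (α′ φ) + χ (α φ) * χ (γ′ z)) (λ z → χ (α′ φ) * χ (γ z)))
                   (cong₂ _+_ (trans (sum-+ (λ z → χ (α φ) * χ (α′ φ)) (λ z → χ (α φ) * χ (γ′ z)))
                     (cong₂ _+_ (trans (sum-const {Carrier} (χ (α φ) * χ (α′ φ))) (*-comm A _)) (sum-*ˡ (χ (α φ)) (λ z → χ (γ′ z)))))
                     (sum-*ˡ (χ (α′ φ)) (λ z → χ (γ z))))))) ⟩
          (∑[ φ ] (χ (α φ) * χ (α′ φ) * A + χ (α φ) * sγ′ + χ (α′ φ) * sγ + sγγ))
            ≡⟨ trans (sum-+ (λ φ → χ (α φ) * χ (α′ φ) * A + χ (α φ) * sγ′ + χ (α′ φ) * sγ) (λ _ → sγγ))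
                 (cong₂ _+_ (trans (sum-+ (λ φ → χ (α φ) * χ (α′ φ) * A + χ (α φ) * sγ′) (λ φ → χ (α′ φ) * sγ))
                   (cong₂ _+_ (trans (sum-+ (λ φ → χ (α φ) * χ (α′ φ) * A) (λ φ → χ (α φ) * sγ′))
                     (cong₂ _+_ (sum-*ʳ A (λ φ → χ (α φ) * χ (α′ φ))) (sum-*ʳ sγ′ (λ φ → χ (α φ)))))
                     (sum-*ʳ sγ (λ φ → χ (α′ φ))))) (sum-const {U} sγγ)) ⟩
          sαα * A + sα * sγ′ + sα′ * sγ + C * sγγ ∎))
          where open ≡-Reasoning

        opaque
          unfolding _*_
          dist : ∀ q a c s₁ s₂ s₃ s₄ s₅ s₆ → q * (q * (s₁ * a + s₂ * s₃ + s₄ * s₅ + c * s₆)) ≡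
                 q * (q * s₁) * a + (q * s₂) * (q * s₃) + (q * s₄) * (q * s₅) + c * (q * (q * s₆))
          dist = solve-∀ ring
          coll : ∀ q a c d y z → c * (1ℤ + q * y) * a + c * d + c * d + c * (d * (1ℤ + q * z)) ≡
                 c * (a + pos 3 * d + q * a * y + q * d * z)
          coll = solve-∀ ring

      -- `neighbour-meets` yields two conditions, each a disjunction of one on `φ` and one on `z`.
      -- Generically the four conjunctions have, after multiplication by q², sizes at most C A, C D,
      -- C D and C D; the first grows under `shareˣ` and the last under `shareᴷ`.
      triple-bound : q * (q * (∑[ φ ] ∑[ z ] χ (meet (b M.⊕ outer V φ z) e ∧ meet (b M.⊕ outer V φ z) e′))) ≤
                     C * (A + pos 3 * D + q * A * χ (shareˣ b e e′) + q * D * χ (shareᴷ b e e′))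
      triple-bound = begin
        q * (q * (∑[ φ ] ∑[ z ] χ (meet (b M.⊕ outer V φ z) e ∧ meet (b M.⊕ outer V φ z) e′)))
          ≤⟨ *-monoˡ (<⇒0≤ 0<q) (*-monoˡ (<⇒0≤ 0<q) (ℤ.≤-trans (sum-mono (λ φ → sum-mono (λ z → χ-mono (λ t →
               ∧-intro (neighbour-meets {e} x (proj₂ (proj₂ (proj₂ o))) φ z (∧-elimˡ t))
                 (neighbour-meets {e′} x′ (proj₂ (proj₂ (proj₂ o′))) φ z (∧-elimʳ {meet (b M.⊕ outer V φ z) e} t)))))) cover-sum)) ⟩
        q * (q * (sαα * A + sα * sγ′ + sα′ * sγ + C * sγγ))
          ≡⟨ dist q A C sαα sα sγ′ sα′ sγ sγγ ⟩
        q * (q * sαα) * A + (q * sα) * (q * sγ′) + (q * sα′) * (q * sγ) + C * (q * (q * sγγ))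
          ≤⟨ ℤ.+-mono-≤ (ℤ.+-mono-≤ (ℤ.+-mono-≤ (*-monoʳ (<⇒0≤ 0<A) qqαα)
               (subst (λ t → t * (q * sγ′) ≤ C * D) (sym qα) (*-monoˡ (<⇒0≤ 0<C) qγ′)))
               (subst (λ t → t * (q * sγ) ≤ C * D) (sym qα′) (*-monoˡ (<⇒0≤ 0<C) qγ)))
               (*-monoˡ (<⇒0≤ 0<C) qqγγ) ⟩
        C * (1ℤ + q * χ (shareˣ b e e′)) * A + C * D + C * D + C * (D * (1ℤ + q * χ (shareᴷ b e e′)))
          ≡⟨ coll q A C D (χ (shareˣ b e e′)) (χ (shareᴷ b e e′)) ⟩
        C * (A + pos 3 * D + q * A * χ (shareˣ b e e′) + q * D * χ (shareᴷ b e e′)) ∎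
        where open ℤ.≤-Reasoning

  -- Counting quadruples inside one part

  module Stability (𝔽 : FiniteField) (V : Linear.VSpace 𝔽) (k′ : ℕ) where
    open Linear 𝔽
    open VS V
    open Moments 𝔽 V k′
    open Energy 𝔽 V k′
    open Pairs 𝔽 V k′
    open Triples 𝔽 V k′

    pairs-not-meet : ∀ F → pairs F (λ b e → not (meet b e)) ≡ size F * size F - pairs F meet
    pairs-not-meet F = trans (over-cong F (λ b → trans (over-cong F (λ e → χ-not (meet b e)))
        (trans (over-- F (λ _ → 1ℤ) (λ e → χ (meet b e))) (cong (λ z → z - over F (λ e → χ (meet b e))) (trans (over-const F 1ℤ) (*-identityʳ (size F)))))))
      (trans (over-- F (λ _ → size F) (λ b → over F (λ e → χ (meet b e)))) (cong (λ z → z - pairs F meet) (over-const F (size F))))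

    0≤size : ∀ F → 0ℤ ≤ size F
    0≤size F = sum-nonneg (λ b → 0≤χ (F b))

    -- The second argument of `one` is fixed first, so that `bad F` is by definition the sum of the
    -- row counts `r` that occur in `mR-lower`.
    bad : (M → Bool) → ℤ
    bad F = pairs F (λ e b → not (one b e))

    bad-split : ∀ F → bad F ≡ pairs F (λ b e → not (meet b e)) + pairs F two
    bad-split F = begin
      bad F ≡⟨ over-swap F F (λ e b → χ (not (one b e))) ⟩
      over F (λ b → over F (λ e → χ (not (one b e))))
        ≡⟨ over-cong F (λ b → trans (over-cong F (λ e → pt b e)) (over-+ F (λ e → χ (not (meet b e))) (λ e → χ (two b e)))) ⟩
      over F (λ b → over F (λ e → χ (not (meet b e))) + over F (λ e → χ (two b e)))
        ≡⟨ over-+ F (λ b → over F (λ e → χ (not (meet b e)))) (λ b → over F (λ e → χ (two b e))) ⟩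
      pairs F (λ b e → not (meet b e)) + pairs F two ∎
      where
      open ≡-Reasoning
      cases : ∀ m t → (t ≡ true → m ≡ true) → χ (not (m ∧ not t)) ≡ χ (not m) + χ t
      cases true  true  _ = refl
      cases true  false _ = refl
      cases false false _ = refl
      cases false true  h with h refl
      ... | ()
      pt : ∀ b e → χ (not (one b e)) ≡ χ (not (meet b e)) + χ (two b e)
      pt b e = cases (meet b e) (two b e) (two⇒meet b e)

    -- The two bounds carry the factors `a` and q - 1 that also clear the denominators in
    -- `few-through` and `few-lying`, so that lightness can be negated into the hypothesis of
    -- `peel`.
    module _ (F : M → Bool) (F-inj : Injective F) (X Y : ℤ) (0≤X : 0ℤ ≤ X) (0≤Y : 0ℤ ≤ Y)
             (light-points : ∀ v → ¬ v ≡ 𝟎 → a * deg F v ≤ X)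
             (light-spans : ∀ b e → F b ≡ true → F e ≡ true → one b e ≡ true →
                            (q - 1ℤ) * over F (λ e′ → χ (shareᴷ b e e′)) ≤ Y) where
      private
        -- `Z` bounds q - 1 times the sum of `W b e e′` over `e′`, for `b` and `e` that meet in a
        -- point; its terms are the generic contribution and those of the two kinds of coincidence.
        sz m Z : ℤ
        sz = size F
        m = pairs F (λ b e → not (meet b e))
        Z = (q - 1ℤ) * (A + pos 3 * D) * sz + q * X + q * D * Y

        oo : M → M → M → Bool
        oo b e e′ = one b e ∧ one b e′

        W : M → M → M → ℤ
        W b e e′ = A + pos 3 * D + q * A * χ (shareˣ b e e′) + q * D * χ (shareᴷ b e e′)

        0≤W : ∀ b e e′ → 0ℤ ≤ W b e e′
        0≤W b e e′ = 0≤sum (0≤sum (0≤sum (<⇒0≤ 0<A) (0≤prod 0≤pos (<⇒0≤ 0<D)))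
          (0≤prod (0≤prod (<⇒0≤ 0<q) (<⇒0≤ 0<A)) (0≤χ (shareˣ b e e′))))
          (0≤prod (0≤prod (<⇒0≤ 0<q) (<⇒0≤ 0<D)) (0≤χ (shareᴷ b e e′)))

        0≤Z : 0ℤ ≤ Z
        0≤Z = 0≤sum (0≤sum (0≤prod (0≤prod 0≤q-1 (0≤sum (<⇒0≤ 0<A) (0≤prod 0≤pos (<⇒0≤ 0<D)))) (0≤size F))
          (0≤prod (<⇒0≤ 0<q) 0≤X)) (0≤prod (0≤prod (<⇒0≤ 0<q) (<⇒0≤ 0<D)) 0≤Y)

        -- A pair counted by `T` consists of `b` and a neighbour that meets both `e` and `e′`, so
        -- `triple-bound` limits the neighbours of each `b`.
        T-bound : ∀ e e′ → q * (q * T (Restrict F e e′)) ≤ over F (λ b → χ (oo b e e′) * (C * W b e e′))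
        T-bound e e′ = begin
          q * (q * T (Restrict F e e′))
            ≤⟨ *-monoˡ (<⇒0≤ 0<q) (*-monoˡ (<⇒0≤ 0<q) T≤) ⟩
          q * (q * (∑[ b ] χ (Restrict F e e′ b) * S b))
            ≡⟨ trans (cong (q *_) (sym (sum-*ˡ q (λ b → χ (Restrict F e e′ b) * S b)))) (sym (sum-*ˡ q (λ b → q * (χ (Restrict F e e′ b) * S b)))) ⟩
          (∑[ b ] q * (q * (χ (Restrict F e e′ b) * S b)))
            ≡⟨ sum-cong (λ b → trans (cong (λ t → q * (q * (t * S b))) (χ-∧ (F b) (oo b e e′))) (ar q (χ (F b)) (χ (oo b e e′)) (S b))) ⟩
          over F (λ b → χ (oo b e e′) * (q * (q * S b)))
            ≤⟨ over-mono F (λ b _ → χ-guard F {oo b e e′} (λ p → triple-bound b e e′ (∧-elimˡ p) (∧-elimʳ {one b e} p))) ⟩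
          over F (λ b → χ (oo b e e′) * (C * W b e e′)) ∎
          where
          open ℤ.≤-Reasoning
          S : M → ℤ
          S b = ∑[ φ ] ∑[ z ] χ (meet (b M.⊕ outer V φ z) e ∧ meet (b M.⊕ outer V φ z) e′)
          opaque
            unfolding _*_
            ar : ∀ q f o s → q * (q * (f * o * s)) ≡ f * (o * (q * (q * s)))
            ar = solve-∀ ring
          restrict⇒meets : ∀ c → Restrict F e e′ c ≡ true → meet c e ∧ meet c e′ ≡ true
          restrict⇒meets c p = ∧-intro (∧-elimˡ {meet c e} (∧-elimˡ (∧-elimʳ {F c} p)))
            (∧-elimˡ {meet c e′} (∧-elimʳ {one c e} (∧-elimʳ {F c} p)))
          T≤ : T (Restrict F e e′) ≤ (∑[ b ] χ (Restrict F e e′ b) * S b)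
          T≤ = begin
            T (Restrict F e e′)
              ≤⟨ sum-mono (λ φ → sum-mono (λ z → sum-mono (λ b → *-monoˡ (0≤χ (Restrict F e e′ b)) (χ-mono (restrict⇒meets (b M.⊕ outer V φ z)))))) ⟩
            (∑[ φ ] ∑[ z ] over (Restrict F e e′) (λ b → χ (meet (b M.⊕ outer V φ z) e ∧ meet (b M.⊕ outer V φ z) e′)))
              ≡⟨ sum-cong (λ φ → sym (over-sum (Restrict F e e′) (λ b z → χ (meet (b M.⊕ outer V φ z) e ∧ meet (b M.⊕ outer V φ z) e′)))) ⟩
            (∑[ φ ] over (Restrict F e e′) (λ b → ∑[ z ] χ (meet (b M.⊕ outer V φ z) e ∧ meet (b M.⊕ outer V φ z) e′)))
              ≡⟨ sym (over-sum (Restrict F e e′) (λ b φ → ∑[ z ] χ (meet (b M.⊕ outer V φ z) e ∧ meet (b M.⊕ outer V φ z) e′))) ⟩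
            (∑[ b ] χ (Restrict F e e′ b) * S b) ∎

        -- As `b` and `e` share only the line of `b ⟨ x ⟩`, a common point of all three lies on it.
        -- Hence `e′` passes through `b ⟨ x ⟩` and is counted by the degree there.
        shareˣ-count : ∀ b e → F b ≡ true → one b e ≡ true → a * over F (λ e′ → χ (shareˣ b e e′)) ≤ X
        shareˣ-count b e Fb p = ℤ.≤-trans (*-monoˡ (<⇒0≤ 0<a) (over-mono F (λ e′ _ → le e′))) (light-points (b ⟨ x ⟩) bx≢0)
          where
          o : ∃ λ x → ¬ x ≡ U.𝟎 × (b ⟨ x ⟩ ∈im e) ≡ true × (∀ u → (b ⟨ u ⟩ ∈im e) ≡ true → U.mult x u ≡ true)
          o = one-elim b e p
          x : U
          x = proj₁ o
          bx≢0 : ¬ b ⟨ x ⟩ ≡ 𝟎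
          bx≢0 z = proj₁ (proj₂ o) (F-inj b Fb x z)
          le : ∀ e′ → χ (shareˣ b e e′) ≤ (∑[ u ] χ (U.nz u) * χ (e′ ⟨ u ⟩ == b ⟨ x ⟩))
          le e′ with bool-cases (shareˣ b e e′)
          ... | inj₂ n = ℤ.≤-trans (ℤ.≤-reflexive (cong χ n)) (sum-nonneg (λ u → 0≤prod (0≤χ (U.nz u)) (0≤χ (e′ ⟨ u ⟩ == b ⟨ x ⟩))))
          ... | inj₁ s = hit (ex-elim (λ u → U.nz u ∧ ((b ⟨ u ⟩ ∈im e) ∧ (b ⟨ u ⟩ ∈im e′))) s)
            where
            hit : (∃ λ u → U.nz u ∧ ((b ⟨ u ⟩ ∈im e) ∧ (b ⟨ u ⟩ ∈im e′)) ≡ true) → χ (shareˣ b e e′) ≤ (∑[ u ] χ (U.nz u) * χ (e′ ⟨ u ⟩ == b ⟨ x ⟩))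
            hit (u , r) with U.mult-elim {x} {u} (proj₂ (proj₂ (proj₂ o)) u (∧-elimˡ (∧-elimʳ {U.nz u} r)))
            ... | c , u≡cx with inverse c (U.nonzero-scalar {c} {x} (λ z → U.nz-elim {u} (∧-elimˡ r) (trans u≡cx z)))
            ...   | d , cd with ∈im-elim e′ (∈im-scale e′ d (∧-elimʳ {b ⟨ u ⟩ ∈im e} (∧-elimʳ {U.nz u} r)))
            ...     | w , s′ = ℤ.≤-trans (χ≤1 (shareˣ b e e′)) (ℤ.≤-trans
                    (ℤ.≤-reflexive (sym (trans (cong₂ (λ y z → χ y * χ z) (U.nz-intro {w} w≢0) (≡⇒== ew)) (*-identityˡ 1ℤ))))
                    (single≤ (λ u → χ (U.nz u) * χ (e′ ⟨ u ⟩ == b ⟨ x ⟩)) (λ u → 0≤prod (0≤χ (U.nz u)) (0≤χ (e′ ⟨ u ⟩ == b ⟨ x ⟩))) w))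
              where
              ew : e′ ⟨ w ⟩ ≡ b ⟨ x ⟩
              ew = trans s′ (trans (cong (λ y → d · b ⟨ y ⟩) u≡cx) (trans (cong (d ·_) (app-·ʳ V b c x)) (unscale cd (b ⟨ x ⟩))))
              w≢0 : ¬ w ≡ U.𝟎
              w≢0 refl = bx≢0 (trans (sym ew) (app-0ʳ V e′))

        W-sum : ∀ b e → F b ≡ true → F e ≡ true → (q - 1ℤ) * over F (λ e′ → χ (oo b e e′) * W b e e′) ≤ Z
        W-sum b e Fb Fe with bool-cases (one b e)
        ... | inj₂ n = subst (_≤ Z) (sym (trans (cong ((q - 1ℤ) *_) (trans (over-cong F {w′ = λ _ → 0ℤ} (λ e′ →
                trans (cong (λ t → χ (t ∧ one b e′) * W b e e′) n) (zeroˡ (W b e e′)))) (trans (over-const F 0ℤ) (zeroʳ sz)))) (zeroʳ (q - 1ℤ)))) 0≤Z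
        ... | inj₁ p = begin
          (q - 1ℤ) * over F (λ e′ → χ (oo b e e′) * W b e e′)
            ≤⟨ *-monoˡ 0≤q-1 (over-mono F (λ e′ _ → subst (χ (oo b e e′) * W b e e′ ≤_) (*-identityˡ _) (*-monoʳ (0≤W b e e′) (χ≤1 (oo b e e′))))) ⟩
          (q - 1ℤ) * over F (W b e)
            ≡⟨ cong ((q - 1ℤ) *_) (trans (over-+ F (λ e′ → A + pos 3 * D + q * A * χ (shareˣ b e e′)) (λ e′ → q * D * χ (shareᴷ b e e′)))
                 (cong₂ _+_ (trans (over-+ F (λ _ → A + pos 3 * D) (λ e′ → q * A * χ (shareˣ b e e′)))
                   (cong₂ _+_ (over-const F (A + pos 3 * D)) (over-*ˡ F (q * A) (λ e′ → χ (shareˣ b e e′)))))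
                   (over-*ˡ F (q * D) (λ e′ → χ (shareᴷ b e e′))))) ⟩
          (q - 1ℤ) * (sz * (A + pos 3 * D) + q * A * sx + q * D * sk)
            ≡⟨ ar (q - 1ℤ) q A D sz sx sk ⟩
          (q - 1ℤ) * (A + pos 3 * D) * sz + q * (a * sx) + q * D * ((q - 1ℤ) * sk)
            ≤⟨ ℤ.+-mono-≤ (ℤ.+-monoʳ-≤ ((q - 1ℤ) * (A + pos 3 * D) * sz) (*-monoˡ (<⇒0≤ 0<q) (shareˣ-count b e Fb p)))
                 (*-monoˡ (0≤prod (<⇒0≤ 0<q) (<⇒0≤ 0<D)) (light-spans b e Fb Fe p)) ⟩
          Z ∎
          where
          open ℤ.≤-Reasoning
          sx sk : ℤ
          sx = over F (λ e′ → χ (shareˣ b e e′))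
          sk = over F (λ e′ → χ (shareᴷ b e e′))
          opaque
            unfolding _*_
            ar : ∀ p q a d s x k → p * (s * (a + pos 3 * d) + q * a * x + q * d * k) ≡ p * (a + pos 3 * d) * s + q * (p * a * x) + q * d * (p * k)
            ar = solve-∀ ring

        mR sR : M → M → ℤ
        mR e e′ = pairs (Restrict F e e′) meet
        sR e e′ = size (Restrict F e e′)

        over² : (M → M → ℤ) → ℤ
        over² w = over F (λ e → over F (w e))

        over²-mono : ∀ {w w′} → (∀ e e′ → F e ≡ true → F e′ ≡ true → w e e′ ≤ w′ e e′) → over² w ≤ over² w′
        over²-mono h = over-mono F (λ e Fe → over-mono F (λ e′ Fe′ → h e e′ Fe Fe′))

        over²-*ˡ : ∀ c w → over² (λ e e′ → c * w e e′) ≡ c * over² w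
        over²-*ˡ c w = trans (over-cong F (λ e → over-*ˡ F c (w e))) (over-*ˡ F c (λ e → over F (w e)))

        -- `adjacency-count-bound` is applied to each restricted family. Exchanging the summations
        -- so that `e′` becomes innermost is essential: only for fixed `b` and `e` do the lightness
        -- assumptions bound the coincidences.
        upper : q * over² (λ e e′ → a * mR e e′ - D * (sR e e′ * sR e e′)) ≤ P * (sz * sz * Z)
        upper = *-cancelˡ 0<C (begin
          C * (q * over² L)
            ≡⟨ trans (ar₁ C q (over² L)) (cong (q *_) (sym (over²-*ˡ C L))) ⟩
          q * over² (λ e e′ → C * L e e′)
            ≤⟨ *-monoˡ (<⇒0≤ 0<q) (over²-mono (λ e e′ Fe Fe′ → adjacency-count-bound (Restrict F e e′) (λ b p → F-inj b (∧-elimˡ p)))) ⟩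
          q * over² (λ e e′ → q * (h * T (Restrict F e e′)))
            ≡⟨ cong (q *_) (trans (over-cong F (λ e → over-cong F (λ e′ → ar₁ q h (T (Restrict F e e′))))) (over²-*ˡ h (λ e e′ → q * T (Restrict F e e′)))) ⟩
          q * (h * over² (λ e e′ → q * T (Restrict F e e′)))
            ≡⟨ trans (ar₁ q h _) (cong (h *_) (sym (over²-*ˡ q (λ e e′ → q * T (Restrict F e e′))))) ⟩
          h * over² (λ e e′ → q * (q * T (Restrict F e e′)))
            ≤⟨ *-monoˡ (<⇒0≤ 0<h) (over²-mono (λ e e′ _ _ → T-bound e e′)) ⟩
          h * over² (λ e e′ → over F (λ b → χ (oo b e e′) * (C * W b e e′)))
            ≡⟨ cong (h *_) (trans (over-cong F (λ e → over-swap F F (λ e′ b → χ (oo b e e′) * (C * W b e e′))))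
                 (trans (over-swap F F (λ e b → over F (λ e′ → χ (oo b e e′) * (C * W b e e′))))
                   (trans (over-cong F (λ b → over-cong F (λ e → trans (over-cong F (λ e′ → ar₁ (χ (oo b e e′)) C (W b e e′)))
                     (over-*ˡ F C (λ e′ → χ (oo b e e′) * W b e e′))))) (over²-*ˡ C (λ b e → over F (λ e′ → χ (oo b e e′) * W b e e′)))))) ⟩
          h * (C * over² (λ b e → over F (λ e′ → χ (oo b e e′) * W b e e′)))
            ≡⟨ trans (ar₂ (q - 1ℤ) P C _) (cong (λ t → C * (P * t)) (sym (over²-*ˡ (q - 1ℤ) (λ b e → over F (λ e′ → χ (oo b e e′) * W b e e′))))) ⟩
          C * (P * over² (λ b e → (q - 1ℤ) * over F (λ e′ → χ (oo b e e′) * W b e e′)))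
            ≤⟨ *-monoˡ (<⇒0≤ 0<C) (*-monoˡ (<⇒0≤ 0<P) (over²-mono W-sum)) ⟩
          C * (P * over² (λ _ _ → Z))
            ≡⟨ cong (λ t → C * (P * t)) (trans (over-cong F (λ _ → over-const F Z)) (trans (over-const F (sz * Z)) (sym (*-assoc sz sz Z)))) ⟩
          C * (P * (sz * sz * Z)) ∎)
          where
          open ℤ.≤-Reasoning
          L : M → M → ℤ
          L e e′ = a * mR e e′ - D * (sR e e′ * sR e e′)
          opaque
            unfolding _*_
            ar₁ : ∀ x y z → x * (y * z) ≡ y * (x * z)
            ar₁ = solve-∀ ring
            ar₂ : ∀ x y c z → x * y * (c * z) ≡ c * (y * (x * z))
            ar₂ = solve-∀ ring

        r n : M → ℤ
        r e = over F (λ c → χ (not (one c e)))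
        n b = over F (λ c → χ (not (meet b c)))

        -- Bonferroni: the indicator of a conjunction is at least 1 minus the number of failing
        -- conditions. The linear left side can then be summed term by term.
        five : ∀ s t s′ t′ w → 1ℤ + - χ (not s) + - χ (not t) + - χ (not s′) + - χ (not t′) + - χ (not w) ≤
                               χ (s ∧ t) * (χ (s′ ∧ t′) * χ w)
        five s t s′ t′ w = subst (1ℤ + - χ (not s) + - χ (not t) + - χ (not s′) + - χ (not t′) + - χ (not w) ≤_) (trans (χ-∧ (s ∧ t) ((s′ ∧ t′) ∧ w)) (cong (χ (s ∧ t) *_) (χ-∧ (s′ ∧ t′) w))) (go s t s′ t′ w)
          where
          bound : ∀ {x} b → x ≤ 0ℤ → x ≤ χ b
          bound b p = ℤ.≤-trans p (0≤χ b)
          sub : ∀ {x} b → x ≤ 0ℤ → x + - χ (not b) ≤ 0ℤ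
          sub b p = ℤ.+-mono-≤ p (ℤ.neg-mono-≤ (0≤χ (not b)))
          go : ∀ s t s′ t′ w → 1ℤ + - χ (not s) + - χ (not t) + - χ (not s′) + - χ (not t′) + - χ (not w) ≤ χ ((s ∧ t) ∧ ((s′ ∧ t′) ∧ w))
          go true true true true true = ℤ.≤-refl
          go true true true true false = ℤ.≤-refl
          go true true true false w = sub w ℤ.≤-refl
          go true true false t′ w = sub w (sub t′ ℤ.≤-refl)
          go true false s′ t′ w = sub w (sub t′ (sub s′ ℤ.≤-refl))
          go false t s′ t′ w = sub w (sub t′ (sub s′ (sub t ℤ.≤-refl)))

        -- One shape serves all four nested sums of `mR-lower`; free places are filled with zeros.
        linear : ∀ (x₀ : ℤ) (f₁ f₂ f₃ f₄ f₅ : M → ℤ) →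
          over F (λ c → x₀ + - f₁ c + - f₂ c + - f₃ c + - f₄ c + - f₅ c) ≡
          sz * x₀ + - over F f₁ + - over F f₂ + - over F f₃ + - over F f₄ + - over F f₅
        linear x₀ f₁ f₂ f₃ f₄ f₅ =
          trans (over-- F (λ c → x₀ + - f₁ c + - f₂ c + - f₃ c + - f₄ c) f₅) (cong (_+ - over F f₅)
          (trans (over-- F (λ c → x₀ + - f₁ c + - f₂ c + - f₃ c) f₄) (cong (_+ - over F f₄)
          (trans (over-- F (λ c → x₀ + - f₁ c + - f₂ c) f₃) (cong (_+ - over F f₃)
          (trans (over-- F (λ c → x₀ + - f₁ c) f₂) (cong (_+ - over F f₂)
          (trans (over-- F (λ _ → x₀) f₁) (cong (_+ - over F f₁) (over-const F x₀))))))))))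

        -- Among all quadruples, each of the four conditions linking `b` and `c` to `e` and `e′`
        -- fails for sz² bad of them, and the condition that `b` meets `c` fails for sz² m.
        mR-lower : sz * (sz * (sz * sz)) - pos 4 * (sz * sz * bad F) - sz * sz * m ≤ over² mR
        mR-lower = begin
          sz * (sz * (sz * sz)) - pos 4 * (sz * sz * bad F) - sz * sz * m
            ≡⟨ sym sums ⟩
          over² (λ e e′ → over² (λ b c → 1ℤ + - χ (not (one b e)) + - χ (not (one b e′)) + - χ (not (one c e)) + - χ (not (one c e′)) + - χ (not (meet b c))))
            ≤⟨ over²-mono (λ e e′ _ _ → over²-mono (λ b c _ _ → five (one b e) (one b e′) (one c e) (one c e′) (meet b c))) ⟩
          over² (λ e e′ → over² (λ b c → χ (oo b e e′) * (χ (oo c e e′) * χ (meet b c))))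
            ≡⟨ over-cong F (λ e → over-cong F (λ e′ → sym (unfold e e′))) ⟩
          over² mR ∎
          where
          open ℤ.≤-Reasoning
          unfold : ∀ e e′ → mR e e′ ≡ over² (λ b c → χ (oo b e e′) * (χ (oo c e e′) * χ (meet b c)))
          unfold e e′ = sum-cong (λ b → trans (cong₂ _*_ (χ-∧ (F b) (oo b e e′))
              (sum-cong (λ c → trans (cong (_* χ (meet b c)) (χ-∧ (F c) (oo c e e′))) (*-assoc (χ (F c)) (χ (oo c e e′)) (χ (meet b c))))))
            (trans (*-assoc (χ (F b)) (χ (oo b e e′)) _) (cong (χ (F b) *_) (sym (over-*ˡ F (χ (oo b e e′)) (λ c → χ (oo c e e′) * χ (meet b c)))))))
          opaque
            unfolding _*_
            e₁ : ∀ s x y r r′ n → s * 1ℤ + - (s * x) + - (s * y) + - r + - r′ + - n ≡ (s + - r + - r′) + - (s * x) + - (s * y) + - n + - 0ℤ + - 0ℤ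
            e₁ = solve-∀ ring
            e₂ : ∀ s r r′ m → s * (s + - r + - r′) + - (s * r) + - (s * r′) + - m + - (s * 0ℤ) + - (s * 0ℤ) ≡
                 (s * s + - (pos 2 * (s * r)) + - m) + - (pos 2 * s * r′) + - 0ℤ + - 0ℤ + - 0ℤ + - 0ℤ
            e₂ = solve-∀ ring
            e₃ : ∀ s r m R → s * (s * s + - (pos 2 * (s * r)) + - m) + - (pos 2 * s * R) + - (s * 0ℤ) + - (s * 0ℤ) + - (s * 0ℤ) + - (s * 0ℤ) ≡
                 (s * (s * s) + - (s * m) + - (pos 2 * s * R)) + - (pos 2 * (s * s) * r) + - 0ℤ + - 0ℤ + - 0ℤ + - 0ℤ
            e₃ = solve-∀ ring
            e₄ : ∀ s m R → s * (s * (s * s) + - (s * m) + - (pos 2 * s * R)) + - (pos 2 * (s * s) * R) + - (s * 0ℤ) + - (s * 0ℤ) + - (s * 0ℤ) + - (s * 0ℤ) ≡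
                 s * (s * (s * s)) - pos 4 * (s * s * R) - s * s * m
            e₄ = solve-∀ ring
          z₀ : over F (λ _ → 0ℤ) ≡ sz * 0ℤ
          z₀ = over-const F 0ℤ
          S₁ : ∀ e e′ b → over F (λ c → 1ℤ + - χ (not (one b e)) + - χ (not (one b e′)) + - χ (not (one c e)) + - χ (not (one c e′)) + - χ (not (meet b c))) ≡
               (sz + - r e + - r e′) + - (sz * χ (not (one b e))) + - (sz * χ (not (one b e′))) + - n b + - 0ℤ + - 0ℤ
          S₁ e e′ b = trans (linear 1ℤ (λ _ → χ (not (one b e))) (λ _ → χ (not (one b e′))) (λ c → χ (not (one c e))) (λ c → χ (not (one c e′))) (λ c → χ (not (meet b c))))
            (trans (cong₂ (λ x y → sz * 1ℤ + - x + - y + - r e + - r e′ + - n b) (over-const F _) (over-const F _))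
              (e₁ sz (χ (not (one b e))) (χ (not (one b e′))) (r e) (r e′) (n b)))
          S₂ : ∀ e e′ → over F (λ b → (sz + - r e + - r e′) + - (sz * χ (not (one b e))) + - (sz * χ (not (one b e′))) + - n b + - 0ℤ + - 0ℤ) ≡
               (sz * sz + - (pos 2 * (sz * r e)) + - m) + - (pos 2 * sz * r e′) + - 0ℤ + - 0ℤ + - 0ℤ + - 0ℤ
          S₂ e e′ = trans (linear (sz + - r e + - r e′) (λ b → sz * χ (not (one b e))) (λ b → sz * χ (not (one b e′))) n (λ _ → 0ℤ) (λ _ → 0ℤ))
            (trans (cong₂ (λ x y → sz * (sz + - r e + - r e′) + - x + - y + - m + - over F (λ _ → 0ℤ) + - over F (λ _ → 0ℤ))
                (over-*ˡ F sz (λ b → χ (not (one b e)))) (over-*ˡ F sz (λ b → χ (not (one b e′)))))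
              (trans (cong (λ z → sz * (sz + - r e + - r e′) + - (sz * r e) + - (sz * r e′) + - m + - z + - z) z₀) (e₂ sz (r e) (r e′) m)))
          S₃ : ∀ e → over F (λ e′ → (sz * sz + - (pos 2 * (sz * r e)) + - m) + - (pos 2 * sz * r e′) + - 0ℤ + - 0ℤ + - 0ℤ + - 0ℤ) ≡
               (sz * (sz * sz) + - (sz * m) + - (pos 2 * sz * bad F)) + - (pos 2 * (sz * sz) * r e) + - 0ℤ + - 0ℤ + - 0ℤ + - 0ℤ
          S₃ e = trans (linear (sz * sz + - (pos 2 * (sz * r e)) + - m) (λ e′ → pos 2 * sz * r e′) (λ _ → 0ℤ) (λ _ → 0ℤ) (λ _ → 0ℤ) (λ _ → 0ℤ))
            (trans (cong₂ (λ x z → sz * (sz * sz + - (pos 2 * (sz * r e)) + - m) + - x + - z + - z + - z + - z) (over-*ˡ F (pos 2 * sz) r) z₀)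
              (e₃ sz (r e) m (bad F)))
          S₄ : over F (λ e → (sz * (sz * sz) + - (sz * m) + - (pos 2 * sz * bad F)) + - (pos 2 * (sz * sz) * r e) + - 0ℤ + - 0ℤ + - 0ℤ + - 0ℤ) ≡
               sz * (sz * (sz * sz)) - pos 4 * (sz * sz * bad F) - sz * sz * m
          S₄ = trans (linear (sz * (sz * sz) + - (sz * m) + - (pos 2 * sz * bad F)) (λ e → pos 2 * (sz * sz) * r e) (λ _ → 0ℤ) (λ _ → 0ℤ) (λ _ → 0ℤ) (λ _ → 0ℤ))
            (trans (cong₂ (λ x z → sz * (sz * (sz * sz) + - (sz * m) + - (pos 2 * sz * bad F)) + - x + - z + - z + - z + - z) (over-*ˡ F (pos 2 * (sz * sz)) r) z₀)
              (e₄ sz m (bad F)))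
          sums : over² (λ e e′ → over² (λ b c → 1ℤ + - χ (not (one b e)) + - χ (not (one b e′)) + - χ (not (one c e)) + - χ (not (one c e′)) + - χ (not (meet b c)))) ≡
                 sz * (sz * (sz * sz)) - pos 4 * (sz * sz * bad F) - sz * sz * m
          sums = trans (over-cong F (λ e → trans (over-cong F (λ e′ → trans (over-cong F (λ b → S₁ e e′ b)) (S₂ e e′))) (S₃ e))) S₄

        sR≤ : ∀ e e′ → sR e e′ * sR e e′ ≤ sz * sz
        sR≤ e e′ = ℤ.≤-trans (*-monoʳ (0≤size (Restrict F e e′)) le) (*-monoˡ (0≤size F) le)
          where
          le : sR e e′ ≤ sz
          le = sum-mono (λ b → χ-mono {Restrict F e e′ b} {F b} (λ p → ∧-elimˡ p))

        scaled : sz * sz * (q * (a * (sz * sz - pos 4 * bad F - m) - D * (sz * sz))) ≤ sz * sz * (P * Z)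
        scaled = begin
          sz * sz * (q * (a * (sz * sz - pos 4 * bad F - m) - D * (sz * sz)))
            ≡⟨ ar₁ sz q a (bad F) m D ⟩
          q * (a * (sz * (sz * (sz * sz)) - pos 4 * (sz * sz * bad F) - sz * sz * m) + - (sz * (sz * (D * (sz * sz)))))
            ≤⟨ *-monoˡ (<⇒0≤ 0<q) (ℤ.+-mono-≤ (*-monoˡ (<⇒0≤ 0<a) mR-lower) (ℤ.neg-mono-≤ sR-sum)) ⟩
          q * (a * over² mR - over² (λ e e′ → D * (sR e e′ * sR e e′)))
            ≡⟨ cong (q *_) (trans (cong (λ z → z - over² (λ e e′ → D * (sR e e′ * sR e e′))) (sym (over²-*ˡ a mR)))
                 (sym (trans (over-cong F (λ e → over-- F (λ e′ → a * mR e e′) (λ e′ → D * (sR e e′ * sR e e′))))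
                   (over-- F (λ e → over F (λ e′ → a * mR e e′)) (λ e → over F (λ e′ → D * (sR e e′ * sR e e′))))))) ⟩
          q * over² (λ e e′ → a * mR e e′ - D * (sR e e′ * sR e e′))
            ≤⟨ upper ⟩
          P * (sz * sz * Z)
            ≡⟨ ar₂ P (sz * sz) Z ⟩
          sz * sz * (P * Z) ∎
          where
          open ℤ.≤-Reasoning
          opaque
            unfolding _*_
            ar₁ : ∀ s q a R m d → s * s * (q * (a * (s * s - pos 4 * R - m) - d * (s * s))) ≡
                  q * (a * (s * (s * (s * s)) - pos 4 * (s * s * R) - s * s * m) + - (s * (s * (d * (s * s)))))
            ar₁ = solve-∀ ring
            ar₂ : ∀ x y z → x * (y * z) ≡ y * (x * z)
            ar₂ = solve-∀ ring
          sR-sum : over² (λ e e′ → D * (sR e e′ * sR e e′)) ≤ sz * (sz * (D * (sz * sz)))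
          sR-sum = ℤ.≤-trans (over²-mono (λ e e′ _ _ → *-monoˡ (<⇒0≤ 0<D) (sR≤ e e′)))
            (ℤ.≤-reflexive (trans (over-cong F (λ _ → over-const F (D * (sz * sz)))) (over-const F (sz * (D * (sz * sz))))))

        0≤bad : 0ℤ ≤ bad F
        0≤bad = 0≤pairs F F-inj (λ e b → not (one b e))

        0≤m : 0ℤ ≤ m
        0≤m = 0≤pairs F F-inj (λ b e → not (meet b e))

      local-bound : q * (a * (sz * sz - pos 4 * bad F - m) - D * (sz * sz)) ≤ P * Z
      local-bound with sz ℤ.≟ 0ℤ
      ... | no sz≢0 = *-cancelˡ (0<prod 0<sz 0<sz) scaled
        where
        0<sz : 0ℤ < sz
        0<sz = ℤ.≤∧≢⇒< (0≤size F) (λ p → sz≢0 (sym p))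
      -- Nothing can be cancelled for an empty family, but there the left side is at most 0.
      ... | yes sz≡0 = ℤ.≤-trans (≤-by (0≤prod (<⇒0≤ 0<q) (0≤prod (<⇒0≤ 0<a) (0≤sum (0≤prod 0≤pos 0≤bad) 0≤m)))
          (trans (cong (λ s → 0ℤ - q * (a * (s * s - pos 4 * bad F - m) - D * (s * s))) sz≡0) (ar q a (bad F) m D)))
          (0≤prod (<⇒0≤ 0<P) 0≤Z)
        where
        opaque
          unfolding _*_
          ar : ∀ q a R m d → 0ℤ - q * (a * (0ℤ * 0ℤ - pos 4 * R - m) - d * (0ℤ * 0ℤ)) ≡ q * (a * (pos 4 * R + m))
          ar = solve-∀ ring

      -- `local-bound` plus four times `pair-count-bound`. The factor four cancels the pairs meeting
      -- in more than a point: through `bad` they are charged with 4 q a, and each copy of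
      -- `pair-count-bound` pays q a.
      part-bound : (q + pos 4) * (a * (sz * sz)) ≤
        (pos 5 * q + pos 4) * (a * m) + (q + pos 4) * (D * (sz * sz)) + (pos 5 * a + pos 3 * ((q - 1ℤ) * D)) * (P * sz) + P * (q * X + q * D * Y)
      part-bound = ≤-by (0≤sum (0≤prod 0≤pos (0≤diff (pair-count-bound F F-inj))) (0≤diff local-bound))
        (trans (ar q A D P sz m (pairs F two) X Y) (cong₂ (λ mt B → pos 4 * (a * P * sz + D * (sz * sz) - a * (mt + q * pairs F two)) +
            (P * Z - q * (a * (sz * sz - pos 4 * B - m) - D * (sz * sz))))
          (sym mt≡) (sym (bad-split F))))
        where
        opaque
          unfolding _*_
          flip : ∀ x y → y ≡ x - (x - y)
          flip = solve-∀ ring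
          ar : ∀ q A D P s m t X Y →
            (pos 5 * q + pos 4) * ((q - 1ℤ) * A * m) + (q + pos 4) * (D * (s * s)) + (pos 5 * ((q - 1ℤ) * A) + pos 3 * ((q - 1ℤ) * D)) * (P * s)
              + P * (q * X + q * D * Y) - (q + pos 4) * ((q - 1ℤ) * A * (s * s)) ≡
            pos 4 * ((q - 1ℤ) * A * P * s + D * (s * s) - (q - 1ℤ) * A * ((s * s - m) + q * t)) +
            (P * ((q - 1ℤ) * (A + pos 3 * D) * s + q * X + q * D * Y) - q * ((q - 1ℤ) * A * (s * s - pos 4 * (m + t) - m) - D * (s * s)))
          ar = solve-∀ ring
        mt≡ : pairs F meet ≡ sz * sz - m
        mt≡ = trans (flip (sz * sz) (pairs F meet)) (cong (λ z → sz * sz - z) (sym (pairs-not-meet F)))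

  -- The greedy partition

  argmin : ∀ {A : Set} {{_ : Enum A}} (R : A → Bool) (f : A → ℤ) →
           (∃ λ a → R a ≡ true × (∀ b → R b ≡ true → f a ≤ f b)) ⊎ (∀ a → R a ≡ false)
  argmin {A} {{E}} R f with go (Enum.elems E)
    where
    go : ∀ xs → (∃ λ a → R a ≡ true × (∀ b → b ∈ xs → R b ≡ true → f a ≤ f b)) ⊎ (∀ a → a ∈ xs → R a ≡ false)
    go [] = inj₂ λ _ ()
    go (x ∷ xs) with bool-cases (R x) | go xs
    ... | inj₂ n | inj₂ h = inj₂ λ { a (here refl) → n ; a (there i) → h a i }
    ... | inj₂ n | inj₁ (a , Ra , h) = inj₁ (a , Ra , λ { b (here refl) Rb → true≢false Rb n ; b (there i) Rb → h b i Rb })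
    ... | inj₁ y | inj₂ h = inj₁ (x , y , λ { b (here refl) Rb → ℤ.≤-refl ; b (there i) Rb → true≢false Rb (h b i) })
    ... | inj₁ y | inj₁ (a , Ra , h) with ℤ.≤-total (f x) (f a)
    ...   | inj₁ le = inj₁ (x , y , λ { b (here refl) Rb → ℤ.≤-refl ; b (there i) Rb → ℤ.≤-trans le (h b i Rb) })
    ...   | inj₂ le = inj₁ (a , Ra , λ { b (here refl) Rb → le ; b (there i) Rb → h b i Rb })
  ... | inj₁ (a , Ra , h) = inj₁ (a , Ra , λ b → h b (∈-elems b))
  ... | inj₂ h = inj₂ (λ a → h a (∈-elems a))

  opaque
    unfolding _*_
    cs-identity : ∀ j S y z → j * ((1ℤ + j) * (S + z * z) - (y + z) * (y + z)) ≡
                  (1ℤ + j) * (j * S - y * y) + (y - j * z) * (y - j * z)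
    cs-identity = solve-∀ ring

  square-zero : ∀ {y} → y * y ≤ 0ℤ → y ≡ 0ℤ
  square-zero {y} p with y ℤ.≟ 0ℤ
  ... | yes q = q
  ... | no q = ⊥-elim (ℤ.<⇒≱ (pos-square y q) p)
    where
    opaque
      unfolding _*_
      neg-sq : ∀ y → (- y) * (- y) ≡ y * y
      neg-sq = solve-∀ ring
    pos-square : ∀ y → ¬ y ≡ 0ℤ → 0ℤ < y * y
    pos-square y q with ℤ.≤-total 0ℤ y
    ... | inj₁ le = 0<prod (ℤ.≤∧≢⇒< le (λ r → q (sym r))) (ℤ.≤∧≢⇒< le (λ r → q (sym r)))
    ... | inj₂ le = subst (0ℤ <_) (neg-sq y) (0<prod neg neg)
      where
      neg : 0ℤ < - y
      neg = ℤ.≤∧≢⇒< (ℤ.neg-mono-≤ le) (λ r → q (trans (sym (ℤ.neg-involutive y)) (cong -_ (sym r))))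

  -- The step of (n₁ + ... + nⱼ)² ≤ j (n₁² + ... + nⱼ²) by induction on the number of parts.
  -- `cs-identity` carries a factor `j`, so j = 0 is treated apart; there `y` vanishes.
  cauchy-step : ∀ j S y z → 0ℤ ≤ S → y * y ≤ pos j * S → (y + z) * (y + z) ≤ pos (suc j) * (S + z * z)
  cauchy-step zero S y z 0≤S p = subst₂ (λ t u → (t + z) * (t + z) ≤ u) (sym y≡0) (sym (*-identityˡ (S + z * z)))
      (subst₂ _≤_ (sym (cong₂ _*_ (ℤ.+-identityˡ z) (ℤ.+-identityˡ z))) refl
        (subst (_≤ S + z * z) (ℤ.+-identityˡ (z * z)) (ℤ.+-monoˡ-≤ (z * z) 0≤S)))
    where
    y≡0 : y ≡ 0ℤ
    y≡0 = square-zero (subst (y * y ≤_) (zeroˡ S) p)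
  cauchy-step (suc i) S y z 0≤S p = ℤ.0≤i-j⇒j≤i (*-cancelˡ 0<j (subst₂ _≤_ (sym (zeroʳ j)) (sym (cs-identity j S y z))
      (0≤sum (0≤prod {1ℤ + j} 0≤pos (0≤diff p)) (0≤square (y - j * z)))))
    where
    j : ℤ
    j = pos (suc i)
    0<j : 0ℤ < j
    0<j = +<+ (s≤s z≤n)

  module Greedy (𝔽 : FiniteField) (V : Linear.VSpace 𝔽) (k′ : ℕ) where
    open Linear 𝔽
    open VS V
    open Moments 𝔽 V k′
    open Energy 𝔽 V k′
    open Pairs 𝔽 V k′
    open Triples 𝔽 V k′
    open Stability 𝔽 V k′

    DisjointT : M → M → Set
    DisjointT b e = meet b e ≡ false

    -- The EM property for tuples. Pairwise disjoint entries are automatically distinct, because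
    -- every tuple meets itself by `meet-refl`.
    MatchingBound : ℕ → (M → Bool) → Set
    MatchingBound t Y = ∀ xs → All (λ b → Y b ≡ true) xs → AllPairs DisjointT xs → length xs ℕ.≤ t

    _⊆_ : (M → Bool) → (M → Bool) → Set
    F ⊆ Y = ∀ b → F b ≡ true → Y b ≡ true

    Far Near : (M → Bool) → M → M → Bool
    Near Y y b = Y b ∧ meet y b
    Far Y y b = Y b ∧ not (meet y b)

    over-split : ∀ Y (R : M → Bool) w → over Y w ≡ over (λ b → Y b ∧ R b) w + over (λ b → Y b ∧ not (R b)) w
    over-split Y R w = trans (sum-cong (λ b → pt (Y b) (R b) (w b))) (sum-+ (λ b → χ (Y b ∧ R b) * w b) (λ b → χ (Y b ∧ not (R b)) * w b))
      where
      opaque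
        unfolding _*_
        p₁ : ∀ w → 1ℤ * w ≡ 1ℤ * w + 0ℤ * w
        p₁ = solve-∀ ring
        p₂ : ∀ w → 1ℤ * w ≡ 0ℤ * w + 1ℤ * w
        p₂ = solve-∀ ring
        p₃ : ∀ w → 0ℤ * w ≡ 0ℤ * w + 0ℤ * w
        p₃ = solve-∀ ring
      pt : ∀ y r w → χ y * w ≡ χ (y ∧ r) * w + χ (y ∧ not r) * w
      pt true  true  w = p₁ w
      pt true  false w = p₂ w
      pt false r     w = p₃ w

    over-1 : ∀ F → over F (λ _ → 1ℤ) ≡ size F
    over-1 F = trans (over-const F 1ℤ) (*-identityʳ (size F))

    far-bound : ∀ {t Y y} → Y y ≡ true → MatchingBound (suc t) Y → MatchingBound t (Far Y y)
    far-bound {t} {Y} {y} Yy em xs all ap with em (y ∷ xs) (Yy ∷ All.map (λ p → ∧-elimˡ p) all)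
        (All.map (λ {b} p → not-elim (∧-elimʳ {Y b} p)) all ∷ ap)
    ... | s≤s le = le

    empty-size : ∀ Y → (∀ b → Y b ≡ false) → size Y ≡ 0ℤ
    empty-size Y h = sum-zero (λ b → cong χ (h b))

    -- By minimality every near member meets at least as many members of `Y` as there are near ones,
    -- so near-near and near-far meetings together make up the square of the near size. Counted
    -- again from the far side, the near-far meetings add at least the number of disjoint pairs
    -- among the near members.
    greedy-step : ∀ Y y → Injective Y → Y y ≡ true →
      (∀ b → Y b ≡ true → over Y (λ e → χ (meet y e)) ≤ over Y (λ e → χ (meet b e))) →
      size (Near Y y) * size (Near Y y) + pairs (Near Y y) (λ b e → not (meet b e)) + pairs (Far Y y) meet ≤ pairs Y meet
    greedy-step Y y Y-inj Yy least = subst₂ _≤_ (lhs (size N) (pairs N meet) (pairs Fr meet) (pairs N (λ b e → not (meet b e))) (pairs-not-meet N)) (sym total)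
        (≤-by (0≤sum (0≤sum (0≤diff row) (0≤diff row)) (0≤diff cross-sym))
          (ar (size N * size N) (pairs N meet) cross cross′ (pairs Fr meet)))
      where
      open ℤ.≤-Reasoning
      N Fr : M → Bool
      N = Near Y y
      Fr = Far Y y
      cross cross′ : ℤ
      cross = over N (λ b → over Fr (λ e → χ (meet b e)))
      cross′ = over Fr (λ b → over N (λ e → χ (meet b e)))
      opaque
        unfolding _*_
        ar : ∀ s n c c′ f → (n + c + (c′ + f)) - (s + (s - n) + f) ≡ (n + c - s) + (n + c - s) + (c′ - c)
        ar = solve-∀ ring
      lhs : ∀ s n f m → m ≡ s * s - n → s * s + (s * s - n) + f ≡ s * s + m + f
      lhs s n f m refl = refl
      split : ∀ b → over Y (λ e → χ (meet b e)) ≡ over N (λ e → χ (meet b e)) + over Fr (λ e → χ (meet b e))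
      split b = over-split Y (meet y) (λ e → χ (meet b e))
      total : pairs Y meet ≡ pairs N meet + cross + (cross′ + pairs Fr meet)
      total = trans (over-split Y (meet y) (λ b → over Y (λ e → χ (meet b e)))) (cong₂ _+_
        (trans (over-cong N split) (over-+ N (λ b → over N (λ e → χ (meet b e))) (λ b → over Fr (λ e → χ (meet b e)))))
        (trans (over-cong Fr split) (over-+ Fr (λ b → over N (λ e → χ (meet b e))) (λ b → over Fr (λ e → χ (meet b e))))))
      degree-y : over Y (λ e → χ (meet y e)) ≡ size N
      degree-y = sum-cong (λ e → sym (χ-∧ (Y e) (meet y e)))
      row : size N * size N ≤ pairs N meet + cross
      row = begin
        size N * size N
          ≡⟨ sym (over-const N (size N)) ⟩
        over N (λ _ → size N)
          ≤⟨ over-mono N (λ b p → subst (_≤ over Y (λ e → χ (meet b e))) degree-y (least b (∧-elimˡ p))) ⟩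
        over N (λ b → over Y (λ e → χ (meet b e)))
          ≡⟨ trans (over-cong N split) (over-+ N (λ b → over N (λ e → χ (meet b e))) (λ b → over Fr (λ e → χ (meet b e)))) ⟩
        pairs N meet + cross ∎
      cross-sym : cross ≤ cross′
      cross-sym = begin
        cross
          ≡⟨ over-swap N Fr (λ b e → χ (meet b e)) ⟩
        over Fr (λ e → over N (λ b → χ (meet b e)))
          ≤⟨ over-mono Fr (λ e _ → over-mono N (λ b p → χ-mono (meet-sym b e (Y-inj b (∧-elimˡ p))))) ⟩
        cross′ ∎

    -- Füredi's argument: remove a member meeting as few members as possible together with all
    -- the members it meets; the removed members are pairwise disjoint, so there are at most t parts.
    module _ (e₁ c₁ c₂ c₃ c₄ : ℤ) (0≤c₄ : 0ℤ ≤ c₄) where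

      -- Only two totals over the parts are kept: `S₂`, the sum of the squared sizes, and `m₂`, the
      -- number of ordered disjoint pairs inside parts. `weighted` is the inequality for the parts,
      -- summed.
      record Partition (t : ℕ) (Y : M → Bool) : Set where
        field
          S₂ m₂    : ℤ
          0≤S₂     : 0ℤ ≤ S₂
          meets    : S₂ + m₂ ≤ pairs Y meet
          cauchy   : size Y * size Y ≤ pos t * S₂
          S₂≤      : S₂ ≤ size Y * size Y
          weighted : e₁ * S₂ ≤ c₁ * m₂ + c₂ * S₂ + c₃ * size Y + pos t * c₄

      greedy-partition : ∀ t Y → Injective Y → MatchingBound t Y →
        (∀ F → F ⊆ Y → e₁ * (size F * size F) ≤ c₁ * pairs F (λ b e → not (meet b e)) + c₂ * (size F * size F) + c₃ * size F + c₄) →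
        Partition t Y
      greedy-partition t Y Y-inj em part with argmin Y (λ b → over Y (λ e → χ (meet b e)))
      greedy-partition t Y Y-inj em part | inj₂ none = record
        { S₂ = 0ℤ ; m₂ = 0ℤ ; 0≤S₂ = ℤ.≤-refl ; meets = 0≤pairs Y Y-inj meet
        ; cauchy = ℤ.≤-reflexive (trans size² (sym (zeroʳ (pos t))))
        ; S₂≤ = ℤ.≤-reflexive (sym size²)
        ; weighted = ≤-by (0≤prod {pos t} 0≤pos 0≤c₄) (trans (cong (λ s → c₁ * 0ℤ + c₂ * 0ℤ + c₃ * s + pos t * c₄ - e₁ * 0ℤ) (empty-size Y none)) (ar e₁ c₁ c₂ c₃ (pos t * c₄))) }
        where
        size² : size Y * size Y ≡ 0ℤ
        size² = trans (cong (λ s → s * s) (empty-size Y none)) (zeroˡ 0ℤ)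
        opaque
          unfolding _*_
          ar : ∀ e x y z w → x * 0ℤ + y * 0ℤ + z * 0ℤ + w - e * 0ℤ ≡ w
          ar = solve-∀ ring
      greedy-partition zero Y Y-inj em part | inj₁ (y , Yy , _) with em (y ∷ []) (Yy ∷ []) ([] ∷ [])
      ... | ()
      greedy-partition (suc t) Y Y-inj em part | inj₁ (y , Yy , least) = record
        { S₂ = R.S₂ + n * n ; m₂ = R.m₂ + m
        ; 0≤S₂ = 0≤sum R.0≤S₂ (0≤square n)
        ; meets = ℤ.≤-trans (subst (_≤ n * n + m + pairs (Far Y y) meet) (ar₁ n m R.S₂ R.m₂) (ℤ.+-monoʳ-≤ (n * n + m) R.meets))
                    (greedy-step Y y Y-inj Yy least)
        ; cauchy = subst (λ s → s * s ≤ pos (suc t) * (R.S₂ + n * n)) (sym size-split) (cauchy-step t R.S₂ (size (Far Y y)) n R.0≤S₂ R.cauchy)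
        ; S₂≤ = subst (λ s → R.S₂ + n * n ≤ s * s) (sym size-split) (≤-by
            (0≤sum (0≤diff R.S₂≤) (0≤prod 0≤pos (0≤prod (0≤size (Far Y y)) (0≤size (Near Y y))))) (ar₂ (size (Far Y y)) n R.S₂))
        ; weighted = subst₂ _≤_ (ar₃ e₁ R.S₂ (n * n)) (trans (ar₄ c₁ c₂ c₃ c₄ R.m₂ m R.S₂ (n * n) (size (Far Y y)) n (pos t))
            (cong₂ (λ s u → c₁ * (R.m₂ + m) + c₂ * (R.S₂ + n * n) + c₃ * s + u * c₄) (sym size-split) refl))
            (ℤ.+-mono-≤ R.weighted (part (Near Y y) (λ b p → ∧-elimˡ p))) }
        where
        module R = Partition (greedy-partition t (Far Y y) (λ b p → Y-inj b (∧-elimˡ p)) (far-bound Yy em)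
                                (λ F F⊆ → part F (λ b p → ∧-elimˡ (F⊆ b p))))
        n m : ℤ
        n = size (Near Y y)
        m = pairs (Near Y y) (λ b e → not (meet b e))
        size-split : size Y ≡ size (Far Y y) + n
        size-split = trans (sym (over-1 Y)) (trans (over-split Y (meet y) (λ _ → 1ℤ))
          (trans (cong₂ _+_ (over-1 (Near Y y)) (over-1 (Far Y y))) (ℤ.+-comm n (size (Far Y y)))))
        opaque
          unfolding _*_
          ar₁ : ∀ n m s r → n * n + m + (s + r) ≡ s + n * n + (r + m)
          ar₁ = solve-∀ ring
          ar₂ : ∀ f n s → (f + n) * (f + n) - (s + n * n) ≡ (f * f - s) + pos 2 * (f * n)
          ar₂ = solve-∀ ring
          ar₃ : ∀ e s n → e * s + e * n ≡ e * (s + n)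
          ar₃ = solve-∀ ring
          ar₄ : ∀ c₁ c₂ c₃ c₄ r m s n f z t → (c₁ * r + c₂ * s + c₃ * f + t * c₄) + (c₁ * m + c₂ * n + c₃ * z + c₄) ≡
                c₁ * (r + m) + c₂ * (s + n) + c₃ * (f + z) + (1ℤ + t) * c₄
          ar₄ = solve-∀ ring

    -- Beyond these thresholds a centre holds more members than `t` members away from it can meet;
    -- they are matched to `few-through` and `few-lying`.
    Light : ℤ → (M → Bool) → Set
    Light t Y = (∀ v → ¬ v ≡ 𝟎 → a * deg Y v ≤ t * D * P) ×
                (∀ b e → Y b ≡ true → Y e ≡ true → one b e ≡ true → (q - 1ℤ) * over Y (λ e′ → χ (shareᴷ b e e′)) ≤ t * P)

    over-⊆ : ∀ {F Y} → F ⊆ Y → ∀ w → (∀ b → 0ℤ ≤ w b) → over F w ≤ over Y w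
    over-⊆ F⊆Y w 0≤w = sum-mono (λ b → *-monoʳ (0≤w b) (χ-mono (F⊆Y b)))

    -- The disjoint pairs `m₂` are eliminated: `weighted` charges them with (5q + 4) a, and the
    -- multiple 5q + 4 of `meet-bound` pays for them. This raises q + 4 to 6q + 8 on the left and 5
    -- to 5q + 9 on the right. Finally `cauchy` trades t `S₂` for the square of the size of `Y`.
    light-bound : ∀ t Y → Injective Y → MatchingBound t Y → Light (pos t) Y →
      (pos 6 * q + pos 8) * (a * (size Y * size Y)) ≤
      pos t * ((pos 6 * q + pos 8) * (D * (size Y * size Y)) + ((pos 5 * q + pos 9) * a + pos 3 * ((q - 1ℤ) * D)) * (P * size Y)
        + pos t * (pos 2 * q * (pos t * D * (P * P))))
    light-bound t Y Y-inj em (light₁ , light₂) = ℤ.≤-trans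
        (subst (_≤ (pos 6 * q + pos 8) * a * (pos t * S₂)) (*-assoc (pos 6 * q + pos 8) a (size Y * size Y))
          (*-monoˡ (0≤prod 0≤lead (<⇒0≤ 0<a)) cauchy))
        (subst (_≤ pos t * RHS) (ar₀ (pos 6 * q + pos 8) a (pos t) S₂) (*-monoˡ {pos t} 0≤pos core))
      where
      X₀ Y₀ : ℤ
      X₀ = pos t * D * P
      Y₀ = pos t * P
      0≤X₀ : 0ℤ ≤ X₀
      0≤X₀ = 0≤prod (0≤prod {pos t} 0≤pos (<⇒0≤ 0<D)) (<⇒0≤ 0<P)
      0≤Y₀ : 0ℤ ≤ Y₀
      0≤Y₀ = 0≤prod {pos t} 0≤pos (<⇒0≤ 0<P)
      0≤lead : 0ℤ ≤ pos 6 * q + pos 8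
      0≤lead = 0≤sum (0≤prod {pos 6} 0≤pos (<⇒0≤ 0<q)) 0≤pos
      opaque
        unfolding _*_
        ar₀ : ∀ l a t s → t * (l * (a * s)) ≡ l * a * (t * s)
        ar₀ = solve-∀ ring
        assoc₄ : ∀ P q a m d s p n x → (pos 5 * q + pos 4) * (a * m) + (q + pos 4) * (d * s) + p * (P * n) + x ≡
                 (pos 5 * q + pos 4) * a * m + (q + pos 4) * d * s + p * P * n + x
        assoc₄ = solve-∀ ring
      part : ∀ F → F ⊆ Y → (q + pos 4) * a * (size F * size F) ≤
        (pos 5 * q + pos 4) * a * pairs F (λ b e → not (meet b e)) + (q + pos 4) * D * (size F * size F) +
        (pos 5 * a + pos 3 * ((q - 1ℤ) * D)) * P * size F + P * (q * X₀ + q * D * Y₀)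
      part F F⊆Y = subst₂ _≤_ (sym (*-assoc (q + pos 4) a (size F * size F)))
        (assoc₄ P q a (pairs F (λ b e → not (meet b e))) D (size F * size F) (pos 5 * a + pos 3 * ((q - 1ℤ) * D)) (size F) (P * (q * X₀ + q * D * Y₀)))
        (part-bound F (λ b p → Y-inj b (F⊆Y b p)) X₀ Y₀ 0≤X₀ 0≤Y₀
          (λ v v≢0 → ℤ.≤-trans (*-monoˡ (<⇒0≤ 0<a) (over-⊆ F⊆Y (λ b → ∑[ u ] χ (U.nz u) * χ (b ⟨ u ⟩ == v))
            (λ b → sum-nonneg (λ u → 0≤prod (0≤χ (U.nz u)) (0≤χ (b ⟨ u ⟩ == v)))))) (light₁ v v≢0))
          (λ b e Fb Fe p → ℤ.≤-trans (*-monoˡ 0≤q-1 (over-⊆ F⊆Y (λ e′ → χ (shareᴷ b e e′)) (λ e′ → 0≤χ (shareᴷ b e e′))))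
            (light₂ b e (F⊆Y b Fb) (F⊆Y e Fe) p)))
      0≤c₄ : 0ℤ ≤ P * (q * X₀ + q * D * Y₀)
      0≤c₄ = 0≤prod (<⇒0≤ 0<P) (0≤sum (0≤prod (<⇒0≤ 0<q) 0≤X₀) (0≤prod (0≤prod (<⇒0≤ 0<q) (<⇒0≤ 0<D)) 0≤Y₀))
      open Partition (greedy-partition ((q + pos 4) * a) ((pos 5 * q + pos 4) * a) ((q + pos 4) * D)
        ((pos 5 * a + pos 3 * ((q - 1ℤ) * D)) * P) (P * (q * X₀ + q * D * Y₀)) 0≤c₄ t Y Y-inj em part)
      RHS : ℤ
      RHS = (pos 6 * q + pos 8) * (D * (size Y * size Y)) + ((pos 5 * q + pos 9) * a + pos 3 * ((q - 1ℤ) * D)) * (P * size Y)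
        + pos t * (pos 2 * q * (pos t * D * (P * P)))
      meet-bound : a * (S₂ + m₂) ≤ a * P * size Y + D * (size Y * size Y)
      meet-bound = ℤ.≤-trans (*-monoˡ (<⇒0≤ 0<a) (ℤ.≤-trans meets (subst (_≤ pairs Y meet + q * pairs Y two) (ℤ.+-identityʳ (pairs Y meet))
        (ℤ.+-monoʳ-≤ (pairs Y meet) (0≤prod (<⇒0≤ 0<q) (0≤pairs Y Y-inj two)))))) (pair-count-bound Y Y-inj)
      opaque
        unfolding _*_
        ar : ∀ q a D P t s m y w →
          ((pos 6 * q + pos 8) * (D * (y * y)) + ((pos 5 * q + pos 9) * a + pos 3 * w) * (P * y) + t * (pos 2 * q * (t * D * (P * P)))) -
          (pos 6 * q + pos 8) * (a * s) ≡
          (((pos 5 * q + pos 4) * a * m + (q + pos 4) * D * s + (pos 5 * a + pos 3 * w) * P * y + t * (P * (q * (t * D * P) + q * D * (t * P)))) - (q + pos 4) * a * s)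
          + (pos 5 * q + pos 4) * (a * P * y + D * (y * y) - a * (s + m)) + (q + pos 4) * (D * (y * y - s))
        ar = solve-∀ ring
      core : (pos 6 * q + pos 8) * (a * S₂) ≤ RHS
      core = ≤-by (0≤sum (0≤sum (0≤diff weighted) (0≤prod (0≤sum (0≤prod {pos 5} 0≤pos (<⇒0≤ 0<q)) 0≤pos) (0≤diff meet-bound)))
          (0≤prod (0≤sum {q} {pos 4} (<⇒0≤ 0<q) 0≤pos) (0≤prod (<⇒0≤ 0<D) (0≤diff S₂≤))))
        (ar q a D P (pos t) S₂ m₂ (size Y) ((q - 1ℤ) * D))

  -- Members through a point or inside a span

  module Incidence (𝔽 : FiniteField) (V : Linear.VSpace 𝔽) (k′ : ℕ) where
    open Linear 𝔽
    open VS V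
    open Moments 𝔽 V k′
    open Energy 𝔽 V k′
    open Pairs 𝔽 V k′

    Inj⇒≡ : ∀ b → Inj b → ∀ u u′ → b ⟨ u ⟩ ≡ b ⟨ u′ ⟩ → u ≡ u′
    Inj⇒≡ b h u u′ eq = trans (sym (U.⊖⊕ u u′)) (trans (cong (U._⊕ u′) (h (u U.⊕ U.⊖ u′)
      (trans (app-⊕ʳ V b u (U.⊖ u′)) (trans (cong₂ _⊕_ eq (app-⊖ʳ V b u′)) (⊕-inverseʳ _))))) (U.⊕-identityˡ u′))

    joint : Carrier → Carrier → U → U → M → ℤ
    joint v v′ u u′ b = χ (not (U.mult u u′)) * (χ (b ⟨ u ⟩ == v) * χ (b ⟨ u′ ⟩ == v′))

    0≤joint : ∀ v v′ u u′ b → 0ℤ ≤ joint v v′ u u′ b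
    0≤joint v v′ u u′ b = 0≤prod (0≤χ (not (U.mult u u′))) (0≤prod (0≤χ (b ⟨ u ⟩ == v)) (0≤χ (b ⟨ u′ ⟩ == v′)))

    -- For injective `b` and independent `v`, `v′` this is the indicator that both lie in the image
    -- of `b`. With `v′` zero it detects noninjective tuples, in `pencil-point`.
    both : Carrier → Carrier → M → ℤ
    both v v′ b = over U.nz (λ u → ∑[ u′ ] joint v v′ u u′ b)

    0≤both : ∀ v v′ b → 0ℤ ≤ both v v′ b
    0≤both v v′ b = over-nonneg U.nz (λ u → sum-nonneg (λ u′ → 0≤joint v v′ u u′ b))

    joints≤both : ∀ v v′ u b → ¬ u ≡ U.𝟎 → (∑[ u′ ] joint v v′ u u′ b) ≤ both v v′ b
    joints≤both v v′ u b u≢0 = subst (_≤ both v v′ b) (trans (cong (λ s → χ s * (∑[ u′ ] joint v v′ u u′ b)) (U.nz-intro {u} u≢0)) (*-identityˡ _))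
      (single≤ (λ u → χ (U.nz u) * (∑[ u′ ] joint v v′ u u′ b)) (λ u → 0≤prod (0≤χ (U.nz u)) (sum-nonneg (λ u′ → 0≤joint v v′ u u′ b))) u)

    joint≤both : ∀ v v′ u u′ b → ¬ u ≡ U.𝟎 → joint v v′ u u′ b ≤ both v v′ b
    joint≤both v v′ u u′ b u≢0 = ℤ.≤-trans (single≤ (λ u′ → joint v v′ u u′ b) (λ u′ → 0≤joint v v′ u u′ b) u′) (joints≤both v v′ u b u≢0)

    joint-one : ∀ v v′ u u′ b → U.mult u u′ ≡ false → b ⟨ u ⟩ ≡ v → b ⟨ u′ ⟩ ≡ v′ → joint v v′ u u′ b ≡ 1ℤ
    joint-one v v′ u u′ b p r r′ = trans (cong₂ (λ x y → χ (not x) * y) p (trans (cong₂ (λ x y → χ x * χ y) (≡⇒== r) (≡⇒== r′)) (*-identityˡ 1ℤ))) (*-identityˡ 1ℤ)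

    -- There are at most N₁ C independent pairs of vectors, and by `eval-two` each of them takes the
    -- values `v`, `v′` for A′ / A tuples.
    sum-both : ∀ v v′ → A * (∑[ b ] both v v′ b) ≤ C * P
    sum-both v v′ = *-cancelˡ 0<A (begin
      A * (A * (∑[ b ] both v v′ b))
        ≡⟨ sym (*-assoc A A (∑[ b ] both v v′ b)) ⟩
      A * A * (∑[ b ] both v v′ b)
        ≡⟨ cong (A * A *_) (trans (sym (over-sum U.nz (λ u b → ∑[ u′ ] joint v v′ u u′ b))) (over-cong U.nz (λ u → sum-swap (λ b u′ → joint v v′ u u′ b)))) ⟩
      A * A * over U.nz (λ u → ∑[ u′ ] ∑[ b ] joint v v′ u u′ b)
        ≡⟨ trans (sym (over-*ˡ U.nz (A * A) (λ u → ∑[ u′ ] ∑[ b ] joint v v′ u u′ b))) (over-cong U.nz (λ u → sym (sum-*ˡ (A * A) (λ u′ → ∑[ b ] joint v v′ u u′ b)))) ⟩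
      over U.nz (λ u → ∑[ u′ ] A * A * (∑[ b ] joint v v′ u u′ b))
        ≤⟨ over-mono U.nz (λ u p → sum-mono (λ u′ → t-sum u u′ (U.nz-elim {u} p))) ⟩
      over U.nz (λ u → ∑[ u′ ] A * A′)
        ≡⟨ trans (over-const U.nz (∑[ u′ ] A * A′)) (trans (cong (N₁ *_) (sum-const {U} (A * A′))) (ar N₁ C A A′)) ⟩
      A * (C * P) ∎)
      where
      open ℤ.≤-Reasoning
      opaque
        unfolding _*_
        ar : ∀ n c a b → n * (c * (a * b)) ≡ a * (c * (n * b))
        ar = solve-∀ ring
      t-sum : ∀ u u′ → ¬ u ≡ U.𝟎 → A * A * (∑[ b ] joint v v′ u u′ b) ≤ A * A′
      t-sum u u′ u≢0 with bool-cases (U.mult u u′)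
      ... | inj₁ p = subst (_≤ A * A′) (sym (trans (cong (A * A *_) (sum-zero (λ b → trans (cong (λ s → χ (not s) * (χ (b ⟨ u ⟩ == v) * χ (b ⟨ u′ ⟩ == v′))) p) (zeroˡ _)))) (zeroʳ (A * A))))
                       (0≤prod (<⇒0≤ 0<A) (<⇒0≤ 0<A′))
      ... | inj₂ p = ℤ.≤-reflexive (trans (cong (A * A *_) (sum-cong (λ b → trans (cong (λ s → χ (not s) * (χ (b ⟨ u ⟩ == v) * χ (b ⟨ u′ ⟩ == v′))) p) (*-identityˡ _))))
                       (trans (eval-two u≢0 p (λ z → χ (z == v)) (λ z → χ (z == v′)))
                         (trans (cong (card M *_) (trans (cong₂ _*_ (sum-once v) (sum-once v′)) (*-identityˡ 1ℤ))) (trans (*-identityʳ (card M)) cardM))))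

    single : Carrier → M → ℤ
    single v b = ∑[ u ] χ (U.nz u) * χ (b ⟨ u ⟩ == v)

    -- The origin of `P`: each of the N₁ nonzero vectors is sent to `v` by A′ tuples.
    sum-single : ∀ v → (∑[ b ] single v b) ≡ P
    sum-single v = *-cancelˡ-≡ 0<A (begin
      A * (∑[ b ] ∑[ u ] χ (U.nz u) * χ (b ⟨ u ⟩ == v))
        ≡⟨ trans (cong (A *_) (trans (sum-swap (λ b u → χ (U.nz u) * χ (b ⟨ u ⟩ == v))) (sum-cong (λ u → sum-*ˡ (χ (U.nz u)) (λ b → χ (b ⟨ u ⟩ == v))))))
             (sym (over-*ˡ U.nz A (λ u → ∑[ b ] χ (b ⟨ u ⟩ == v)))) ⟩
      over U.nz (λ u → A * (∑[ b ] χ (b ⟨ u ⟩ == v)))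
        ≡⟨ sum-cong (λ u → guard u (bool-cases (U.nz u))) ⟩
      over U.nz (λ _ → A * A′)
        ≡⟨ trans (over-const U.nz (A * A′)) (ar N₁ A A′) ⟩
      A * P ∎)
      where
      open ≡-Reasoning
      opaque
        unfolding _*_
        ar : ∀ n a b → n * (a * b) ≡ a * (n * b)
        ar = solve-∀ ring
      guard : ∀ u → U.nz u ≡ true ⊎ U.nz u ≡ false → χ (U.nz u) * (A * (∑[ b ] χ (b ⟨ u ⟩ == v))) ≡ χ (U.nz u) * (A * A′)
      guard u (inj₁ p) = cong (χ (U.nz u) *_) (trans (eval-one (U.nz-elim {u} p) (λ w → χ (w == v)))
        (trans (cong (card M *_) (sum-once v)) (trans (*-identityʳ (card M)) cardM)))
      guard u (inj₂ p) = trans (cong (λ s → χ s * (A * (∑[ b ] χ (b ⟨ u ⟩ == v)))) p) (trans (zeroˡ _) (sym (trans (cong (λ s → χ s * (A * A′)) p) (zeroˡ _))))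

    single≤∈im : ∀ v b → Inj b → single v b ≤ χ (v ∈im b)
    single≤∈im v b b-inj = subst (_≤ χ (v ∈im b)) (sum-cong (λ u → χ-∧ (U.nz u) (b ⟨ u ⟩ == v)))
      (at-most-one (λ u → U.nz u ∧ (b ⟨ u ⟩ == v)) (v ∈im b) (λ u p → ∈im-intro b u (==⇒≡ (∧-elimʳ {U.nz u} p)))
        (λ u u′ p p′ → Inj⇒≡ b b-inj u u′ (trans (==⇒≡ (∧-elimʳ {U.nz u} p)) (sym (==⇒≡ (∧-elimʳ {U.nz u′} p′))))))

    preimage≢0 : ∀ {v} b u → ¬ v ≡ 𝟎 → b ⟨ u ⟩ ≡ v → ¬ u ≡ U.𝟎
    preimage≢0 b u v≢0 r refl = v≢0 (trans (sym r) (app-0ʳ V b))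

    ∈im≤single : ∀ v b → ¬ v ≡ 𝟎 → χ (v ∈im b) ≤ single v b
    ∈im≤single v b v≢0 with bool-cases (v ∈im b)
    ... | inj₂ n = ℤ.≤-trans (ℤ.≤-reflexive (cong χ n)) (sum-nonneg (λ u → 0≤prod (0≤χ (U.nz u)) (0≤χ (b ⟨ u ⟩ == v))))
    ... | inj₁ p with ∈im-elim b p
    ...   | u , s = ℤ.≤-trans (χ≤1 (v ∈im b)) (ℤ.≤-trans
        (ℤ.≤-reflexive (sym (trans (cong₂ (λ y z → χ y * χ z) (U.nz-intro {u} (preimage≢0 b u v≢0 s)) (≡⇒== s)) (*-identityˡ 1ℤ))))
        (single≤ (λ u → χ (U.nz u) * χ (b ⟨ u ⟩ == v)) (λ u → 0≤prod (0≤χ (U.nz u)) (0≤χ (b ⟨ u ⟩ == v))) u))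

  module Peel (𝔽 : FiniteField) (V : Linear.VSpace 𝔽) (k′ : ℕ) where
    open Linear 𝔽
    open VS V
    open Moments 𝔽 V k′
    open Energy 𝔽 V k′
    open Pairs 𝔽 V k′
    open Triples 𝔽 V k′
    open Stability 𝔽 V k′
    open Greedy 𝔽 V k′
    open Incidence 𝔽 V k′

    _∖_ : (M → Bool) → (M → Bool) → M → Bool
    (Y ∖ Z) b = Y b ∧ not (Z b)

    _∩_ : (M → Bool) → (M → Bool) → M → Bool
    (Y ∩ Z) b = Y b ∧ Z b

    peel : ∀ t Y Z m B → Injective Y → MatchingBound (suc t) Y → 0ℤ ≤ m → 0ℤ ≤ B →
      (∀ x → Y x ≡ true → Z x ≡ false → m * over (Y ∩ Z) (λ e → χ (meet x e)) ≤ B) →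
      pos (suc t) * B < m * size (Y ∩ Z) → MatchingBound t (Y ∖ Z)
    peel t Y Z m B Y-inj em 0≤m 0≤B few many xs all ap = extend (find fresh)
      where
      in-Y : All (λ b → Y b ≡ true) xs
      in-Y = All.map (λ p → ∧-elimˡ p) all
      clear : List M → M → Bool
      clear []       e = true
      clear (x ∷ ys) e = not (meet x e) ∧ clear ys e
      fresh : M → Bool
      fresh e = (Y ∩ Z) e ∧ clear xs e
      total : List M → ℤ
      total []       = 0ℤ
      total (x ∷ ys) = over (Y ∩ Z) (λ e → χ (meet x e)) + total ys
      clear-bound : ∀ ys → over (Y ∩ Z) (λ e → χ (not (clear ys e))) ≤ total ys
      clear-bound [] = ℤ.≤-reflexive (trans (over-const (Y ∩ Z) 0ℤ) (zeroʳ (size (Y ∩ Z))))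
      clear-bound (x ∷ ys) = ℤ.≤-trans (over-mono (Y ∩ Z) (λ e _ → le (meet x e) (clear ys e)))
          (subst (_≤ total (x ∷ ys)) (sym (over-+ (Y ∩ Z) (λ e → χ (meet x e)) (λ e → χ (not (clear ys e)))))
            (ℤ.+-monoʳ-≤ (over (Y ∩ Z) (λ e → χ (meet x e))) (clear-bound ys)))
        where
        le : ∀ s c → χ (not (not s ∧ c)) ≤ χ s + χ (not c)
        le true  true  = ℤ.≤-refl
        le true  false = +≤+ (s≤s z≤n)
        le false true  = ℤ.≤-refl
        le false false = ℤ.≤-refl
      total-bound : ∀ ys → All (λ b → Y b ≡ true × Z b ≡ false) ys → m * total ys ≤ pos (length ys) * B
      total-bound [] _ = ℤ.≤-reflexive (trans (zeroʳ m) (sym (zeroˡ B)))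
      total-bound (x ∷ ys) ((Yx , Zx) ∷ r) = subst₂ _≤_ (sym (distribˡ m _ (total ys))) (ar B (pos (length ys)))
          (ℤ.+-mono-≤ (few x Yx Zx) (total-bound ys r))
        where
        opaque
          unfolding _*_
          ar : ∀ B l → B + l * B ≡ (1ℤ + l) * B
          ar = solve-∀ ring
      pieces : All (λ b → Y b ≡ true × Z b ≡ false) xs
      pieces = All.map (λ {b} p → ∧-elimˡ p , not-elim (∧-elimʳ {Y b} p)) all
      clear-all : ∀ ys e → clear ys e ≡ true → Y e ≡ true → All (λ x → meet e x ≡ false) ys
      clear-all []       e _ _  = []
      clear-all (x ∷ ys) e c Ye = ≢true⇒false (λ mt → true≢false (meet-sym e x (Y-inj e Ye) mt) (not-elim (∧-elimˡ c))) ∷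
                                  clear-all ys e (∧-elimʳ {not (meet x e)} c) Ye
      extend : (∃ λ e → fresh e ≡ true) ⊎ (∀ e → fresh e ≡ false) → length xs ℕ.≤ t
      extend (inj₁ (e , p)) with em (e ∷ xs) (Ye ∷ in-Y) (clear-all xs e (∧-elimʳ {(Y ∩ Z) e} p) Ye ∷ ap)
        where
        Ye : Y e ≡ true
        Ye = ∧-elimˡ {Y e} (∧-elimˡ p)
      ... | s≤s le = le
      extend (inj₂ none) = ⊥-elim (ℤ.<⇒≱ many (begin
        m * size (Y ∩ Z)                                     ≡⟨ cong (m *_) (sym (over-1 (Y ∩ Z))) ⟩
        m * over (Y ∩ Z) (λ _ → 1ℤ)                          ≤⟨ *-monoˡ 0≤m (over-mono (Y ∩ Z) (λ e p → ℤ.≤-reflexive (sym (cong χ (unclear e p))))) ⟩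
        m * over (Y ∩ Z) (λ e → χ (not (clear xs e)))        ≤⟨ *-monoˡ 0≤m (clear-bound xs) ⟩
        m * total xs                                         ≤⟨ total-bound xs pieces ⟩
        -- A priori `xs` may have t + 1 entries, the bound inherited from `Y`; the hypothesis `many`
        -- is made to exclude exactly this many bundles of meetings.
        pos (length xs) * B                                  ≤⟨ *-monoʳ 0≤B (+≤+ (em xs in-Y ap)) ⟩
        pos (suc t) * B                                      ∎))
        where
        open ℤ.≤-Reasoning
        unclear : ∀ e → (Y ∩ Z) e ≡ true → not (clear xs e) ≡ true
        unclear e p with bool-cases (clear xs e)
        ... | inj₂ n = not-intro n
        ... | inj₁ c = true≢false (∧-intro p c) (none e)

    module _ (v : Carrier) (v≢0 : ¬ v ≡ 𝟎) where

      through : M → Bool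
      through b = v ∈im b

      deg≤through : ∀ Y → Injective Y → deg Y v ≤ size (Y ∩ through)
      deg≤through Y Y-inj = ℤ.≤-trans (over-mono Y (λ b Yb → single≤∈im v b (Y-inj b Yb))) (ℤ.≤-reflexive (sum-cong (λ b → sym (χ-∧ (Y b) (v ∈im b)))))

      through-size : ∀ Y → size (Y ∩ through) ≤ P
      through-size Y = subst (size (Y ∩ through) ≤_) (sum-single v)
        (sum-mono (λ b → ℤ.≤-trans (χ-mono {(Y ∩ through) b} {v ∈im b} (∧-elimʳ {Y b})) (∈im≤single v b v≢0)))

      through-meet : ∀ b e → through b ≡ true → through e ≡ true → meet b e ≡ true
      through-meet b e p r with ∈im-elim b p
      ... | u , s = meet-intro {b} {e} u (λ { refl → v≢0 (trans (sym s) (app-0ʳ V b)) }) (subst (λ w → (w ∈im e) ≡ true) (sym s) r)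

      -- A member through `v` that meets `x` contains `v` and a vector of `x`, and these are
      -- independent because `v` is not in `x`. It is counted q - 1 times, once for each multiple of
      -- that vector; `sum-both` is applied to each of the N₁ nonzero vectors of `x`.
      few-through : ∀ Y x → Inj x → through x ≡ false → a * over (Y ∩ through) (λ e → χ (meet x e)) ≤ D * P
      few-through Y x x-inj v∉x = begin
        a * over (Y ∩ through) (λ e → χ (meet x e))
          ≡⟨ ar₁ A (q - 1ℤ) (over (Y ∩ through) (λ e → χ (meet x e))) ⟩
        A * ((q - 1ℤ) * over (Y ∩ through) (λ e → χ (meet x e)))
          ≤⟨ *-monoˡ (<⇒0≤ 0<A) (subst (_≤ (∑[ e ] big e)) (over-*ˡ (Y ∩ through) (q - 1ℤ) (λ e → χ (meet x e))) (sum-mono pointwise)) ⟩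
        A * (∑[ e ] big e)
          ≡⟨ trans (cong (A *_) (sym (over-sum U.nz (λ y e → both v (x ⟨ y ⟩) e)))) (sym (over-*ˡ U.nz A (λ y → ∑[ e ] both v (x ⟨ y ⟩) e))) ⟩
        over U.nz (λ y → A * (∑[ e ] both v (x ⟨ y ⟩) e))
          ≤⟨ over-mono U.nz (λ y _ → sum-both v (x ⟨ y ⟩)) ⟩
        over U.nz (λ _ → C * P)
          ≡⟨ over-const U.nz (C * P) ⟩
        N₁ * (C * P)
          ≤⟨ *-monoʳ (0≤prod (<⇒0≤ 0<C) (<⇒0≤ 0<P)) N₁≤C ⟩
        C * (C * P)
          ≡⟨ sym (*-assoc C C P) ⟩
        D * P ∎
        where
        open ℤ.≤-Reasoning
        big : M → ℤ
        big e = over U.nz (λ y → both v (x ⟨ y ⟩) e)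
        opaque
          unfolding _*_
          ar₁ : ∀ a p s → p * a * s ≡ a * (p * s)
          ar₁ = solve-∀ ring
        pointwise : ∀ e → χ ((Y ∩ through) e) * ((q - 1ℤ) * χ (meet x e)) ≤ big e
        pointwise e with bool-cases ((Y ∩ through) e ∧ meet x e)
        ... | inj₂ n = subst (_≤ big e) (sym (trans (ar (χ ((Y ∩ through) e)) (q - 1ℤ) (χ (meet x e)))
                (trans (cong ((q - 1ℤ) *_) (trans (sym (χ-∧ ((Y ∩ through) e) (meet x e))) (cong χ n))) (zeroʳ (q - 1ℤ)))))
                (over-nonneg U.nz (λ y → 0≤both v (x ⟨ y ⟩) e))
          where
          opaque
            unfolding _*_
            ar : ∀ x y z → x * (y * z) ≡ y * (x * z)
            ar = solve-∀ ring
        ... | inj₁ p with ∈im-elim e (∧-elimʳ {Y e} (∧-elimˡ p)) | meet-elim {x} {e} (∧-elimʳ {(Y ∩ through) e} p)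
        ...   | u , eu | y , y≢0 , r with ∈im-elim e r
        ...     | w , ew = begin
            χ ((Y ∩ through) e) * ((q - 1ℤ) * χ (meet x e))
              ≡⟨ trans (cong₂ (λ s t → χ s * ((q - 1ℤ) * χ t)) (∧-elimˡ p) (∧-elimʳ {(Y ∩ through) e} p)) (trans (*-identityˡ _) (*-identityʳ (q - 1ℤ))) ⟩
            q - 1ℤ
              ≡⟨ sym (count-nz 𝕂) ⟩
            (∑[ c ] χ (VS.nz 𝕂 c))
              ≤⟨ count-inj (λ c → c U.· y , c U.· w) (VS.nz 𝕂) target hit (λ c c′ _ _ eq → U.scalar-inj y≢0 (cong proj₁ eq)) ⟩
            (∑[ p ] χ (target p))
              ≡⟨ trans (sum-× (λ p → χ (target p))) (sum-cong (λ y → trans (sum-cong (λ w → χ-∧ (U.nz y) (not (U.mult u w) ∧ ((e ⟨ u ⟩ == v) ∧ (e ⟨ w ⟩ == x ⟨ y ⟩)))))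
                   (trans (sum-*ˡ (χ (U.nz y)) (λ w → χ (not (U.mult u w) ∧ ((e ⟨ u ⟩ == v) ∧ (e ⟨ w ⟩ == x ⟨ y ⟩)))))
                     (cong (χ (U.nz y) *_) (sum-cong (λ w → trans (χ-∧ (not (U.mult u w)) ((e ⟨ u ⟩ == v) ∧ (e ⟨ w ⟩ == x ⟨ y ⟩)))
                       (cong (χ (not (U.mult u w)) *_) (χ-∧ (e ⟨ u ⟩ == v) (e ⟨ w ⟩ == x ⟨ y ⟩))))))))) ⟩
            over U.nz (λ y → ∑[ w ] joint v (x ⟨ y ⟩) u w e)
              ≤⟨ over-mono U.nz (λ y _ → joints≤both v (x ⟨ y ⟩) u e u≢0) ⟩
            big e ∎
          where
          u≢0 : ¬ u ≡ U.𝟎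
          u≢0 = preimage≢0 e u v≢0 eu
          target : U × U → Bool
          target (y , w) = U.nz y ∧ (not (U.mult u w) ∧ ((e ⟨ u ⟩ == v) ∧ (e ⟨ w ⟩ == x ⟨ y ⟩)))
          hit : ∀ c → VS.nz 𝕂 c ≡ true → target (c U.· y , c U.· w) ≡ true
          hit c nz = ∧-intro (U.nz-intro {c U.· y} (U.scale-nonzero c≢0 y≢0)) (∧-intro (not-intro ind) (∧-intro (≡⇒== eu) (≡⇒== ecw)))
            where
            c≢0 : ¬ c ≡ 0ᵏ
            c≢0 = VS.nz-elim 𝕂 nz
            ecw : e ⟨ c U.· w ⟩ ≡ x ⟨ c U.· y ⟩
            ecw = trans (app-·ʳ V e c w) (trans (cong (c ·_) ew) (sym (app-·ʳ V x c y)))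
            xcy≢0 : ¬ x ⟨ c U.· y ⟩ ≡ 𝟎
            xcy≢0 z = U.scale-nonzero c≢0 y≢0 (x-inj _ z)
            -- Otherwise v would be a multiple of a vector of x.
            ind : U.mult u (c U.· w) ≡ false
            ind = ≢true⇒false (λ m → contra (U.mult-elim {u} {c U.· w} m))
              where
              contra : (∃ λ d → c U.· w ≡ d U.· u) → ⊥
              contra (d , eq) = let i , di = inverse d d≢0 in
                  true≢false (subst (λ z → (z ∈im x) ≡ true) (trans (cong (i ·_) xy≡) (unscale di v)) (∈im-scale x i (∈im-intro x (c U.· y) refl))) v∉x
                where
                xy≡ : x ⟨ c U.· y ⟩ ≡ d · v
                xy≡ = trans (sym ecw) (trans (cong (e ⟨_⟩) eq) (trans (app-·ʳ V e d u) (cong (d ·_) eu)))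
                d≢0 : ¬ d ≡ 0ᵏ
                d≢0 = nonzero-scalar (λ z → xcy≢0 (trans xy≡ z))

  module Span (𝔽 : FiniteField) (V : Linear.VSpace 𝔽) (k′ : ℕ) where
    open Linear 𝔽
    open VS V
    open Moments 𝔽 V k′
    open Energy 𝔽 V k′
    open Pairs 𝔽 V k′
    open Triples 𝔽 V k′
    open Stability 𝔽 V k′
    open Greedy 𝔽 V k′
    open Incidence 𝔽 V k′
    open Peel 𝔽 V k′
    open SubspaceIndex 𝔽 V

    opaque
      unfolding _*_
      pow-arr : ∀ x y z w → (x * y) * (z * w) ≡ (x * z) * (y * w)
      pow-arr = solve-∀ ring

    ^-distrib : ∀ x y n → (x * y) ^ n ≡ x ^ n * y ^ n
    ^-distrib x y zero    = sym (*-identityˡ 1ℤ)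
    ^-distrib x y (suc n) = trans (cong (x * y *_) (^-distrib x y n)) (pow-arr x y (x ^ n) (y ^ n))

    ^-nonneg : ∀ {x} → 0ℤ ≤ x → ∀ n → 0ℤ ≤ x ^ n
    ^-nonneg p zero    = 0≤pos
    ^-nonneg p (suc n) = 0≤prod p (^-nonneg p n)

    ^-mono : ∀ {x y} → 0ℤ ≤ x → x ≤ y → ∀ n → x ^ n ≤ y ^ n
    ^-mono 0≤x p zero    = ℤ.≤-refl
    ^-mono 0≤x p (suc n) = ℤ.≤-trans (*-monoʳ (^-nonneg 0≤x n) p) (*-monoˡ (ℤ.≤-trans 0≤x p) (^-mono 0≤x p n))

    module _ (S : Carrier → Bool) (S-closed : Closed S) (D≤A : D ≤ A)
             (S-size : q * (∑[ v ] χ (S v)) ≤ D) where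
      private
        σ : ℤ
        σ = ∑[ v ] χ (S v)

        0≤σ : 0ℤ ≤ σ
        0≤σ = sum-nonneg (λ v → 0≤χ (S v))

      lies : ∀ {j} → Vec Carrier j → Bool
      lies e = not (ex λ w → not (S (app V e w)))

      lies-elim : ∀ {j} (e : Vec Carrier j) → lies e ≡ true → ∀ w → S (app V e w) ≡ true
      lies-elim e p w with bool-cases (S (app V e w))
      ... | inj₁ s = s
      ... | inj₂ n = true≢false (ex-intro (λ w → not (S (app V e w))) w (not-intro n)) (not-elim p)

      lies-intro : ∀ {j} (e : Vec Carrier j) → (∀ w → S (app V e w) ≡ true) → lies e ≡ true
      lies-intro e h = not-intro (≢true⇒false (λ p → let w , n = ex-elim (λ w → not (S (app V e w))) p in
        true≢false (h w) (not-elim n)))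

      lies-head : ∀ {j} h (t : Vec Carrier j) → lies (h ∷ t) ≡ true → S h ≡ true
      lies-head {j} h t p = subst (λ v → S v ≡ true) (app-head V h t) (lies-elim (h ∷ t) p (1ᵏ ∷ VS.𝟎 (Pow 𝕂 j)))

      lies-tail : ∀ {j} h (t : Vec Carrier j) → lies (h ∷ t) ≡ true → lies t ≡ true
      lies-tail h t p = lies-intro t (λ w → subst (λ v → S v ≡ true) (app-tail V h t w) (lies-elim (h ∷ t) p (0ᵏ ∷ w)))

      count-lies : ∀ j → sum {Vec Carrier j} (λ e → χ (lies e)) ≤ σ ^ j
      count-lies zero    = subst (_≤ 1ℤ) (sym (sum-[] (λ e → χ (lies e)))) (χ≤1 (lies []))
      count-lies (suc j) = begin
        sum (λ e → χ (lies {suc j} e))                      ≡⟨ sum-∷ (λ e → χ (lies e)) ⟩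
        (∑[ h ] ∑[ t ] χ (lies {suc j} (h ∷ t)))            ≤⟨ sum-mono (λ h → sum-mono (λ t → le h t)) ⟩
        (∑[ h ] ∑[ t ] χ (S h) * χ (lies {j} t))            ≡⟨ sum-sum-* (λ h → χ (S h)) (λ t → χ (lies {j} t)) ⟩
        σ * sum (λ t → χ (lies {j} t))                      ≤⟨ *-monoˡ 0≤σ (count-lies j) ⟩
        σ * σ ^ j                                           ∎
        where
        open ℤ.≤-Reasoning
        le : ∀ h t → χ (lies {suc j} (h ∷ t)) ≤ χ (S h) * χ (lies t)
        le h t = subst (χ (lies (h ∷ t)) ≤_) (χ-∧ (S h) (lies t)) (χ-mono (λ p → ∧-intro (lies-head h t p) (lies-tail h t p)))

      -- Given the other entries, the entry at the first nonzero coordinate of `w` is determined by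
      -- the value `z`; this saves one factor σ.
      count-lies-at : ∀ j (w : Vec K (suc j)) z → ¬ w ≡ VS.𝟎 (Pow 𝕂 (suc j)) →
        sum {Vec Carrier (suc j)} (λ e → χ (lies e ∧ (app V e w == z))) ≤ σ ^ j
      count-lies-at j (c ∷ w) z cw≢0 = subst (_≤ σ ^ j) (sym (sum-∷ (λ e → χ (lies e ∧ (app V e (c ∷ w) == z))))) (by-head j w cw≢0 (c ≟ 0ᵏ))
        where
        open ℤ.≤-Reasoning
        by-head : ∀ j (w : Vec K j) → ¬ c ∷ w ≡ VS.𝟎 (Pow 𝕂 (suc j)) → Relation.Nullary.Dec (c ≡ 0ᵏ) →
          (∑[ h ] ∑[ t ] χ (lies {suc j} (h ∷ t) ∧ (app V (h ∷ t) (c ∷ w) == z))) ≤ σ ^ j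
        by-head j w _ (no c≢0) = begin
          (∑[ h ] ∑[ t ] χ (lies {suc j} (h ∷ t) ∧ (app V (h ∷ t) (c ∷ w) == z)))
            ≡⟨ sum-swap (λ h t → χ (lies {suc j} (h ∷ t) ∧ (app V (h ∷ t) (c ∷ w) == z))) ⟩
          (∑[ t ] ∑[ h ] χ (lies {suc j} (h ∷ t) ∧ (app V (h ∷ t) (c ∷ w) == z)))
            ≤⟨ sum-mono (λ t → at-most-one (λ h → lies {suc j} (h ∷ t) ∧ (app V (h ∷ t) (c ∷ w) == z)) (lies {j} t) (λ h p → lies-tail h t (∧-elimˡ p))
                 (λ h h′ p p′ → cancel (⊕-cancelʳ (app V t w) (c · h) (c · h′) (trans (==⇒≡ (∧-elimʳ {lies {suc j} (h ∷ t)} p)) (sym (==⇒≡ (∧-elimʳ {lies {suc j} (h′ ∷ t)} p′))))))) ⟩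
          sum (λ t → χ (lies {j} t))
            ≤⟨ count-lies j ⟩
          σ ^ j ∎
          where
          cancel : ∀ {x y} → c · x ≡ c · y → x ≡ y
          cancel {x} {y} p = let d , cd = inverse c c≢0 in trans (sym (unscale cd x)) (trans (cong (d ·_) p) (unscale cd y))
        by-head zero [] cw≢0 (yes refl) = ⊥-elim (cw≢0 refl)
        by-head (suc i) w cw≢0 (yes refl) = begin
          (∑[ h ] ∑[ t ] χ (lies {suc (suc i)} (h ∷ t) ∧ (app V (h ∷ t) (0ᵏ ∷ w) == z)))
            ≤⟨ sum-mono (λ h → sum-mono (λ t → le h t)) ⟩
          (∑[ h ] ∑[ t ] χ (S h) * χ (lies {suc i} t ∧ (app V t w == z)))
            ≡⟨ sum-sum-* (λ h → χ (S h)) (λ t → χ (lies {suc i} t ∧ (app V t w == z))) ⟩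
          σ * sum (λ t → χ (lies {suc i} t ∧ (app V t w == z)))
            ≤⟨ *-monoˡ 0≤σ (count-lies-at i w z (λ { refl → cw≢0 refl })) ⟩
          σ * σ ^ i ∎
          where
          le : ∀ h t → χ (lies {suc (suc i)} (h ∷ t) ∧ (app V (h ∷ t) (0ᵏ ∷ w) == z)) ≤ χ (S h) * χ (lies t ∧ (app V t w == z))
          le h t = subst (χ (lies (h ∷ t) ∧ (app V (h ∷ t) (0ᵏ ∷ w) == z)) ≤_) (χ-∧ (S h) (lies t ∧ (app V t w == z)))
            (χ-mono (λ p → ∧-intro (lies-head h t (∧-elimˡ p)) (∧-intro (lies-tail h t (∧-elimˡ p))
              (≡⇒== (trans (sym (app-tail V h t w)) (==⇒≡ (∧-elimʳ {lies (h ∷ t)} p)))))))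

      private
        Cₜ : ℤ
        Cₜ = card (Vec K k′)

        C≡ : C ≡ q * Cₜ
        C≡ = trans (sum-∷ (λ _ → 1ℤ)) (sum-const {K} Cₜ)

        Cₜ≡ : Cₜ ≡ q ^ k′
        Cₜ≡ = card-Vec K k′

        -- q^(k-1) σ^(k-1) = (q σ)^(k-1) ≤ D^(k-1) ≤ A^(k-1). Here 2k ≤ n enters in the form `D≤A`.
        scaled-power : Cₜ * σ ^ k′ ≤ A′
        scaled-power = subst (_≤ A′) (trans (^-distrib q σ k′) (cong (_* σ ^ k′) (sym Cₜ≡)))
          (^-mono (0≤prod (<⇒0≤ 0<q) 0≤σ) (ℤ.≤-trans S-size D≤A) k′)

      -- The vectors of `x` inside `S` form a subspace of index at least q, so at most C / q of them
      -- can be shared. Each of these, paired with a nonzero `w`, admits at most σ^(k-1) tuples by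
      -- `count-lies-at`, and every member that meets `x` is counted at least q - 1 times.
      few-lying : ∀ Y x → Inj x → lies x ≡ false → (q - 1ℤ) * over (Y ∩ lies) (λ e → χ (meet x e)) ≤ P
      few-lying Y x x-inj out = *-cancelˡ 0<q (begin
        q * ((q - 1ℤ) * over (Y ∩ lies) (λ e → χ (meet x e)))
          ≤⟨ *-monoˡ (<⇒0≤ 0<q) (subst (_≤ (∑[ e ] big e)) (over-*ˡ (Y ∩ lies) (q - 1ℤ) (λ e → χ (meet x e))) (sum-mono pointwise)) ⟩
        q * (∑[ e ] big e)
          ≡⟨ cong (q *_) (trans (sym (over-sum Sx (λ y e → over U.nz (λ w → t y w e)))) (over-cong Sx (λ y → sym (over-sum U.nz (λ w e → t y w e))))) ⟩
        q * over Sx (λ y → over U.nz (λ w → ∑[ e ] t y w e))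
          ≤⟨ *-monoˡ (<⇒0≤ 0<q) (over-mono Sx (λ y _ → over-mono U.nz (λ w w≢0 → count-lies-at k′ w (x ⟨ y ⟩) (U.nz-elim {w} w≢0)))) ⟩
        q * over Sx (λ y → over U.nz (λ w → σ ^ k′))
          ≡⟨ trans (cong (q *_) (trans (over-const Sx (over U.nz (λ w → σ ^ k′))) (cong ((∑[ y ] χ (Sx y)) *_) (over-const U.nz (σ ^ k′))))) (sym (*-assoc q (∑[ y ] χ (Sx y)) (N₁ * σ ^ k′))) ⟩
        q * (∑[ y ] χ (Sx y)) * (N₁ * σ ^ k′)
          ≤⟨ *-monoʳ (0≤prod (<⇒0≤ 0<N₁) (^-nonneg 0≤σ k′)) index ⟩
        C * (N₁ * σ ^ k′)
          ≡⟨ trans (cong (_* (N₁ * σ ^ k′)) C≡) (ar q Cₜ N₁ (σ ^ k′)) ⟩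
        q * (N₁ * (Cₜ * σ ^ k′))
          ≤⟨ *-monoˡ (<⇒0≤ 0<q) (*-monoˡ (<⇒0≤ 0<N₁) scaled-power) ⟩
        q * P ∎)
        where
        open ℤ.≤-Reasoning
        Sx : U → Bool
        Sx y = S (x ⟨ y ⟩)
        t : U → U → M → ℤ
        t y w e = χ (lies e ∧ (e ⟨ w ⟩ == x ⟨ y ⟩))
        0≤t : ∀ y w e → 0ℤ ≤ t y w e
        0≤t y w e = 0≤χ (lies e ∧ (e ⟨ w ⟩ == x ⟨ y ⟩))
        big : M → ℤ
        big e = over Sx (λ y → over U.nz (λ w → t y w e))
        opaque
          unfolding _*_
          ar : ∀ q c n s → q * c * (n * s) ≡ q * (n * (c * s))
          ar = solve-∀ ring
        Sx-closed : SubspaceIndex.Closed 𝔽 (Pow 𝕂 k) Sx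
        Sx-closed = (λ y y′ p p′ → subst (λ v → S v ≡ true) (sym (app-⊕ʳ V x y y′)) (proj₁ S-closed _ _ p p′)) ,
                    (λ c y p → subst (λ v → S v ≡ true) (sym (app-·ʳ V x c y)) (proj₂ S-closed c _ p))
        index : q * (∑[ y ] χ (Sx y)) ≤ C
        index = let w , n = ex-elim (λ w → not (S (x ⟨ w ⟩))) (contains (ex λ w → not (S (x ⟨ w ⟩))) out) in
          ℤ.≤-trans (ℤ.≤-reflexive (cong (q *_) (sum-cong (λ y → cong χ (∧-true (Sx y))))))
            (SubspaceIndex.index-bound 𝔽 (Pow 𝕂 k) Sx (λ _ → true) Sx-closed ((λ _ _ _ _ → refl) , (λ _ _ _ → refl)) w (not-elim n) refl)
          where
          contains : ∀ b → not b ≡ false → b ≡ true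
          contains true _ = refl
          ∧-true : ∀ b → b ≡ b ∧ true
          ∧-true true  = refl
          ∧-true false = refl
        pointwise : ∀ e → χ ((Y ∩ lies) e) * ((q - 1ℤ) * χ (meet x e)) ≤ big e
        pointwise e with bool-cases ((Y ∩ lies) e ∧ meet x e)
        ... | inj₂ n = subst (_≤ big e) (sym (trans (ar′ (χ ((Y ∩ lies) e)) (q - 1ℤ) (χ (meet x e)))
                (trans (cong ((q - 1ℤ) *_) (trans (sym (χ-∧ ((Y ∩ lies) e) (meet x e))) (cong χ n))) (zeroʳ (q - 1ℤ)))))
                (over-nonneg Sx (λ y → over-nonneg U.nz (λ w → 0≤t y w e)))
          where
          opaque
            unfolding _*_
            ar′ : ∀ x y z → x * (y * z) ≡ y * (x * z)
            ar′ = solve-∀ ring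
        ... | inj₁ p with meet-elim {x} {e} (∧-elimʳ {(Y ∩ lies) e} p)
        ...   | y , y≢0 , r with ∈im-elim e r
        ...     | w , ew = begin
            χ ((Y ∩ lies) e) * ((q - 1ℤ) * χ (meet x e))
              ≡⟨ trans (cong₂ (λ s t → χ s * ((q - 1ℤ) * χ t)) (∧-elimˡ p) (∧-elimʳ {(Y ∩ lies) e} p)) (trans (*-identityˡ _) (*-identityʳ (q - 1ℤ))) ⟩
            q - 1ℤ
              ≡⟨ sym (count-nz 𝕂) ⟩
            (∑[ c ] χ (VS.nz 𝕂 c))
              ≤⟨ count-inj (λ c → c U.· y , c U.· w) (VS.nz 𝕂) target hit (λ c c′ _ _ eq → U.scalar-inj y≢0 (cong proj₁ eq)) ⟩
            (∑[ p ] χ (target p))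
              ≡⟨ trans (sum-× (λ p → χ (target p))) (sum-cong (λ y → trans (sum-cong (λ w → trans (χ-∧ (Sx y) (U.nz w ∧ (lies e ∧ (e ⟨ w ⟩ == x ⟨ y ⟩))))
                   (cong (χ (Sx y) *_) (χ-∧ (U.nz w) (lies e ∧ (e ⟨ w ⟩ == x ⟨ y ⟩)))))) (sum-*ˡ (χ (Sx y)) (λ w → χ (U.nz w) * t y w e)))) ⟩
            big e ∎
          where
          target : U × U → Bool
          target (y , w) = Sx y ∧ (U.nz w ∧ (lies e ∧ (e ⟨ w ⟩ == x ⟨ y ⟩)))
          in-S : lies e ≡ true
          in-S = ∧-elimʳ {Y e} (∧-elimˡ p)
          hit : ∀ c → VS.nz 𝕂 c ≡ true → target (c U.· y , c U.· w) ≡ true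
          hit c nz = ∧-intro (subst (λ v → S v ≡ true) ecw (lies-elim e in-S (c U.· w)))
              (∧-intro (U.nz-intro {c U.· w} cw≢0) (∧-intro in-S (≡⇒== ecw)))
            where
            ecw : e ⟨ c U.· w ⟩ ≡ x ⟨ c U.· y ⟩
            ecw = trans (app-·ʳ V e c w) (trans (cong (c ·_) ew) (sym (app-·ʳ V x c y)))
            cw≢0 : ¬ c U.· w ≡ U.𝟎
            cw≢0 z = U.scale-nonzero (VS.nz-elim 𝕂 nz) y≢0 (x-inj _ (trans (sym ecw) (trans (cong (e ⟨_⟩) z) (app-0ʳ V e))))

      -- Counting all tuples with entries in `S` would only give C A′, slightly more than P = (C -
      -- 1) A′. Injectivity supplies the difference: q times the number of heads for a given tail is
      -- at most D - C instead of D.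
      lying-size : ∀ Y → Injective Y → size (Y ∩ lies) ≤ P
      lying-size Y Y-inj = *-cancelˡ 0<C (begin
        C * size (Y ∩ lies)
          ≡⟨ trans (cong (_* size (Y ∩ lies)) C≡) (ar₁ q Cₜ (size (Y ∩ lies))) ⟩
        Cₜ * (q * size (Y ∩ lies))
          ≡⟨ cong (λ z → Cₜ * (q * z)) (trans (sum-∷ (λ e → χ ((Y ∩ lies) e))) (sum-swap (λ h t → χ ((Y ∩ lies) (h ∷ t))))) ⟩
        Cₜ * (q * (∑[ t ] ∑[ h ] χ ((Y ∩ lies) (h ∷ t))))
          ≤⟨ *-monoˡ 0≤Cₜ (subst (_≤ (∑[ t ] χ (lies {k′} t) * (D - C))) (sum-*ˡ q (λ t → ∑[ h ] χ ((Y ∩ lies) (h ∷ t)))) (sum-mono per-tail)) ⟩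
        Cₜ * (∑[ t ] χ (lies {k′} t) * (D - C))
          ≤⟨ *-monoˡ 0≤Cₜ (subst (_≤ σ ^ k′ * (D - C)) (sym (sum-*ʳ (D - C) (λ t → χ (lies {k′} t)))) (*-monoʳ 0≤D-C (count-lies k′))) ⟩
        Cₜ * (σ ^ k′ * (D - C))
          ≡⟨ sym (*-assoc Cₜ (σ ^ k′) (D - C)) ⟩
        Cₜ * σ ^ k′ * (D - C)
          ≤⟨ *-monoʳ 0≤D-C scaled-power ⟩
        A′ * (D - C)
          ≡⟨ trans (ar₂ A′ C) (cong (λ n → C * (n * A′)) (sym N₁≡)) ⟩
        C * P ∎)
        where
        open ℤ.≤-Reasoning
        opaque
          unfolding _*_
          ar₁ : ∀ q c s → q * c * s ≡ c * (q * s)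
          ar₁ = solve-∀ ring
          ar₂ : ∀ a c → a * (c * c - c) ≡ c * ((c - 1ℤ) * a)
          ar₂ = solve-∀ ring
          ar₃ : ∀ c → c * c - c ≡ c * (c - 1ℤ)
          ar₃ = solve-∀ ring
          ar₄ : ∀ q d s x i → (d - q * i) - q * x ≡ (d - q * s) + q * (s - (x + i))
          ar₄ = solve-∀ ring
        0≤Cₜ : 0ℤ ≤ Cₜ
        0≤Cₜ = sum-nonneg {Vec K k′} (λ _ → 0≤pos)
        0≤D-C : 0ℤ ≤ D - C
        0≤D-C = subst (0ℤ ≤_) (sym (ar₃ C)) (0≤prod (<⇒0≤ 0<C) (subst (0ℤ ≤_) N₁≡ (<⇒0≤ 0<N₁)))
        -- The head of an injective tuple avoids the image of its tail.
        per-tail : ∀ t → q * (∑[ h ] χ ((Y ∩ lies) (h ∷ t))) ≤ χ (lies {k′} t) * (D - C)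
        per-tail t with find (λ h → (Y ∩ lies) (h ∷ t))
        ... | inj₂ none = subst (_≤ χ (lies t) * (D - C)) (sym (trans (cong (q *_) (sum-zero (λ h → cong χ (none h)))) (zeroʳ q)))
                (0≤prod (0≤χ (lies t)) 0≤D-C)
        ... | inj₁ (h₀ , p) = subst (q * (∑[ h ] χ ((Y ∩ lies) (h ∷ t))) ≤_)
              (sym (trans (cong (λ s → χ s * (D - C)) t-lies) (*-identityˡ (D - C))))
              (≤-by (0≤sum (0≤diff S-size) (0≤prod (<⇒0≤ 0<q) (0≤diff (ℤ.≤-trans (ℤ.+-monoʳ-≤ (∑[ h ] χ ((Y ∩ lies) (h ∷ t))) im-size) disjoint-parts))))
                (trans (cong (λ c → D - c - q * (∑[ h ] χ ((Y ∩ lies) (h ∷ t)))) C≡) (ar₄ q D σ (∑[ h ] χ ((Y ∩ lies) (h ∷ t))) Cₜ)))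
          where
          in-t : Carrier → Bool
          in-t v = ex λ w → app V t w == v
          t-lies : lies t ≡ true
          t-lies = lies-tail h₀ t (∧-elimʳ {Y (h₀ ∷ t)} p)
          im-size : Cₜ ≤ (∑[ v ] χ (in-t v))
          im-size = count-inj (app V t) (λ _ → true) in-t (λ w _ → ex-intro (λ w′ → app V t w′ == app V t w) w (≡⇒== {x = app V t w} refl))
            (λ w w′ _ _ eq → tail-eq (Inj⇒≡ (h₀ ∷ t) (Y-inj (h₀ ∷ t) (∧-elimˡ p)) (0ᵏ ∷ w) (0ᵏ ∷ w′) (trans (app-tail V h₀ t w) (trans eq (sym (app-tail V h₀ t w′))))))
            where
            tail-eq : ∀ {c d : K} {n} {u v : Vec K n} → c ∷ u ≡ d ∷ v → u ≡ v
            tail-eq refl = refl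
          disjoint-parts : (∑[ h ] χ ((Y ∩ lies) (h ∷ t))) + (∑[ h ] χ (in-t h)) ≤ σ
          disjoint-parts = subst (_≤ σ) (sum-+ (λ h → χ ((Y ∩ lies) (h ∷ t))) (λ h → χ (in-t h))) (sum-mono pt)
            where
            pt : ∀ h → χ ((Y ∩ lies) (h ∷ t)) + χ (in-t h) ≤ χ (S h)
            pt h with bool-cases (in-t h) | bool-cases ((Y ∩ lies) (h ∷ t))
            ... | inj₂ n | inj₂ n′ = subst (_≤ χ (S h)) (sym (cong₂ (λ x y → χ x + χ y) n′ n)) (0≤χ (S h))
            ... | inj₂ n | inj₁ y = subst₂ _≤_ (sym (cong₂ (λ x y → χ x + χ y) y n)) (sym (cong χ (lies-head h t (∧-elimʳ {Y (h ∷ t)} y)))) ℤ.≤-refl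
            ... | inj₁ i | c = finish (ex-elim (λ w → app V t w == h) i) c
              where
              finish : (∃ λ w → (app V t w == h) ≡ true) → (Y ∩ lies) (h ∷ t) ≡ true ⊎ (Y ∩ lies) (h ∷ t) ≡ false →
                       χ ((Y ∩ lies) (h ∷ t)) + χ (in-t h) ≤ χ (S h)
              finish (w , r) (inj₂ n) = subst₂ _≤_ (sym (cong₂ (λ x y → χ x + χ y) n i))
                (sym (cong χ (subst (λ v → S v ≡ true) (==⇒≡ r) (lies-elim t t-lies w)))) ℤ.≤-refl
              finish (w , r) (inj₁ y) = ⊥-elim (0≢1 (sym (head-eq (Y-inj (h ∷ t) (∧-elimˡ y) (1ᵏ ∷ VS.⊖_ (Pow 𝕂 k′) w)
                (trans (cong₂ _⊕_ (·-identity h) (trans (app-⊖ʳ V t w) (cong ⊖_ (==⇒≡ r)))) (⊕-inverseʳ h))))))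
                where
                head-eq : ∀ {c d : K} {n} {u v : Vec K n} → c ∷ u ≡ d ∷ v → c ≡ d
                head-eq refl = refl

      -- Two disjoint members inside `S` would span `D` vectors, but `S` has at most D / q.
      lies-meet : ∀ b e → Inj b → Inj e → lies b ≡ true → lies e ≡ true → meet b e ≡ true
      lies-meet b e b-inj e-inj lb le with bool-cases (meet b e)
      ... | inj₁ m = m
      ... | inj₂ n = ⊥-elim (ℤ.<⇒≱ 0<q-1 (*-cancelˡ 0<D (subst₂ _≤_ (ar₁ D q) (sym (zeroʳ D)) (ℤ.i≤j⇒i-j≤0 (ℤ.≤-trans (*-monoˡ (<⇒0≤ 0<q) many) S-size)))))
        where
        opaque
          unfolding _*_
          ar₁ : ∀ d q → q * d - d ≡ d * (q - 1ℤ)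
          ar₁ = solve-∀ ring
        many : D ≤ σ
        many = subst (_≤ σ) (trans (sum-× {A = U} {B = U} (λ _ → 1ℤ)) (sum-const {U} C))
          (count-inj (λ p → b ⟨ proj₁ p ⟩ ⊕ e ⟨ proj₂ p ⟩) (λ _ → true) S
            (λ p _ → proj₁ S-closed _ _ (lies-elim b lb (proj₁ p)) (lies-elim e le (proj₂ p)))
            (λ { (u , w) (u′ , w′) _ _ eq → same u w u′ w′ eq }))
          where
          open ≡-Reasoning
          same : ∀ u w u′ w′ → b ⟨ u ⟩ ⊕ e ⟨ w ⟩ ≡ b ⟨ u′ ⟩ ⊕ e ⟨ w′ ⟩ → (u , w) ≡ (u′ , w′)
          same u w u′ w′ eq = cong₂ _,_ u≡u′ w≡w′
            where
            diff : b ⟨ u U.⊕ U.⊖ u′ ⟩ ≡ e ⟨ w′ U.⊕ U.⊖ w ⟩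
            diff = ⊕-cancelʳ (b ⟨ u′ ⟩ ⊕ e ⟨ w ⟩) _ _ (begin
              b ⟨ u U.⊕ U.⊖ u′ ⟩ ⊕ (b ⟨ u′ ⟩ ⊕ e ⟨ w ⟩)   ≡⟨ sym (⊕-assoc _ _ _) ⟩
              (b ⟨ u U.⊕ U.⊖ u′ ⟩ ⊕ b ⟨ u′ ⟩) ⊕ e ⟨ w ⟩   ≡⟨ cong (_⊕ e ⟨ w ⟩) (trans (sym (app-⊕ʳ V b _ u′)) (cong (b ⟨_⟩) (U.⊖⊕ u u′))) ⟩
              b ⟨ u ⟩ ⊕ e ⟨ w ⟩                           ≡⟨ eq ⟩
              b ⟨ u′ ⟩ ⊕ e ⟨ w′ ⟩                         ≡⟨ cong (b ⟨ u′ ⟩ ⊕_) (trans (cong (e ⟨_⟩) (sym (U.⊖⊕ w′ w))) (app-⊕ʳ V e _ w)) ⟩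
              b ⟨ u′ ⟩ ⊕ (e ⟨ w′ U.⊕ U.⊖ w ⟩ ⊕ e ⟨ w ⟩)   ≡⟨ sym (⊕-assoc _ _ _) ⟩
              (b ⟨ u′ ⟩ ⊕ e ⟨ w′ U.⊕ U.⊖ w ⟩) ⊕ e ⟨ w ⟩   ≡⟨ cong (_⊕ e ⟨ w ⟩) (⊕-comm _ _) ⟩
              (e ⟨ w′ U.⊕ U.⊖ w ⟩ ⊕ b ⟨ u′ ⟩) ⊕ e ⟨ w ⟩   ≡⟨ ⊕-assoc _ _ _ ⟩
              e ⟨ w′ U.⊕ U.⊖ w ⟩ ⊕ (b ⟨ u′ ⟩ ⊕ e ⟨ w ⟩)   ∎)
            d≡0 : u U.⊕ U.⊖ u′ ≡ U.𝟎
            d≡0 with (u U.⊕ U.⊖ u′) ≟ U.𝟎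
            ... | yes z = z
            ... | no z = true≢false (meet-intro {b} {e} (u U.⊕ U.⊖ u′) z (∈im-intro e (w′ U.⊕ U.⊖ w) (sym diff))) n
            u≡u′ : u ≡ u′
            u≡u′ = trans (sym (U.⊖⊕ u u′)) (trans (cong (U._⊕ u′) d≡0) (U.⊕-identityˡ u′))
            w≡w′ : w ≡ w′
            w≡w′ = sym (trans (sym (U.⊖⊕ w′ w)) (trans (cong (U._⊕ w) (e-inj _ (trans (sym diff) (trans (cong (b ⟨_⟩) d≡0) (app-0ʳ V b))))) (U.⊕-identityˡ w)))

  -- Peeling off heavy centres

  -- The constants combine 6q + 8 and 5q + 9 from light-bound with the factor
  -- 1001/1000 > (4096/4095)², which absorbs the deficit Δ of the family.
  Slack : (q A D t : ℤ) → Set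
  Slack q A D t = D * (t * (pos 8002 * q + pos 8000) + pos 3003 * (q - 1ℤ)) < (q - 1ℤ) * A * (pos 995 * q - pos 1009)

  -- The ring solver is unary in numeric literals, so the identities below take their large
  -- constants as variables.
  opaque
    unfolding _*_

    near-linear-identity : ∀ m k n r p y → (k * n + r) * (y * y) - m * (k * (p * y)) ≡ y * (k * (n * y - m * p)) + r * (y * y)
    near-linear-identity = solve-∀ ring

    near-square-identity : ∀ m k n r p y → (k * (n * n) + r) * (y * y) - m * m * (k * (p * p)) ≡
                           k * ((n * y - m * p) * (n * y + m * p)) + r * (y * y)
    near-square-identity = solve-∀ ring

    distrib-minus : ∀ m l x z → m * (l * x - z) ≡ m * l * x - m * z
    distrib-minus = solve-∀ ring

    -- The positive remainders here and in `constant₂` express that 1001/1000 exceeds 4096/4095 and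
    -- its square.
    constant₁ : pos 4095 * pos 1001 ≡ pos 1000 * pos 4096 + pos 3095
    constant₁ = refl

    constant₂ : pos 4095 * pos 4095 * pos 1001 ≡ pos 1000 * (pos 4096 * pos 4096) + pos 8578025
    constant₂ = refl

    -- `light-bound` is scaled by N, and N t P y and N (t P)² are replaced by N′ y². For N = 1000
    -- and N′ = 1001 the coefficients 6N + 2N′, 8N, 3N′, 6N - 5N′ and 9N′ - 8N are 8002, 8000, 3003,
    -- 995 and 1009.
    slack-identity′ : ∀ N N′ q a d w P t y →
      y * y * (d * (t * ((pos 6 * N + pos 2 * N′) * q + pos 8 * N)) + pos 3 * N′ * w - a * ((pos 6 * N - pos 5 * N′) * q - (pos 9 * N′ - pos 8 * N))) ≡
      N * (t * ((pos 6 * q + pos 8) * (d * (y * y)) + ((pos 5 * q + pos 9) * a + pos 3 * w) * (P * y) + t * (pos 2 * q * (t * d * (P * P))))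
        - (pos 6 * q + pos 8) * (a * (y * y)))
      + ((pos 5 * q + pos 9) * a + pos 3 * w) * (N′ * (y * y) - N * (t * P * y))
      + pos 2 * q * (t * d) * (N′ * (y * y) - N * (t * P * (t * P)))
    slack-identity′ = solve-∀ ring

    slack-identity : ∀ q a d w P t y →
      y * y * (d * (t * (pos 8002 * q + pos 8000)) + pos 3003 * w - a * (pos 995 * q - pos 1009)) ≡
      pos 1000 * (t * ((pos 6 * q + pos 8) * (d * (y * y)) + ((pos 5 * q + pos 9) * a + pos 3 * w) * (P * y) + t * (pos 2 * q * (t * d * (P * P))))
        - (pos 6 * q + pos 8) * (a * (y * y)))
      + ((pos 5 * q + pos 9) * a + pos 3 * w) * (pos 1001 * (y * y) - pos 1000 * (t * P * y))
      + pos 2 * q * (t * d) * (pos 1001 * (y * y) - pos 1000 * (t * P * (t * P)))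
    slack-identity = slack-identity′ (pos 1000) (pos 1001)

    slack-shape′ : ∀ q d t x y → d * (t * x + y * (q - 1ℤ)) ≡ d * (t * x) + y * ((q - 1ℤ) * d)
    slack-shape′ = solve-∀ ring

  slack-shape : ∀ q d t → d * (t * (pos 8002 * q + pos 8000) + pos 3003 * (q - 1ℤ)) ≡
                d * (t * (pos 8002 * q + pos 8000)) + pos 3003 * ((q - 1ℤ) * d)
  slack-shape q d t = slack-shape′ q d t (pos 8002 * q + pos 8000) (pos 3003)

  near-linear : ∀ p y → pos 4095 * (pos 1001 * (y * y) - pos 1000 * (p * y)) ≡
                y * (pos 1000 * (pos 4096 * y - pos 4095 * p)) + pos 3095 * (y * y)
  near-linear p y = trans (distrib-minus (pos 4095) (pos 1001) (y * y) (pos 1000 * (p * y)))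
    (trans (cong (λ c → c * (y * y) - pos 4095 * (pos 1000 * (p * y))) constant₁)
      (near-linear-identity (pos 4095) (pos 1000) (pos 4096) (pos 3095) p y))

  near-square : ∀ p y → pos 4095 * pos 4095 * (pos 1001 * (y * y) - pos 1000 * (p * p)) ≡
                pos 1000 * ((pos 4096 * y - pos 4095 * p) * (pos 4096 * y + pos 4095 * p)) + pos 8578025 * (y * y)
  near-square p y = trans (distrib-minus (pos 4095 * pos 4095) (pos 1001) (y * y) (pos 1000 * (p * p)))
    (trans (cong (λ c → c * (y * y) - pos 4095 * pos 4095 * (pos 1000 * (p * p))) constant₂)
      (near-square-identity (pos 4095) (pos 1000) (pos 4096) (pos 8578025) p y))

  slack-contradiction : ∀ q A D P t y → 0ℤ < q → 0ℤ < q - 1ℤ → 0ℤ < A → 0ℤ < D → 0ℤ < P → 0ℤ ≤ t → 0ℤ < y →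
    pos 4095 * (t * P) ≤ pos 4096 * y → Slack q A D t →
    ¬ ((pos 6 * q + pos 8) * ((q - 1ℤ) * A * (y * y)) ≤
       t * ((pos 6 * q + pos 8) * (D * (y * y)) + ((pos 5 * q + pos 9) * ((q - 1ℤ) * A) + pos 3 * ((q - 1ℤ) * D)) * (P * y)
        + t * (pos 2 * q * (t * D * (P * P)))))
  slack-contradiction q A D P t y 0<q 0<q-1 0<A 0<D 0<P 0≤t 0<y near slack bound =
    ℤ.<⇒≱ slack (subst ((q - 1ℤ) * A * (pos 995 * q - pos 1009) ≤_) (sym (slack-shape q D t))
      (ℤ.0≤i-j⇒j≤i (*-cancelˡ 0<yy (subst₂ _≤_ (sym (zeroʳ (y * y))) (sym (slack-identity q ((q - 1ℤ) * A) D ((q - 1ℤ) * D) P t y))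
        (0≤sum (0≤sum (0≤prod {pos 1000} 0≤pos (0≤diff bound)) (0≤prod 0≤c lin)) (0≤prod (0≤prod (0≤prod {pos 2} 0≤pos (<⇒0≤ 0<q)) (0≤prod 0≤t (<⇒0≤ 0<D))) quad))))))
    where
    p : ℤ
    p = t * P
    0<yy : 0ℤ < y * y
    0<yy = 0<prod 0<y 0<y
    0≤c : 0ℤ ≤ (pos 5 * q + pos 9) * ((q - 1ℤ) * A) + pos 3 * ((q - 1ℤ) * D)
    0≤c = 0≤sum (0≤prod (0≤sum (0≤prod {pos 5} 0≤pos (<⇒0≤ 0<q)) 0≤pos) (0≤prod (<⇒0≤ 0<q-1) (<⇒0≤ 0<A)))
            (0≤prod {pos 3} 0≤pos (0≤prod (<⇒0≤ 0<q-1) (<⇒0≤ 0<D)))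
    lin : 0ℤ ≤ pos 1001 * (y * y) - pos 1000 * (p * y)
    lin = *-cancelˡ {pos 4095} (+<+ (s≤s z≤n)) (subst₂ _≤_ (sym (zeroʳ (pos 4095))) (sym (near-linear p y))
      (0≤sum (0≤prod (<⇒0≤ 0<y) (0≤prod {pos 1000} 0≤pos (0≤diff near))) (0≤prod {pos 3095} 0≤pos (<⇒0≤ 0<yy))))
    quad : 0ℤ ≤ pos 1001 * (y * y) - pos 1000 * (p * p)
    quad = *-cancelˡ {pos 4095 * pos 4095} (0<prod {pos 4095} {pos 4095} (+<+ (s≤s z≤n)) (+<+ (s≤s z≤n)))
      (subst₂ _≤_ (sym (zeroʳ (pos 4095 * pos 4095))) (sym (near-square p y))
        (0≤sum (0≤prod {pos 1000} 0≤pos (0≤prod (0≤diff near) (0≤sum (0≤prod {pos 4096} 0≤pos (<⇒0≤ 0<y)) (0≤prod {pos 4095} 0≤pos (0≤prod 0≤t (<⇒0≤ 0<P))))))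
          (0≤prod {pos 8578025} 0≤pos (<⇒0≤ 0<yy))))

  module Colour (𝔽 : FiniteField) (V : Linear.VSpace 𝔽) (k′ : ℕ) where
    open Linear 𝔽
    open VS V
    open Moments 𝔽 V k′
    open Energy 𝔽 V k′
    open Pairs 𝔽 V k′
    open Triples 𝔽 V k′
    open Stability 𝔽 V k′
    open Greedy 𝔽 V k′
    open Peel 𝔽 V k′
    open Span 𝔽 V k′

    HeavyPoint HeavySpan : ℤ → (M → Bool) → Set
    HeavyPoint t Y = ∃ λ v → ¬ v ≡ 𝟎 × t * D * P < a * deg Y v
    HeavySpan t Y = ∃ λ b → ∃ λ e → one b e ≡ true × t * P < (q - 1ℤ) * over Y (λ e′ → χ (shareᴷ b e e′))

    private
      <?-true : ∀ {x y} → does (x ℤ.<? y) ≡ true → x < y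
      <?-true {x} {y} p with x ℤ.<? y
      ... | yes r = r
      <?-true () | no _

      <?-false : ∀ {x y} → does (x ℤ.<? y) ≡ false → y ≤ x
      <?-false {x} {y} p with x ℤ.<? y
      ... | no r = ℤ.≮⇒≥ r
      <?-false () | yes _

    light-or-heavy : ∀ t Y → Light t Y ⊎ (HeavyPoint t Y ⊎ HeavySpan t Y)
    light-or-heavy t Y with find (λ v → nz v ∧ does (t * D * P ℤ.<? a * deg Y v))
    ... | inj₁ (v , p) = inj₂ (inj₁ (v , nz-elim {v} (∧-elimˡ p) , <?-true (∧-elimʳ {nz v} p)))
    ... | inj₂ h with find (λ (be : M × M) → one (proj₁ be) (proj₂ be) ∧ does (t * P ℤ.<? (q - 1ℤ) * over Y (λ e′ → χ (shareᴷ (proj₁ be) (proj₂ be) e′))))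
    ...   | inj₁ ((b , e) , p) = inj₂ (inj₂ (b , e , ∧-elimˡ p , <?-true (∧-elimʳ {one b e} p)))
    ...   | inj₂ h′ = inj₁ ((λ v v≢0 → <?-false (second (nz-intro {v} v≢0) (h v))) , (λ b e _ _ p → <?-false (second p (h′ (b , e)))))
      where
      second : ∀ {x y} → x ≡ true → x ∧ y ≡ false → y ≡ false
      second refl p = p

    -- Colours are natural numbers below `t`, so that a further class simply receives the colour
    -- `t`.
    Colouring : ℕ → (M → Bool) → Set
    Colouring t Y = Σ (M → ℕ) λ col → (∀ b → Y b ≡ true → col b ℕ.< t) ×
                    (∀ b e → Y b ≡ true → Y e ≡ true → col b ≡ col e → meet b e ≡ true)

    add-colour : ∀ t Y Z → (∀ b e → (Y ∩ Z) b ≡ true → (Y ∩ Z) e ≡ true → meet b e ≡ true) →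
                 Colouring t (Y ∖ Z) → Colouring (suc t) Y
    add-colour t Y Z centred (col , small , proper) = col′ , small′ , proper′
      where
      col′ : M → ℕ
      col′ b = if Z b then t else col b
      small′ : ∀ b → Y b ≡ true → col′ b ℕ.< suc t
      small′ b Yb with bool-cases (Z b)
      ... | inj₁ z = subst (λ s → (if s then t else col b) ℕ.< suc t) (sym z) ℕ.≤-refl
      ... | inj₂ z = subst (λ s → (if s then t else col b) ℕ.< suc t) (sym z) (ℕ.m<n⇒m<1+n (small b (∧-intro Yb (not-intro z))))
      old : ∀ b → Z b ≡ false → col′ b ≡ col b
      old b z = cong (λ s → if s then t else col b) z
      new : ∀ b → Z b ≡ true → col′ b ≡ t
      new b z = cong (λ s → if s then t else col b) z
      proper′ : ∀ b e → Y b ≡ true → Y e ≡ true → col′ b ≡ col′ e → meet b e ≡ true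
      proper′ b e Yb Ye eq with bool-cases (Z b) | bool-cases (Z e)
      ... | inj₁ z | inj₁ z′ = centred b e (∧-intro Yb z) (∧-intro Ye z′)
      ... | inj₂ z | inj₂ z′ = proper b e (∧-intro Yb (not-intro z)) (∧-intro Ye (not-intro z′)) (trans (sym (old b z)) (trans eq (old e z′)))
      ... | inj₁ z | inj₂ z′ = ⊥-elim (ℕ.<-irrefl (trans (sym (old e z′)) (trans (sym eq) (new b z))) (small e (∧-intro Ye (not-intro z′))))
      ... | inj₂ z | inj₁ z′ = ⊥-elim (ℕ.<-irrefl (trans (sym (old b z)) (trans eq (new e z′))) (small b (∧-intro Yb (not-intro z))))

    -- `Δ` stays fixed through the induction: a centre holds at most `P` tuples, so the size remains
    -- at least t P - Δ when `t` drops by one. The slack for `s` implies that for every smaller `t`.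
    module _ (D≤A : D ≤ A) (s : ℕ) (slack : Slack q A D (pos s)) (Δ : ℤ) (Δ-small : pos 4096 * Δ ≤ P) where

      private
        slack-≤ : ∀ {t} → t ℕ.≤ s → Slack q A D (pos t)
        slack-≤ {t} t≤s = ℤ.≤-<-trans (*-monoˡ (<⇒0≤ 0<D) (ℤ.+-monoˡ-≤ (pos 3003 * (q - 1ℤ))
          (*-monoʳ (0≤sum (0≤prod {pos 8002} 0≤pos (<⇒0≤ 0<q)) 0≤pos) (+≤+ t≤s)))) slack

        -- Since 4096 Δ ≤ P ≤ (t + 1) P, the deficit is at most the fraction 1/4096 of (t + 1) P.
        near : ∀ t y → pos (suc t) * P ≤ y + Δ → pos 4095 * (pos (suc t) * P) ≤ pos 4096 * y
        near t y le = ≤-by (0≤sum (0≤sum (0≤prod {pos 4096} 0≤pos (0≤diff le)) (0≤diff Δ-small)) (0≤prod {pos t} 0≤pos (<⇒0≤ 0<P))) (ar (pos t) P y Δ)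
          where
          opaque
            unfolding _*_
            ar′ : ∀ m t P y d → (1ℤ + m) * y - m * ((1ℤ + t) * P) ≡ (1ℤ + m) * (y + d - (1ℤ + t) * P) + (P - (1ℤ + m) * d) + t * P
            ar′ = solve-∀ ring
            ar : ∀ t P y d → pos 4096 * y - pos 4095 * ((1ℤ + t) * P) ≡ pos 4096 * (y + d - (1ℤ + t) * P) + (P - pos 4096 * d) + t * P
            ar = ar′ (pos 4095)

        not-light : ∀ t Y → suc t ℕ.≤ s → Injective Y → MatchingBound (suc t) Y → pos (suc t) * P ≤ size Y + Δ → ¬ Light (pos (suc t)) Y
        not-light t Y t≤s Y-inj em le light = slack-contradiction q A D P (pos (suc t)) (size Y) 0<q 0<q-1 0<A 0<D 0<P 0≤pos 0<y
            (near t (size Y) le) (slack-≤ t≤s) (light-bound (suc t) Y Y-inj em light)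
          where
          0<y : 0ℤ < size Y
          0<y = ℤ.≰⇒> (λ y≤0 → ℤ.<⇒≱ (0<prod {pos 4095} (+<+ (s≤s z≤n)) (0<prod {pos (suc t)} (+<+ (s≤s z≤n)) 0<P))
            (ℤ.≤-trans (near t (size Y) le) (subst (pos 4096 * size Y ≤_) (zeroʳ (pos 4096)) (*-monoˡ {pos 4096} 0≤pos y≤0))))

        remaining : ∀ t Y Z → size (Y ∩ Z) ≤ P → pos (suc t) * P ≤ size Y + Δ → pos t * P ≤ size (Y ∖ Z) + Δ
        remaining t Y Z le large = ≤-by (0≤sum (0≤diff large) (0≤diff le))
            (trans (ar (pos t) P (size (Y ∩ Z)) (size (Y ∖ Z)) Δ) (cong (λ y → (y + Δ - (1ℤ + pos t) * P) + (P - size (Y ∩ Z))) (sym size-split)))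
          where
          opaque
            unfolding _*_
            ar : ∀ t P x y d → y + d - t * P ≡ ((x + y) + d - (1ℤ + t) * P) + (P - x)
            ar = solve-∀ ring
          size-split : size Y ≡ size (Y ∩ Z) + size (Y ∖ Z)
          size-split = trans (sym (over-1 Y)) (trans (over-split Y Z (λ _ → 1ℤ)) (cong₂ _+_ (over-1 (Y ∩ Z)) (over-1 (Y ∖ Z))))

      colouring : ∀ t Y → t ℕ.≤ s → Injective Y → MatchingBound t Y → pos t * P ≤ size Y + Δ → Colouring t Y
      colouring zero Y _ Y-inj em _ = (λ _ → 0) , (λ b Yb → ⊥-elim (empty b Yb)) , (λ b _ Yb → ⊥-elim (empty b Yb))
        where
        empty : ∀ b → Y b ≡ true → ⊥
        empty b Yb with em (b ∷ []) (Yb ∷ []) ([] ∷ [])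
        ... | ()
      colouring (suc t) Y t≤s Y-inj em large with light-or-heavy (pos (suc t)) Y
      ... | inj₁ light = ⊥-elim (not-light t Y t≤s Y-inj em large light)
      ... | inj₂ (inj₁ (v , v≢0 , heavy)) = add-colour t Y Z (λ b e p r → through-meet v v≢0 b e (∧-elimʳ {Y b} p) (∧-elimʳ {Y e} r))
          (colouring t (Y ∖ Z) (ℕ.<⇒≤ t≤s) (λ b p → Y-inj b (∧-elimˡ p))
            (peel t Y Z a (D * P) Y-inj em (<⇒0≤ 0<a) (0≤prod (<⇒0≤ 0<D) (<⇒0≤ 0<P))
              (λ x Yx Zx → few-through v v≢0 Y x (Y-inj x Yx) Zx)
              (ℤ.<-≤-trans (subst (_< a * deg Y v) (*-assoc (pos (suc t)) D P) heavy) (*-monoˡ (<⇒0≤ 0<a) (deg≤through v v≢0 Y Y-inj))))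
            (remaining t Y Z (through-size v v≢0 Y) large))
        where
        Z : M → Bool
        Z = through v v≢0
      ... | inj₂ (inj₂ (b₀ , e₀ , p₀ , heavy)) = add-colour t Y Z
          (λ b e p r → lies-meet S (span₂-closed b₀ e₀) D≤A S-size b e (Y-inj b (∧-elimˡ p)) (Y-inj e (∧-elimˡ r)) (∧-elimʳ {Y b} p) (∧-elimʳ {Y e} r))
          (colouring t (Y ∖ Z) (ℕ.<⇒≤ t≤s) (λ b p → Y-inj b (∧-elimˡ p))
            (peel t Y Z (q - 1ℤ) P Y-inj em 0≤q-1 (<⇒0≤ 0<P)
              (λ x Yx Zx → few-lying S (span₂-closed b₀ e₀) D≤A S-size Y x (Y-inj x Yx) Zx)
              -- `shareᴷ b₀ e₀` is by definition `lies` for this `S`, so the heaviness of the span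
              -- already speaks of the size of Y ∩ Z.
              (subst (λ z → pos (suc t) * P < (q - 1ℤ) * z) (sum-cong (λ b → sym (χ-∧ (Y b) (Z b)))) heavy))
            (remaining t Y Z (lying-size S (span₂-closed b₀ e₀) D≤A S-size Y Y-inj) large))
        where
        S : Carrier → Bool
        S = span₂ b₀ e₀
        S-size : q * (∑[ v ] χ (S v)) ≤ D
        S-size = card-span₂ b₀ e₀ (∧-elimˡ p₀)
        Z : M → Bool
        Z = lies S (span₂-closed b₀ e₀) D≤A S-size

  -- The numerical inequality between q, s, A and D

  module SlackEstimate where
    private
      -- In these terms `Slack` for t = s reads D (s u + v) < A w.
      u v w : ℤ → ℤ
      u q = pos 8002 * q + pos 8000
      v q = pos 3003 * (q - 1ℤ)
      w q = (q - 1ℤ) * (pos 995 * q - pos 1009)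

      opaque
        unfolding _*_

        -- The range q = 2, ..., 16 is decided by evaluation. The left side is cubic in q and the
        -- right side quadratic, so large q call for a different estimate.
        small-case : ∀ (i : Fin 15) → let q = pos (2 ℕ.+ toℕ i) in q * q * (u q + v q) < pos 512 * w q
        small-case = toWitness {a? = Fin.all? λ i → let q = pos (2 ℕ.+ toℕ i) in (q * q * (u q + v q)) ℤ.<? (pos 512 * w q)} _

        -- Taylor expansion at q = h. For h = 17 the coefficients of x² and x are nonnegative and
        -- the constant term is positive.
        large-expand : ∀ r h m n u₁ u₀ v₁ x →
          r * ((h + x - 1ℤ) * (m * (h + x) - n)) - ((h + x) * (u₁ * (h + x) + u₀) + r * (v₁ * (h + x - 1ℤ))) ≡
          (r * m - u₁) * (x * x) + (r * (m * (h + h - 1ℤ) - n - v₁) - (h + h) * u₁ - u₀) * x +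
          (r * ((h - 1ℤ) * (m * h - n)) - (h * (u₁ * h + u₀) + r * (v₁ * (h - 1ℤ))))
        large-expand = solve-∀ ring

        large-coefficient₂ : 0ℤ ≤ pos 16 * pos 995 - pos 8002
        large-coefficient₂ = +≤+ z≤n

        large-coefficient₁ : 0ℤ ≤ pos 16 * (pos 995 * (pos 17 + pos 17 - 1ℤ) - pos 1009 - pos 3003) - (pos 17 + pos 17) * pos 8002 - pos 8000
        large-coefficient₁ = +≤+ z≤n

        large-coefficient₀ : 0ℤ < pos 16 * ((pos 17 - 1ℤ) * (pos 995 * pos 17 - pos 1009)) - (pos 17 * (pos 8002 * pos 17 + pos 8000) + pos 16 * (pos 3003 * (pos 17 - 1ℤ)))
        large-coefficient₀ = +<+ (s≤s z≤n)

      large-case : ∀ x → let q = pos (17 ℕ.+ x) in q * u q + pos 16 * v q < pos 16 * w q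
      large-case x = ℤ.≰⇒> (λ le → ℤ.<⇒≱ positive (subst (_≤ 0ℤ) (large-expand (pos 16) (pos 17) (pos 995) (pos 1009) (pos 8002) (pos 8000) (pos 3003) (pos x)) (ℤ.i≤j⇒i-j≤0 le)))
        where
        positive : 0ℤ < (pos 16 * pos 995 - pos 8002) * (pos x * pos x) + (pos 16 * (pos 995 * (pos 17 + pos 17 - 1ℤ) - pos 1009 - pos 3003) - (pos 17 + pos 17) * pos 8002 - pos 8000) * pos x +
          (pos 16 * ((pos 17 - 1ℤ) * (pos 995 * pos 17 - pos 1009)) - (pos 17 * (pos 8002 * pos 17 + pos 8000) + pos 16 * (pos 3003 * (pos 17 - 1ℤ))))
        positive = ℤ.+-mono-≤-< (0≤sum (0≤prod large-coefficient₂ (0≤prod {pos x} {pos x} 0≤pos 0≤pos)) (0≤prod {y = pos x} large-coefficient₁ 0≤pos)) large-coefficient₀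

      square-cancel : ∀ x y → 0ℤ ≤ x → 0ℤ ≤ y → x * x ≤ y * y → x ≤ y
      square-cancel x y 0≤x 0≤y p with ℤ.≤-total x y
      ... | inj₁ le = le
      ... | inj₂ ge with x ℤ.≟ y
      ...   | yes eq = ℤ.≤-reflexive eq
      ...   | no neq = ⊥-elim (ℤ.<⇒≱ strict (ℤ.i≤j⇒i-j≤0 p))
        where
        opaque
          unfolding _*_
          ar : ∀ x y → x * x - y * y ≡ (x - y) * (x - y) + pos 2 * (y * (x - y))
          ar = solve-∀ ring
        y<x : 0ℤ < x - y
        y<x = ℤ.≤∧≢⇒< (0≤diff ge) (λ z → neq (ℤ.i-j≡0⇒i≡j x y (sym z)))
        strict : 0ℤ < x * x - y * y
        strict = subst (0ℤ <_) (sym (ar x y)) (ℤ.+-mono-<-≤ (0<prod y<x y<x) (0≤prod {pos 2} 0≤pos (0≤prod 0≤y (<⇒0≤ y<x))))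

    -- The same bound is used in two ways. For small q it is applied as it stands, at the cost of q²
    -- but with a gain of s². For large q its square root 16 s D ≤ q A, obtained with the help of D
    -- ≤ A, is better because it costs only q.
    slack-holds : ∀ (q s : ℕ) A D → 2 ℕ.≤ q → 2 ℕ.≤ s → 0ℤ < A → 0ℤ < D → D ≤ A →
      pos 256 * (pos s * pos s) * D ≤ pos q * pos q * A → Slack (pos q) A D (pos s)
    slack-holds q s A D 2≤q 2≤s 0<A 0<D D≤A bound = by-size (q ℕ.≤? 16)
      where
      Q S m n lhs : ℤ
      Q = pos q
      S = pos s
      m = Q - 1ℤ
      n = pos 995 * Q - pos 1009
      lhs = D * (S * u Q + v Q)
      0<S : 0ℤ < S
      0<S = +<+ (ℕ.≤-trans (s≤s z≤n) 2≤s)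
      0<Q : 0ℤ < Q
      0<Q = +<+ (ℕ.≤-trans (s≤s z≤n) 2≤q)
      0≤u : 0ℤ ≤ u Q
      0≤u = 0≤sum (0≤prod {pos 8002} {Q} 0≤pos 0≤pos) 0≤pos
      0≤v : 0ℤ ≤ v Q
      0≤v = 0≤prod {pos 3003} 0≤pos (0≤diff {1ℤ} {Q} (+≤+ (ℕ.<⇒≤ 2≤q)))
      opaque
        unfolding _*_
        ar₁ : ∀ c s d u v → c * (s * s) * (d * (s * u + v)) ≡ c * (s * s) * d * (s * u + v)
        ar₁ = solve-∀ ring
        ar₂ : ∀ q a s u v → q * q * a * (s * (u + v)) ≡ a * s * (q * q * (u + v))
        ar₂ = solve-∀ ring
        ar₃ : ∀ c a s m n → c * (s * s) * (m * a * n) ≡ a * s * (c * s * (m * n))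
        ar₃ = solve-∀ ring
        ar₄ : ∀ s u v → s * (u + v) - (s * u + v) ≡ (s - 1ℤ) * v
        ar₄ = solve-∀ ring
        ar₅ : ∀ r d s u v → r * (d * (s * u + v)) ≡ r * s * d * u + d * (r * v)
        ar₅ = solve-∀ ring
        ar₆ : ∀ q a u r v → q * a * u + a * (r * v) ≡ a * (q * u + r * v)
        ar₆ = solve-∀ ring
        ar₇ : ∀ r a m n → a * (r * (m * n)) ≡ r * (m * a * n)
        ar₇ = solve-∀ ring
        ar₈ : ∀ r s d → r * s * d * (r * s * d) ≡ r * r * (s * s) * d * d
        ar₈ = solve-∀ ring
        ar₉ : ∀ q a → q * q * a * a ≡ q * a * (q * a)
        ar₉ = solve-∀ ring
        ar₀ : ∀ c s x → c * s * x ≡ s * c * x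
        ar₀ = solve-∀ ring
        const : pos 16 * pos 16 ≡ pos 256
        const = refl
        const′ : pos 2 * pos 256 ≡ pos 512
        const′ = refl
      strictly : ∀ {c x y} → 0ℤ < c → c * x < c * y → x < y
      strictly {c} {x} {y} 0<c p = ℤ.≰⇒> (λ le → ℤ.<⇒≱ p (*-monoˡ (<⇒0≤ 0<c) le))
      *-strict : ∀ {c x y} → 0ℤ < c → x < y → c * x < c * y
      *-strict 0<c p = ℤ.≰⇒> (λ le → ℤ.<⇒≱ p (*-cancelˡ 0<c le))
      by-size : Dec (q ℕ.≤ 16) → lhs < m * A * n
      by-size (yes q≤16) = strictly {pos 256 * (S * S)} (0<prod {pos 256} (+<+ (s≤s z≤n)) (0<prod 0<S 0<S)) (begin-strict
        pos 256 * (S * S) * (D * (S * u Q + v Q))     ≡⟨ ar₁ (pos 256) S D (u Q) (v Q) ⟩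
        pos 256 * (S * S) * D * (S * u Q + v Q)       ≤⟨ *-monoʳ (0≤sum (0≤prod (<⇒0≤ 0<S) 0≤u) 0≤v) bound ⟩
        Q * Q * A * (S * u Q + v Q)                   ≤⟨ *-monoˡ (0≤prod (0≤prod (<⇒0≤ 0<Q) (<⇒0≤ 0<Q)) (<⇒0≤ 0<A)) (≤-by (0≤prod (0≤diff {1ℤ} {S} (+≤+ (ℕ.<⇒≤ 2≤s))) 0≤v) (ar₄ S (u Q) (v Q))) ⟩
        Q * Q * A * (S * (u Q + v Q))                 ≡⟨ ar₂ Q A S (u Q) (v Q) ⟩
        A * S * (Q * Q * (u Q + v Q))                 <⟨ *-strict (0<prod 0<A 0<S) numeric ⟩
        A * S * (pos 512 * w Q)                       ≤⟨ *-monoˡ (<⇒0≤ (0<prod 0<A 0<S)) doubled ⟩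
        A * S * (pos 256 * S * (m * n))               ≡⟨ sym (ar₃ (pos 256) A S m n) ⟩
        pos 256 * (S * S) * (m * A * n)               ∎)
        where
        open ℤ.≤-Reasoning
        numeric : Q * Q * (u Q + v Q) < pos 512 * w Q
        numeric = subst (λ n → pos n * pos n * (u (pos n) + v (pos n)) < pos 512 * w (pos n))
          (trans (cong (2 ℕ.+_) (Fin.toℕ-fromℕ< (ℕ.s≤s (ℕ.∸-monoˡ-≤ 2 q≤16)))) (ℕ.m+[n∸m]≡n 2≤q))
          (small-case (fromℕ< (ℕ.s≤s (ℕ.∸-monoˡ-≤ 2 q≤16))))
        0≤w : 0ℤ ≤ w Q
        0≤w = *-cancelˡ {pos 512} (+<+ (s≤s z≤n)) (subst (_≤ pos 512 * w Q) (sym (zeroʳ (pos 512)))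
          (ℤ.≤-trans (0≤prod (0≤prod (<⇒0≤ 0<Q) (<⇒0≤ 0<Q)) (0≤sum 0≤u 0≤v)) (ℤ.<⇒≤ numeric)))
        -- 512 = 2 · 256, where the factor 2 comes from s ≥ 2.
        doubled : pos 512 * w Q ≤ pos 256 * S * (m * n)
        doubled = subst₂ _≤_ (cong (_* w Q) const′) (sym (ar₀ (pos 256) S (m * n)))
          (*-monoʳ 0≤w (*-monoʳ {pos 256} {pos 2} {S} 0≤pos (+≤+ 2≤s)))
      by-size (no q≰16) = strictly {pos 16} (+<+ (s≤s z≤n)) (begin-strict
        pos 16 * (D * (S * u Q + v Q))              ≡⟨ ar₅ (pos 16) D S (u Q) (v Q) ⟩
        pos 16 * S * D * u Q + D * (pos 16 * v Q)   ≤⟨ ℤ.+-mono-≤ (*-monoʳ 0≤u sD≤) (*-monoʳ (0≤prod {pos 16} 0≤pos 0≤v) D≤A) ⟩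
        Q * A * u Q + A * (pos 16 * v Q)            ≡⟨ ar₆ Q A (u Q) (pos 16) (v Q) ⟩
        A * (Q * u Q + pos 16 * v Q)                <⟨ *-strict 0<A numeric ⟩
        A * (pos 16 * w Q)                          ≡⟨ ar₇ (pos 16) A m n ⟩
        pos 16 * (m * A * n)                        ∎)
        where
        open ℤ.≤-Reasoning
        numeric : Q * u Q + pos 16 * v Q < pos 16 * w Q
        numeric = subst (λ n → pos n * u (pos n) + pos 16 * v (pos n) < pos 16 * w (pos n)) (ℕ.m+[n∸m]≡n (ℕ.≰⇒> q≰16)) (large-case (q ℕ.∸ 17))
        sD≤ : pos 16 * S * D ≤ Q * A
        sD≤ = square-cancel (pos 16 * S * D) (Q * A) (0≤prod (0≤prod {pos 16} 0≤pos (<⇒0≤ 0<S)) (<⇒0≤ 0<D)) (0≤prod (<⇒0≤ 0<Q) (<⇒0≤ 0<A)) (begin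
          pos 16 * S * D * (pos 16 * S * D)           ≡⟨ trans (ar₈ (pos 16) S D) (cong (λ c → c * (S * S) * D * D) const) ⟩
          pos 256 * (S * S) * D * D                   ≤⟨ *-monoʳ (<⇒0≤ 0<D) bound ⟩
          Q * Q * A * D                               ≤⟨ *-monoˡ (0≤prod (0≤prod (<⇒0≤ 0<Q) (<⇒0≤ 0<Q)) (<⇒0≤ 0<A)) D≤A ⟩
          Q * Q * A * A                               ≡⟨ ar₉ Q A ⟩
          Q * A * (Q * A)                             ∎)

  -- The union of s pencils and the number of bases of a k-space

  module Lower (𝔽 : FiniteField) (V : Linear.VSpace 𝔽) (k′ : ℕ) where
    open Linear 𝔽
    open VS V
    open Moments 𝔽 V k′
    open Energy 𝔽 V k′
    open Pairs 𝔽 V k′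
    open Greedy 𝔽 V k′
    open Incidence 𝔽 V k′

    injective : M → Bool
    injective b = not (ex λ u → U.nz u ∧ (b ⟨ u ⟩ == 𝟎))

    injective-elim : ∀ b → injective b ≡ true → Inj b
    injective-elim b p u bu≡0 with u ≟ U.𝟎
    ... | yes r = r
    ... | no r = true≢false (ex-intro (λ u → U.nz u ∧ (b ⟨ u ⟩ == 𝟎)) u (∧-intro (U.nz-intro {u} r) (≡⇒== bu≡0))) (not-elim p)

    injective-intro : ∀ b → Inj b → injective b ≡ true
    injective-intro b h = not-intro (≢true⇒false (λ p → let u , r = ex-elim (λ u → U.nz u ∧ (b ⟨ u ⟩ == 𝟎)) p in
      U.nz-elim {u} (∧-elimˡ r) (h u (==⇒≡ (∧-elimʳ {U.nz u} r)))))

    pencil : Carrier → M → Bool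
    pencil v b = injective b ∧ (v ∈im b)

    module _ (v : Carrier) (v≢0 : ¬ v ≡ 𝟎) where
      private
        -- A noninjective b through v kills a vector independent of the preimage of v.
        pencil-point : ∀ b → single v b ≤ χ (pencil v b) + both v 𝟎 b
        pencil-point b with bool-cases (injective b)
        ... | inj₁ p = ℤ.≤-trans (ℤ.≤-trans (subst (_≤ χ (v ∈im b)) (sum-cong (λ u → χ-∧ (U.nz u) (b ⟨ u ⟩ == v)))
                (at-most-one (λ u → U.nz u ∧ (b ⟨ u ⟩ == v)) (v ∈im b) (λ u r → ∈im-intro b u (==⇒≡ (∧-elimʳ {U.nz u} r)))
                  (λ u u′ r r′ → Inj⇒≡ b (injective-elim b p) u u′ (trans (==⇒≡ (∧-elimʳ {U.nz u} r)) (sym (==⇒≡ (∧-elimʳ {U.nz u′} r′)))))))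
                (ℤ.≤-reflexive (cong (λ s → χ (s ∧ (v ∈im b))) (sym p))))
              (subst (_≤ χ (pencil v b) + both v 𝟎 b) (ℤ.+-identityʳ (χ (pencil v b))) (ℤ.+-monoʳ-≤ (χ (pencil v b)) (0≤both v 𝟎 b)))
        ... | inj₂ n = kills (ex-elim (λ u → U.nz u ∧ (b ⟨ u ⟩ == 𝟎)) (unnot (ex λ u → U.nz u ∧ (b ⟨ u ⟩ == 𝟎)) n))
          where
          unnot : ∀ s → not s ≡ false → s ≡ true
          unnot true _ = refl
          kills : (∃ λ u → U.nz u ∧ (b ⟨ u ⟩ == 𝟎) ≡ true) → single v b ≤ χ (pencil v b) + both v 𝟎 b
          kills (u₀ , r) = ℤ.≤-trans (over-mono U.nz {w = λ u → χ (b ⟨ u ⟩ == v)} {w′ = λ u → ∑[ u′ ] joint v 𝟎 u u′ b} (λ u p → le u (bool-cases (b ⟨ u ⟩ == v))))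
            (subst (_≤ χ (pencil v b) + both v 𝟎 b) (ℤ.+-identityˡ (both v 𝟎 b)) (ℤ.+-monoˡ-≤ (both v 𝟎 b) (0≤χ (pencil v b))))
            where
            u₀≢0 : ¬ u₀ ≡ U.𝟎
            u₀≢0 = U.nz-elim {u₀} (∧-elimˡ r)
            bu₀ : b ⟨ u₀ ⟩ ≡ 𝟎
            bu₀ = ==⇒≡ (∧-elimʳ {U.nz u₀} r)
            le : ∀ u → (b ⟨ u ⟩ == v) ≡ true ⊎ (b ⟨ u ⟩ == v) ≡ false → χ (b ⟨ u ⟩ == v) ≤ (∑[ u′ ] joint v 𝟎 u u′ b)
            le u (inj₂ z) = ℤ.≤-trans (ℤ.≤-reflexive (cong χ z)) (sum-nonneg (λ u′ → 0≤joint v 𝟎 u u′ b))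
            le u (inj₁ y) = ℤ.≤-trans (χ≤1 (b ⟨ u ⟩ == v)) (ℤ.≤-trans (ℤ.≤-reflexive (sym (joint-one v 𝟎 u u₀ b ind (==⇒≡ y) bu₀)))
                (single≤ (λ u′ → joint v 𝟎 u u′ b) (λ u′ → 0≤joint v 𝟎 u u′ b) u₀))
              where
              ind : U.mult u u₀ ≡ false
              ind = ≢true⇒false (λ m → contra (U.mult-elim {u} {u₀} m))
                where
                contra : (∃ λ c → u₀ ≡ c U.· u) → ⊥
                contra (c , eq) = scale-nonzero {c} (λ c≡0 → u₀≢0 (trans eq (trans (cong (U._· u) c≡0) (U.·-zeroˡ u)))) v≢0
                  (trans (cong (c ·_) (sym (==⇒≡ y))) (trans (sym (app-·ʳ V b c u)) (trans (cong (b ⟨_⟩) (sym eq)) bu₀)))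

      -- `single` sums to `P` over all tuples; the noninjective ones among them are charged to
      -- `both v 𝟎`, whose sum is at most C P / A.
      pencil-size : A * P - C * P ≤ A * size (pencil v)
      pencil-size = ≤-by (0≤sum (0≤prod (<⇒0≤ 0<A) (0≤diff total)) (0≤diff (sum-both v 𝟎))) (ar A P C (size (pencil v)) (∑[ b ] both v 𝟎 b))
        where
        opaque
          unfolding _*_
          ar : ∀ a p c s t → a * s - (a * p - c * p) ≡ a * (s + t - p) + (c * p - a * t)
          ar = solve-∀ ring
        total : P ≤ size (pencil v) + (∑[ b ] both v 𝟎 b)
        total = subst₂ _≤_ (sum-single v) (sum-+ (λ b → χ (pencil v b)) (both v 𝟎)) (sum-mono pencil-point)

      pencil-pair : ∀ v′ → mult v v′ ≡ false → A * size (λ b → pencil v b ∧ pencil v′ b) ≤ C * P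
      pencil-pair v′ ind = ℤ.≤-trans (*-monoˡ (<⇒0≤ 0<A) (sum-mono le)) (sum-both v v′)
        where
        le : ∀ b → χ (pencil v b ∧ pencil v′ b) ≤ both v v′ b
        le b with bool-cases (pencil v b ∧ pencil v′ b)
        ... | inj₂ n = ℤ.≤-trans (ℤ.≤-reflexive (cong χ n)) (0≤both v v′ b)
        ... | inj₁ p with ∈im-elim b (∧-elimʳ {injective b} (∧-elimˡ p)) | ∈im-elim b (∧-elimʳ {injective b} (∧-elimʳ {pencil v b} p))
        ...   | u , r | u′ , r′ = ℤ.≤-trans (χ≤1 (pencil v b ∧ pencil v′ b)) (ℤ.≤-trans
                (ℤ.≤-reflexive (sym (joint-one v v′ u u′ b ind′ r r′))) (joint≤both v v′ u u′ b (preimage≢0 b u v≢0 r)))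
          where
          ind′ : U.mult u u′ ≡ false
          ind′ = ≢true⇒false (λ m → let c , eq = U.mult-elim {u} {u′} m in
            true≢false (mult-intro {v} {v′} c (trans (sym r′) (trans (cong (b ⟨_⟩) eq) (trans (app-·ʳ V b c u) (cong (c ·_) r))))) ind)

    hits : List Carrier → M → Bool
    hits []       b = false
    hits (v ∷ vs) b = pencil v b ∨ hits vs b

    hits-elim : ∀ vs b → hits vs b ≡ true → Any (λ v → pencil v b ≡ true) vs
    hits-elim (v ∷ vs) b p with bool-cases (pencil v b)
    ... | inj₁ r = here r
    ... | inj₂ n = there (hits-elim vs b (subst (λ s → s ∨ hits vs b ≡ true) n p))

    hits-injective : ∀ vs → Injective (hits vs)
    hits-injective vs b p = go vs (hits-elim vs b p)
      where
      go : ∀ vs → Any (λ v → pencil v b ≡ true) vs → Inj b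
      go (v ∷ vs) (here r)  = injective-elim b (∧-elimˡ r)
      go (v ∷ vs) (there i) = go vs i

    -- Bonferroni: each pencil falls short of `P` by at most C P / A, and two pencils share at most
    -- as much. Adding a pencil to l others costs at most 1 + l such losses, which the growth from
    -- l² to (1 + l)² covers.
    hits-size : ∀ vs → All (λ v → ¬ v ≡ 𝟎) vs → AllPairs (λ v v′ → mult v v′ ≡ false) vs →
                A * (pos (length vs) * P) - pos (length vs) * pos (length vs) * (C * P) ≤ A * size (hits vs)
    hits-size [] _ _ = ℤ.≤-reflexive (trans (ar A P C) (sym (trans (cong (A *_) (sum-zero {f = λ b → χ (hits [] b)} (λ _ → refl))) (zeroʳ A))))
      where
      opaque
        unfolding _*_
        ar : ∀ a p c → a * (0ℤ * p) - 0ℤ * 0ℤ * (c * p) ≡ 0ℤ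
        ar = solve-∀ ring
    hits-size (v ∷ vs) (v≢0 ∷ nzs) (ind ∷ ap) = ≤-by
        (0≤sum (0≤sum (0≤sum (0≤sum (0≤prod (<⇒0≤ 0<A) (0≤diff union)) (0≤diff (pencil-size v v≢0))) (0≤diff (hits-size vs nzs ap)))
          (0≤diff (shared vs ind))) (0≤prod {pos (length vs)} 0≤pos (0≤prod (<⇒0≤ 0<C) (<⇒0≤ 0<P))))
        (ar A P C (pos (length vs)) (size (hits (v ∷ vs))) (size (pencil v)) (size (hits vs)) (size (λ b → pencil v b ∧ hits vs b)))
      where
      opaque
        unfolding _*_
        ar : ∀ a p c l h x y z → a * h - (a * ((1ℤ + l) * p) - (1ℤ + l) * (1ℤ + l) * (c * p)) ≡
             a * ((h + z) - (x + y)) + (a * x - (a * p - c * p)) + (a * y - (a * (l * p) - l * l * (c * p))) + (l * (c * p) - a * z) + l * (c * p)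
        ar = solve-∀ ring
        ar₂ : ∀ l x → x + l * x ≡ (1ℤ + l) * x
        ar₂ = solve-∀ ring
      union : size (pencil v) + size (hits vs) ≤ size (hits (v ∷ vs)) + size (λ b → pencil v b ∧ hits vs b)
      union = subst₂ _≤_ (sum-+ (λ b → χ (pencil v b)) (λ b → χ (hits vs b))) (sum-+ (λ b → χ (hits (v ∷ vs) b)) (λ b → χ (pencil v b ∧ hits vs b)))
        (sum-mono (λ b → ℤ.≤-reflexive (incl-excl (pencil v b) (hits vs b))))
        where
        incl-excl : ∀ s r → χ s + χ r ≡ χ (s ∨ r) + χ (s ∧ r)
        incl-excl true  true  = refl
        incl-excl true  false = refl
        incl-excl false true  = refl
        incl-excl false false = refl
      shared : ∀ ws → All (λ w → mult v w ≡ false) ws → A * size (λ b → pencil v b ∧ hits ws b) ≤ pos (length ws) * (C * P)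
      shared [] _ = ℤ.≤-reflexive (trans (trans (cong (A *_) (sum-zero (λ b → cong χ (f (pencil v b))))) (zeroʳ A)) (sym (zeroˡ (C * P))))
        where
        f : ∀ s → s ∧ false ≡ false
        f true  = refl
        f false = refl
      shared (w ∷ ws) (i ∷ is) = ℤ.≤-trans (*-monoˡ (<⇒0≤ 0<A) (subst (size (λ b → pencil v b ∧ hits (w ∷ ws) b) ≤_)
          (sum-+ (λ b → χ (pencil v b ∧ pencil w b)) (λ b → χ (pencil v b ∧ hits ws b))) (sum-mono (λ b → le (pencil v b) (pencil w b) (hits ws b)))))
          (subst₂ _≤_ (sym (distribˡ A (size (λ b → pencil v b ∧ pencil w b)) (size (λ b → pencil v b ∧ hits ws b)))) (ar₂ (pos (length ws)) (C * P))
            (ℤ.+-mono-≤ (pencil-pair v v≢0 w i) (shared ws is)))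
        where
        le : ∀ s r h → χ (s ∧ (r ∨ h)) ≤ χ (s ∧ r) + χ (s ∧ h)
        le true  true  h = subst (_≤ 1ℤ + χ h) (ℤ.+-identityʳ 1ℤ) (ℤ.+-monoʳ-≤ 1ℤ (0≤χ h))
        le true  false h = ℤ.≤-reflexive (sym (ℤ.+-identityˡ (χ h)))
        le false r     h = ℤ.≤-refl

  -- An initial segment of `elems` is taken; its entries are distinct because every element has
  -- total multiplicity 1.
  distinct-elements : ∀ {X : Set} {{E : Enum X}} m → pos m ≤ card X → ∃ λ (xs : List X) → length xs ≡ m × AllPairs (λ x y → ¬ x ≡ y) xs
  distinct-elements {X} {{E}} m le = List.take m es , take-length m es (ℤ.drop‿+≤+ (subst (pos m ≤_) (trans (sum-def E (λ _ → 1ℤ)) (len es)) le)) , take-pairs m es (unique es (λ a → ℤ.≤-reflexive (Enum.once E a)))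
    where
    es : List X
    es = Enum.elems E
    len : ∀ xs → ∑ {X} xs (λ _ → 1ℤ) ≡ pos (length xs)
    len []       = refl
    len (x ∷ xs) = cong (1ℤ +_) (len xs)
    take-length : ∀ m (xs : List X) → m ℕ.≤ length xs → length (List.take m xs) ≡ m
    take-length zero    xs       _       = refl
    take-length (suc m) (x ∷ xs) (s≤s p) = cong suc (take-length m xs p)
    take-all : ∀ {Q : X → Set} m xs → All Q xs → All Q (List.take m xs)
    take-all zero    xs       _       = []
    take-all (suc m) []       _       = []
    take-all (suc m) (x ∷ xs) (p ∷ r) = p ∷ take-all m xs r
    take-pairs : ∀ {R : X → X → Set} m xs → AllPairs R xs → AllPairs R (List.take m xs)
    take-pairs zero    xs       _       = []
    take-pairs (suc m) []       _       = []
    take-pairs (suc m) (x ∷ xs) (p ∷ r) = take-all m xs p ∷ take-pairs m xs r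
    0≤∑ : ∀ a (xs : List X) → 0ℤ ≤ ∑ xs (λ x → χ (x == a))
    0≤∑ a []       = ℤ.≤-refl
    0≤∑ a (x ∷ xs) = 0≤sum (0≤χ (x == a)) (0≤∑ a xs)
    absent : ∀ a xs → ∑ xs (λ x → χ (x == a)) ≤ 0ℤ → All (λ x → ¬ a ≡ x) xs
    absent a []       _ = []
    absent a (x ∷ xs) p = (λ { refl → ℤ.<⇒≱ (+<+ (s≤s z≤n)) (ℤ.≤-trans (subst (1ℤ ≤_) (cong (λ s → χ s + ∑ xs (λ x → χ (x == a))) (sym (≡⇒== {x = a} refl)))
        (ℤ.+-monoʳ-≤ 1ℤ (0≤∑ a xs))) p) }) ∷ absent a xs (ℤ.≤-trans (subst (_≤ χ (x == a) + ∑ xs (λ x → χ (x == a))) (ℤ.+-identityˡ _) (ℤ.+-monoˡ-≤ (∑ xs (λ x → χ (x == a))) (0≤χ (x == a)))) p)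
    unique : ∀ xs → (∀ a → ∑ xs (λ x → χ (x == a)) ≤ 1ℤ) → AllPairs (λ x y → ¬ x ≡ y) xs
    unique []       _ = []
    unique (x ∷ xs) h = absent x xs (cancel (subst (λ s → χ s + ∑ xs (λ y → χ (y == x)) ≤ 1ℤ) (≡⇒== {x = x} refl) (h x))) ∷
        unique xs (λ a → ℤ.≤-trans (subst (_≤ χ (x == a) + ∑ xs (λ y → χ (y == a))) (ℤ.+-identityˡ _) (ℤ.+-monoˡ-≤ (∑ xs (λ y → χ (y == a))) (0≤χ (x == a)))) (h a))
      where
      opaque
        unfolding _*_
        ar : ∀ x → 0ℤ - x ≡ 1ℤ - (1ℤ + x)
        ar = solve-∀ ring
      cancel : ∀ {x} → 1ℤ + x ≤ 1ℤ → x ≤ 0ℤ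
      cancel {x} p = ≤-by (0≤diff p) (ar x)

  opaque
    unfolding sum

    fin-elems : ∀ n → List (Fin n)
    fin-elems zero    = []
    fin-elems (suc n) = zero ∷ List.map suc (fin-elems n)

    fin-once : ∀ {n} (a : Fin n) → ∑ (fin-elems n) (λ x → χ (does (x Fin.≟ a))) ≡ 1ℤ
    fin-once {suc n} zero = cong (1ℤ +_) (trans (∑-map suc (fin-elems n) (λ x → χ (does (x Fin.≟ zero)))) (∑-zero (fin-elems n)))
    fin-once {suc n} (suc a) = trans (ℤ.+-identityˡ _) (trans (∑-map suc (fin-elems n) (λ x → χ (does (x Fin.≟ suc a))))
      (trans (∑-cong (fin-elems n) (λ x → cong χ (pt x))) (fin-once a)))
      where
      pt : ∀ x → does (suc x Fin.≟ suc a) ≡ does (x Fin.≟ a)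
      pt x with x Fin.≟ a
      ... | yes _ = refl
      ... | no _ = refl

  instance
    enum-Fin : ∀ {n} → Enum (Fin n)
    enum-Fin {n} = record { elems = fin-elems n ; _≟_ = Fin._≟_ ; once = fin-once }

  opaque
    unfolding sum fin-elems

    card-Fin : ∀ n → card (Fin n) ≡ pos n
    card-Fin zero    = refl
    card-Fin (suc n) = cong (1ℤ +_) (trans (∑-map suc (fin-elems n) (λ _ → 1ℤ)) (card-Fin n))

  module Bases (𝔽 : FiniteField) (V : Linear.VSpace 𝔽) (k′ : ℕ) where
    open Linear 𝔽
    open VS V
    open Moments 𝔽 V k′
    open Energy 𝔽 V k′
    open Pairs 𝔽 V k′
    open Incidence 𝔽 V k′
    open Lower 𝔽 V k′
    private
      module Lᵁ = Lower 𝔽 (Pow 𝕂 k) k′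

    sub : M → M → Bool
    sub b b₀ = not (ex λ u → not (b ⟨ u ⟩ ∈im b₀))

    sub-elim : ∀ b b₀ → sub b b₀ ≡ true → ∀ u → (b ⟨ u ⟩ ∈im b₀) ≡ true
    sub-elim b b₀ p u with bool-cases (b ⟨ u ⟩ ∈im b₀)
    ... | inj₁ s = s
    ... | inj₂ n = true≢false (ex-intro (λ u → not (b ⟨ u ⟩ ∈im b₀)) u (not-intro n)) (not-elim p)

    sub-intro : ∀ b b₀ → (∀ u → (b ⟨ u ⟩ ∈im b₀) ≡ true) → sub b b₀ ≡ true
    sub-intro b b₀ h = not-intro (≢true⇒false (λ p → let u , n = ex-elim (λ u → not (b ⟨ u ⟩ ∈im b₀)) p in
      true≢false (h u) (not-elim n)))

    sub-refl : ∀ b → sub b b ≡ true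
    sub-refl b = sub-intro b b (λ u → ∈im-intro b u refl)

    sub-trans : ∀ b c d → sub b c ≡ true → sub c d ≡ true → sub b d ≡ true
    sub-trans b c d p r = sub-intro b d (λ u → let w , s = ∈im-elim c (sub-elim b c p u) in
      subst (λ v → (v ∈im d) ≡ true) s (sub-elim c d r w))

    private
      preimage : M → Carrier → U
      preimage b v = choose (λ u → b ⟨ u ⟩ == v) U.𝟎

      preimage-correct : ∀ b v → (v ∈im b) ≡ true → b ⟨ preimage b v ⟩ ≡ v
      preimage-correct b v p = ==⇒≡ (choose-correct (λ u → b ⟨ u ⟩ == v) U.𝟎 p)

      card-image≥ : ∀ b → Inj b → C ≤ (∑[ v ] χ (v ∈im b))
      card-image≥ b b-inj = count-inj (b ⟨_⟩) (λ _ → true) (_∈im b) (λ u _ → ∈im-intro b u refl)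
        (λ u u′ _ _ → Inj⇒≡ b b-inj u u′)

      card-image≤ : ∀ b → (∑[ v ] χ (v ∈im b)) ≤ C
      card-image≤ b = count-inj (preimage b) (_∈im b) (λ _ → true) (λ _ _ → refl)
        (λ v v′ p p′ eq → trans (sym (preimage-correct b v p)) (trans (cong (b ⟨_⟩) eq) (preimage-correct b v′ p′)))

    -- The image of an injective tuple has `C` vectors and any image at most `C`, so a vector of
    -- `b₀` outside `b` would be one too many.
    sub-sym : ∀ b b₀ → Inj b → sub b b₀ ≡ true → sub b₀ b ≡ true
    sub-sym b b₀ b-inj p = sub-intro b₀ b inside
      where
      inside : ∀ w → (b₀ ⟨ w ⟩ ∈im b) ≡ true
      inside w with bool-cases (b₀ ⟨ w ⟩ ∈im b)
      ... | inj₁ y = y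
      ... | inj₂ n = ⊥-elim (ℤ.<⇒≱ (+<+ (s≤s z≤n)) (≤-by (0≤diff (ℤ.≤-trans (ℤ.+-monoˡ-≤ 1ℤ (card-image≥ b b-inj)) (ℤ.≤-trans more (card-image≤ b₀)))) (ar C)))
        where
        opaque
          unfolding _*_
          ar : ∀ c → 0ℤ - 1ℤ ≡ c - (c + 1ℤ)
          ar = solve-∀ ring
        more : (∑[ v ] χ (v ∈im b)) + 1ℤ ≤ (∑[ v ] χ (v ∈im b₀))
        more = subst (_≤ (∑[ v ] χ (v ∈im b₀))) (trans (sum-+ (λ v → χ (v ∈im b)) (λ v → χ (v == b₀ ⟨ w ⟩))) (cong (sum (λ v → χ (v ∈im b)) +_) (sum-once (b₀ ⟨ w ⟩))))
          (sum-mono pt)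
          where
          pt : ∀ v → χ (v ∈im b) + χ (v == b₀ ⟨ w ⟩) ≤ χ (v ∈im b₀)
          pt v with bool-cases (v == b₀ ⟨ w ⟩) | bool-cases (v ∈im b)
          ... | inj₁ e | inj₁ i = true≢false (subst (λ z → (z ∈im b) ≡ true) (==⇒≡ e) i) n
          ... | inj₁ e | inj₂ i = subst₂ _≤_ (sym (cong₂ (λ x y → χ x + χ y) i e)) (sym (cong χ (∈im-intro b₀ w (sym (==⇒≡ e))))) ℤ.≤-refl
          ... | inj₂ e | inj₂ i = subst (_≤ χ (v ∈im b₀)) (sym (cong₂ (λ x y → χ x + χ y) i e)) (0≤χ (v ∈im b₀))
          ... | inj₂ e | inj₁ i with ∈im-elim b i
          ...   | u , r = subst₂ _≤_ (sym (cong₂ (λ x y → χ x + χ y) i e)) (sym (cong χ (subst (λ z → (z ∈im b₀) ≡ true) r (sub-elim b b₀ p u)))) ℤ.≤-refl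

    basisOf : M → M → Bool
    basisOf b₀ b = injective b ∧ sub b b₀

    -- The order of GL(k, q), which is the number of ordered bases of every k-space; it remains
    -- symbolic throughout.
    bases : ℤ
    bases = sum {Vec U k} (λ t → χ (Lᵁ.injective t))

    0≤bases : 0ℤ ≤ bases
    0≤bases = sum-nonneg (λ t → 0≤χ (Lᵁ.injective t))

    private
      map-inj : ∀ {X Y : Set} {n} (f : X → Y) → (∀ x x′ → f x ≡ f x′ → x ≡ x′) → (xs ys : Vec X n) → map f xs ≡ map f ys → xs ≡ ys
      map-inj f h []       []       _  = refl
      map-inj f h (x ∷ xs) (y ∷ ys) eq = cong₂ _∷_ (h x y (hd eq)) (map-inj f h xs ys (tl eq))
        where
        hd : ∀ {a b} {n} {as bs : Vec _ n} → a ∷ as ≡ b ∷ bs → a ≡ b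
        hd refl = refl
        tl : ∀ {a b} {n} {as bs : Vec _ n} → a ∷ as ≡ b ∷ bs → as ≡ bs
        tl refl = refl

      recover : ∀ {j} b₀ (b : Vec Carrier j) → (∀ u → (app V b u ∈im b₀) ≡ true) → map (b₀ ⟨_⟩) (map (preimage b₀) b) ≡ b
      recover b₀ []      h = refl
      recover {suc j} b₀ (x ∷ b) h = cong₂ _∷_
        (preimage-correct b₀ x (subst (λ v → (v ∈im b₀) ≡ true) (app-head V x b) (h (1ᵏ ∷ VS.𝟎 (Pow 𝕂 j)))))
        (recover b₀ b (λ u → subst (λ v → (v ∈im b₀) ≡ true) (app-tail V x b u) (h (0ᵏ ∷ u))))

    bases≤ : ∀ b₀ → Inj b₀ → bases ≤ size (basisOf b₀)
    bases≤ b₀ b₀-inj = count-inj (map (b₀ ⟨_⟩)) Lᵁ.injective (basisOf b₀)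
      (λ t p → ∧-intro (injective-intro (map (b₀ ⟨_⟩) t) (λ u z → Lᵁ.injective-elim t p u (b₀-inj _ (trans (sym (app-∘ V b₀ t u)) z))))
        (sub-intro (map (b₀ ⟨_⟩) t) b₀ (λ u → ∈im-intro b₀ (app (Pow 𝕂 k) t u) (sym (app-∘ V b₀ t u)))))
      (λ t t′ _ _ → map-inj (b₀ ⟨_⟩) (Inj⇒≡ b₀ b₀-inj) t t′)

    bases≥ : ∀ b₀ → size (basisOf b₀) ≤ bases
    bases≥ b₀ = count-inj (map (preimage b₀)) (basisOf b₀) Lᵁ.injective
      (λ b p → Lᵁ.injective-intro (map (preimage b₀) b) (λ u z → injective-elim b (∧-elimˡ p) u
        (trans (cong (λ c → app V c u) (sym (rec b p))) (trans (app-∘ V b₀ (map (preimage b₀) b) u) (trans (cong (b₀ ⟨_⟩) z) (app-0ʳ V b₀))))))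
      (λ b b′ p p′ eq → trans (sym (rec b p)) (trans (cong (map (b₀ ⟨_⟩)) eq) (rec b′ p′)))
      where
      rec : ∀ b → basisOf b₀ b ≡ true → map (b₀ ⟨_⟩) (map (preimage b₀) b) ≡ b
      rec b p = recover b₀ b (sub-elim b b₀ (∧-elimʳ {injective b} p))

    allBases : ∀ {N} → (Fin N → M) → M → Bool
    allBases B b = injective b ∧ (ex λ i → sub b (B i))

    -- Distinct spaces have no ordered basis in common, so each tuple is counted for at most one
    -- `i`.
    allBases-size : ∀ {N} (B : Fin N → M) → (∀ i → Inj (B i)) → (∀ i j → sub (B i) (B j) ≡ true → i ≡ j) →
                    pos N * bases ≤ size (allBases B)
    allBases-size {N} B B-inj distinct = begin
      pos N * bases                             ≡⟨ sym (trans (sum-const {Fin N} bases) (cong (_* bases) (card-Fin N))) ⟩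
      sum {Fin N} (λ _ → bases)                 ≤⟨ sum-mono (λ i → bases≤ (B i) (B-inj i)) ⟩
      (∑[ i ] ∑[ b ] χ (basisOf (B i) b))       ≡⟨ sum-swap (λ i b → χ (basisOf (B i) b)) ⟩
      (∑[ b ] ∑[ i ] χ (basisOf (B i) b))       ≤⟨ sum-mono (λ b → at-most-one (λ i → basisOf (B i) b) (allBases B b)
        (λ i p → ∧-intro (∧-elimˡ p) (ex-intro (λ i → sub b (B i)) i (∧-elimʳ {injective b} p)))
        (λ i j p r → distinct i j (sub-trans (B i) b (B j) (sub-sym b (B i) (injective-elim b (∧-elimˡ p)) (∧-elimʳ {injective b} p)) (∧-elimʳ {injective b} r)))) ⟩
      size (allBases B)                         ∎
      where open ℤ.≤-Reasoning

    private
      anySub : M → List M → Bool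
      anySub x []       = false
      anySub x (r ∷ rs) = sub x r ∨ anySub x rs

      anySub-false : ∀ x rs → anySub x rs ≡ false → All (λ r → sub x r ≡ false) rs
      anySub-false x []       _ = []
      anySub-false x (r ∷ rs) p with bool-cases (sub x r)
      ... | inj₁ y = true≢false (subst (λ s → s ∨ anySub x rs ≡ true) (sym y) refl) p
      ... | inj₂ n = n ∷ anySub-false x rs (subst (λ s → s ∨ anySub x rs ≡ false) n p)

      reps : (M → Bool) → List M → List M
      reps H []       = []
      reps H (x ∷ xs) = if H x ∧ not (anySub x (reps H xs)) then x ∷ reps H xs else reps H xs

      reps-all : ∀ H xs → All (λ r → H r ≡ true) (reps H xs)
      reps-all H []       = []
      reps-all H (x ∷ xs) with bool-cases (H x ∧ not (anySub x (reps H xs)))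
      ... | inj₁ y = subst (λ s → All (λ r → H r ≡ true) (if s then x ∷ reps H xs else reps H xs)) (sym y) (∧-elimˡ y ∷ reps-all H xs)
      ... | inj₂ n = subst (λ s → All (λ r → H r ≡ true) (if s then x ∷ reps H xs else reps H xs)) (sym n) (reps-all H xs)

      reps-pairs : ∀ H xs → AllPairs (λ x r → sub x r ≡ false) (reps H xs)
      reps-pairs H []       = []
      reps-pairs H (x ∷ xs) with bool-cases (H x ∧ not (anySub x (reps H xs)))
      ... | inj₁ y = subst (λ s → AllPairs (λ x r → sub x r ≡ false) (if s then x ∷ reps H xs else reps H xs)) (sym y)
                       (anySub-false x (reps H xs) (not-elim (∧-elimʳ {H x} y)) ∷ reps-pairs H xs)
      ... | inj₂ n = subst (λ s → AllPairs (λ x r → sub x r ≡ false) (if s then x ∷ reps H xs else reps H xs)) (sym n) (reps-pairs H xs)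

      anySub-here : ∀ x rs → anySub x (x ∷ rs) ≡ true
      anySub-here x rs = subst (λ s → s ∨ anySub x rs ≡ true) (sym (sub-refl x)) refl

      anySub-there : ∀ x r rs → anySub x rs ≡ true → anySub x (r ∷ rs) ≡ true
      anySub-there x r rs p with sub x r
      ... | true  = refl
      ... | false = p

      reps-cover : ∀ H xs x → x ∈ xs → H x ≡ true → anySub x (reps H xs) ≡ true
      reps-cover H (y ∷ xs) x i Hx with bool-cases (H y ∧ not (anySub y (reps H xs)))
      reps-cover H (y ∷ xs) x (here refl) Hx | inj₁ t = subst (λ s → anySub x (if s then y ∷ reps H xs else reps H xs) ≡ true) (sym t) (anySub-here x (reps H xs))
      reps-cover H (y ∷ xs) x (there i) Hx   | inj₁ t = subst (λ s → anySub x (if s then y ∷ reps H xs else reps H xs) ≡ true) (sym t) (anySub-there x y (reps H xs) (reps-cover H xs x i Hx))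
      reps-cover H (y ∷ xs) x (there i) Hx   | inj₂ f = subst (λ s → anySub x (if s then y ∷ reps H xs else reps H xs) ≡ true) (sym f) (reps-cover H xs x i Hx)
      reps-cover H (y ∷ xs) x (here refl) Hx | inj₂ f = subst (λ s → anySub x (if s then y ∷ reps H xs else reps H xs) ≡ true) (sym f) (known (anySub x (reps H xs)) (subst (λ s → s ∧ not (anySub x (reps H xs)) ≡ false) Hx f))
        where
        known : ∀ s → not s ≡ false → s ≡ true
        known true _ = refl

      count-anySub : ∀ b rs → injective b ≡ true → χ (anySub b rs) ≤ ∑ rs (λ r → χ (basisOf r b))
      count-anySub b []       _ = ℤ.≤-refl
      count-anySub b (r ∷ rs) p = ℤ.≤-trans (le (sub b r) (anySub b rs))
        (ℤ.+-mono-≤ (ℤ.≤-reflexive (cong (λ s → χ (s ∧ sub b r)) (sym p))) (count-anySub b rs p))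
        where
        le : ∀ s r → χ (s ∨ r) ≤ χ s + χ r
        le true  r = subst (_≤ 1ℤ + χ r) (ℤ.+-identityʳ 1ℤ) (ℤ.+-monoʳ-≤ 1ℤ (0≤χ r))
        le false r = ℤ.≤-reflexive (sym (ℤ.+-identityˡ (χ r)))

      lookup-pairs : ∀ (rs : List M) → All (λ r → Inj r) rs → AllPairs (λ x r → sub x r ≡ false) rs →
                     ∀ i j → sub (List.lookup rs i) (List.lookup rs j) ≡ true → i ≡ j
      lookup-pairs (r ∷ rs) (_ ∷ inj) (a ∷ ap) zero    zero    p = refl
      lookup-pairs (r ∷ rs) (_ ∷ inj) (a ∷ ap) zero    (suc j) p = true≢false p (All.lookup a (∈-lookup j))
      lookup-pairs (r ∷ rs) (_ ∷ inj) (a ∷ ap) (suc i) zero    p = true≢false (sub-sym (List.lookup rs i) r (All.lookup inj (∈-lookup i)) p) (All.lookup a (∈-lookup i))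
      lookup-pairs (r ∷ rs) (_ ∷ inj) (a ∷ ap) (suc i) (suc j) p = cong suc (lookup-pairs rs inj ap i j p)

    -- The way back from tuples to spaces: one basis of each space is kept, and every tuple of `H`
    -- is among the at most `bases` bases of a kept space. `H` may lack some of these, hence the
    -- inequality.
    representatives : ∀ H → Injective H → ∃ λ N → ∃ λ (B : Fin N → M) →
      (∀ i → H (B i) ≡ true) × (∀ i j → sub (B i) (B j) ≡ true → i ≡ j) × size H ≤ pos N * bases
    representatives H H-inj = length rs , List.lookup rs , (λ i → All.lookup (reps-all H es) (∈-lookup i)) ,
        lookup-pairs rs (All.map (λ {b} → H-inj b) (reps-all H es)) (reps-pairs H es) , bound
      where
      es rs : List M
      es = Enum.elems enum-Vec
      rs = reps H es
      cover : ∀ b → χ (H b) ≤ ∑ rs (λ r → χ (basisOf r b))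
      cover b with bool-cases (H b)
      ... | inj₂ n = ℤ.≤-trans (ℤ.≤-reflexive (cong χ n)) (0≤∑ rs)
        where
        0≤∑ : ∀ rs → 0ℤ ≤ ∑ rs (λ r → χ (basisOf r b))
        0≤∑ []       = ℤ.≤-refl
        0≤∑ (r ∷ rs) = 0≤sum (0≤χ (basisOf r b)) (0≤∑ rs)
      ... | inj₁ y = ℤ.≤-trans (χ≤1 (H b)) (ℤ.≤-trans (ℤ.≤-reflexive (sym (cong χ (reps-cover H es b (∈-elems b) y))))
                       (count-anySub b rs (injective-intro b (H-inj b y))))
      sum-∑ : ∀ ys → (∑[ b ] ∑ ys (λ r → χ (basisOf r b))) ≤ pos (length ys) * bases
      sum-∑ []       = ℤ.≤-reflexive (trans (sum-zero {f = λ b → ∑ [] (λ r → χ (basisOf r b))} (λ _ → refl)) (sym (zeroˡ bases)))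
      sum-∑ (r ∷ ys) = subst₂ _≤_ (sym (sum-+ (λ b → χ (basisOf r b)) (λ b → ∑ ys (λ r → χ (basisOf r b))))) (ar bases (pos (length ys)))
          (ℤ.+-mono-≤ (bases≥ r) (sum-∑ ys))
        where
        opaque
          unfolding _*_
          ar : ∀ g l → g + l * g ≡ (1ℤ + l) * g
          ar = solve-∀ ring
      bound : size H ≤ pos (length rs) * bases
      bound = ℤ.≤-trans (sum-mono cover) (sum-∑ rs)

open import Defs
open import Data.Integer using (ℤ; _-_; +≤+) renaming (+_ to pos; _+_ to _+ℤ_; _≤_ to _≤ℤ_)
open import Data.Nat using (_+_; _∸_; _^_; _≤_; _<_)

-- From spaces over the given field to tuples

module FieldModel {c ℓ′ : Level} (F : CommutativeRing c ℓ′) (isField : IsField F) (q : ℕ) (hasCard : HasCard F q) where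
  open Counting
  open CommutativeRing F using (Carrier; _≈_; 0#; 1#; +-cong; +-congˡ; +-congʳ; +-assoc; +-identityˡ; -‿inverseˡ)
    renaming (refl to ≈-refl; sym to ≈-sym; trans to ≈-trans)
  private
    module F = CommutativeRing F

  -- Scalars are replaced by their indices in the given enumeration, where the equality of the field
  -- becomes propositional.
  ι : Fin q → Carrier
  ι = proj₁ hasCard

  idx : Carrier → Fin q
  idx x = proj₁ (proj₁ (proj₂ hasCard) x)

  ι-idx : ∀ x → ι (idx x) ≈ x
  ι-idx x = proj₂ (proj₁ (proj₂ hasCard) x)

  ι-inj : ∀ {i j} → ι i ≈ ι j → i ≡ j
  ι-inj {i} {j} = proj₂ (proj₂ hasCard) i j

  infixl 6 _+′_
  infixl 7 _*′_
  _+′_ _*′_ : Fin q → Fin q → Fin q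
  i +′ j = idx (ι i F.+ ι j)
  i *′ j = idx (ι i F.* ι j)

  -′_ : Fin q → Fin q
  -′ i = idx (F.- ι i)

  0′ 1′ : Fin q
  0′ = idx 0#
  1′ = idx 1#

  private
    +-val : ∀ i j → ι (i +′ j) ≈ ι i F.+ ι j
    +-val i j = ι-idx _
    *-val : ∀ i j → ι (i *′ j) ≈ ι i F.* ι j
    *-val i j = ι-idx _

    +-assoc′ : ∀ i j k → (i +′ j) +′ k ≡ i +′ (j +′ k)
    +-assoc′ i j k = ι-inj (≈-trans (+-val (i +′ j) k) (≈-trans (+-congʳ (+-val i j)) (≈-trans (+-assoc _ _ _)
      (≈-sym (≈-trans (+-val i (j +′ k)) (+-congˡ (+-val j k)))))))
    *-assoc′ : ∀ i j k → (i *′ j) *′ k ≡ i *′ (j *′ k)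
    *-assoc′ i j k = ι-inj (≈-trans (*-val (i *′ j) k) (≈-trans (F.*-congʳ (*-val i j)) (≈-trans (F.*-assoc _ _ _)
      (≈-sym (≈-trans (*-val i (j *′ k)) (F.*-congˡ (*-val j k)))))))
    +-comm′ : ∀ i j → i +′ j ≡ j +′ i
    +-comm′ i j = ι-inj (≈-trans (+-val i j) (≈-trans (F.+-comm _ _) (≈-sym (+-val j i))))
    *-comm′ : ∀ i j → i *′ j ≡ j *′ i
    *-comm′ i j = ι-inj (≈-trans (*-val i j) (≈-trans (F.*-comm _ _) (≈-sym (*-val j i))))
    +-idˡ : ∀ i → 0′ +′ i ≡ i
    +-idˡ i = ι-inj (≈-trans (+-val 0′ i) (≈-trans (+-congʳ (ι-idx 0#)) (+-identityˡ _)))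
    *-idˡ : ∀ i → 1′ *′ i ≡ i
    *-idˡ i = ι-inj (≈-trans (*-val 1′ i) (≈-trans (F.*-congʳ (ι-idx 1#)) (F.*-identityˡ _)))
    invˡ : ∀ i → (-′ i) +′ i ≡ 0′
    invˡ i = ι-inj (≈-trans (+-val (-′ i) i) (≈-trans (+-congʳ (ι-idx _)) (≈-trans (-‿inverseˡ _) (≈-sym (ι-idx 0#)))))
    distˡ : ∀ i j k → i *′ (j +′ k) ≡ i *′ j +′ i *′ k
    distˡ i j k = ι-inj (≈-trans (*-val i (j +′ k)) (≈-trans (F.*-congˡ (+-val j k)) (≈-trans (F.distribˡ _ _ _)
      (≈-sym (≈-trans (+-val (i *′ j) (i *′ k)) (+-cong (*-val i j) (*-val i k)))))))

  finiteField : FiniteField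
  finiteField = record
    { K = Fin q ; _+ᵏ_ = _+′_ ; _*ᵏ_ = _*′_ ; -ᵏ_ = -′_ ; 0ᵏ = 0′ ; 1ᵏ = 1′
    ; isCommutativeRing = record
      { isRing = record
        { +-isAbelianGroup = record
          { isGroup = record
            { isMonoid = record
              { isSemigroup = record
                { isMagma = record { isEquivalence = isEquivalence ; ∙-cong = cong₂ _+′_ } ; assoc = +-assoc′ }
              ; identity = +-idˡ , λ i → trans (+-comm′ i 0′) (+-idˡ i) }
            ; inverse = invˡ , λ i → trans (+-comm′ i (-′ i)) (invˡ i)
            ; ⁻¹-cong = cong -′_ }
          ; comm = +-comm′ }
        ; *-cong = cong₂ _*′_ ; *-assoc = *-assoc′
        ; *-identity = *-idˡ , λ i → trans (*-comm′ i 1′) (*-idˡ i)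
        ; distrib = distˡ , λ i j k → trans (*-comm′ (j +′ k) i) (trans (distˡ i j k) (cong₂ _+′_ (*-comm′ i j) (*-comm′ i k))) }
      ; *-comm = *-comm′ }
    ; inverse = λ i i≢0 → let y , p = proj₂ isField (ι i) (λ z → i≢0 (ι-inj (≈-trans z (≈-sym (ι-idx 0#))))) in
        idx y , ι-inj (≈-trans (*-val i (idx y)) (≈-trans (F.*-congˡ (ι-idx y)) (≈-trans p (≈-sym (ι-idx 1#)))))
    ; 0≢1 = λ p → proj₁ isField (≈-trans (≈-sym (ι-idx 0#)) (≈-trans (F.reflexive (cong ι p)) (ι-idx 1#)))
    ; enumK = enum-Fin }

  open Linear finiteField using (𝕂; Pow; app; 0ᵏ; _+ᵏ_; _*ᵏ_)

  ⟦_⟧ : ∀ {n} → Vec (Fin q) n → Vect F n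
  ⟦ v ⟧ i = ι (lookup v i)

  code : ∀ {n} → Vect F n → Vec (Fin q) n
  code x = tabulate (λ i → idx (x i))

  ⟦code⟧ : ∀ {n} (x : Vect F n) i → ⟦ code x ⟧ i ≈ x i
  ⟦code⟧ x i = ≈-trans (F.reflexive (cong ι (Vec.lookup∘tabulate (λ i → idx (x i)) i))) (ι-idx (x i))

  ⟦⟧-inj : ∀ {n} (v w : Vec (Fin q) n) → (∀ i → ⟦ v ⟧ i ≈ ⟦ w ⟧ i) → v ≡ w
  ⟦⟧-inj v w h = trans (sym (Vec.tabulate∘lookup v)) (trans (Vec.tabulate-cong (λ i → ι-inj (h i))) (Vec.tabulate∘lookup w))

  ⟦𝟎⟧ : ∀ n i → ⟦ replicate n 0′ ⟧ i ≈ 0#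
  ⟦𝟎⟧ n i = ≈-trans (F.reflexive (cong ι (Vec.lookup-replicate i 0′))) (ι-idx 0#)

  lincomb-cong : ∀ {n k} {c d : Fin k → Carrier} {b b′ : Fin k → Vect F n} → (∀ i → c i ≈ d i) → (∀ i x → b i x ≈ b′ i x) →
                 ∀ x → lincomb F c b x ≈ lincomb F d b′ x
  lincomb-cong {k = zero}  p r x = ≈-refl
  lincomb-cong {k = suc k} p r x = +-cong (F.*-cong (p zero) (r zero x)) (lincomb-cong (λ i → p (suc i)) (λ i → r (suc i)) x)

  lincomb-app : ∀ {n k} (b : Vec (Vec (Fin q) n) k) (u : Vec (Fin q) k) x →
                lincomb F ⟦ u ⟧ (λ i → ⟦ lookup b i ⟧) x ≈ ⟦ app (Pow 𝕂 n) b u ⟧ x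
  lincomb-app {n} []      []      x = ≈-sym (⟦𝟎⟧ n x)
  lincomb-app {n} (v ∷ b) (c ∷ u) x = ≈-trans (+-cong (≈-sym (*-val c (lookup v x))) (lincomb-app b u x))
    (≈-trans (≈-sym (+-val (c *′ lookup v x) (lookup (app (Pow 𝕂 n) b u) x)))
      (F.reflexive (cong ι (sym (trans (Vec.lookup-zipWith _+′_ x (map (c *′_) v) (app (Pow 𝕂 n) b u))
        (cong (_+′ lookup (app (Pow 𝕂 n) b u) x) (Vec.lookup-map x (c *′_) v)))))))

  module Spaces (n k′ : ℕ) where
    private
      k : ℕ
      k = suc k′
      V : Linear.VSpace finiteField
      V = Pow 𝕂 n
    open Moments finiteField V k′ using (M; U; _⟨_⟩)
    open Pairs finiteField V k′

    frame : KSpace F n k → M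
    frame W = tabulate (λ i → code (basis W i))

    ⟦frame⟧ : ∀ W i x → ⟦ lookup (frame W) i ⟧ x ≈ basis W i x
    ⟦frame⟧ W i x = ≈-trans (F.reflexive (cong (λ v → ⟦ v ⟧ x) (Vec.lookup∘tabulate (λ i → code (basis W i)) i))) (⟦code⟧ (basis W i) x)

    combination : ∀ W (coef : Fin k → Carrier) x → ⟦ frame W ⟨ code coef ⟩ ⟧ x ≈ lincomb F coef (basis W) x
    combination W coef x = ≈-trans (≈-sym (lincomb-app (frame W) (code coef) x)) (lincomb-cong {c = ⟦ code coef ⟧} {coef} {λ i → ⟦ lookup (frame W) i ⟧} {basis W} (⟦code⟧ coef) (⟦frame⟧ W) x)

    combination′ : ∀ W u x → ⟦ frame W ⟨ u ⟩ ⟧ x ≈ lincomb F ⟦ u ⟧ (basis W) x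
    combination′ W u x = ≈-trans (≈-sym (lincomb-app (frame W) u x)) (lincomb-cong {c = ⟦ u ⟧} {⟦ u ⟧} {λ i → ⟦ lookup (frame W) i ⟧} {basis W} (λ _ → ≈-refl) (⟦frame⟧ W) x)

    frame-inj : ∀ W → Inj (frame W)
    frame-inj W u p = ⟦⟧-inj u (replicate k 0′) (λ i → ≈-trans
      (indep W ⟦ u ⟧ (λ x → ≈-trans (≈-sym (combination′ W u x)) (≈-trans (F.reflexive (cong (λ v → ⟦ v ⟧ x) p)) (⟦𝟎⟧ n x))) i) (≈-sym (⟦𝟎⟧ k i)))

    ∈-frame : ∀ W u → (_∈ₛ_) F ⟦ frame W ⟨ u ⟩ ⟧ W
    ∈-frame W u = ⟦ u ⟧ , combination′ W u

    frame-∈ : ∀ W {x} → (_∈ₛ_) F x W → ∃ λ u → frame W ⟨ u ⟩ ≡ code x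
    frame-∈ W {x} (coef , p) = code coef , ⟦⟧-inj _ _ (λ i → ≈-trans (combination W coef i) (≈-trans (≈-sym (p i)) (≈-sym (⟦code⟧ x i))))

    code-∈ : ∀ W {v} → (_∈ₛ_) F ⟦ v ⟧ W → (v ∈im frame W) ≡ true
    code-∈ W {v} p = let u , r = frame-∈ W p in ∈im-intro (frame W) u (trans r (⟦⟧-inj _ _ (⟦code⟧ ⟦ v ⟧)))

    toSpace : (b : M) → Inj b → KSpace F n k
    toSpace b b-inj = record
      { basis = λ i → ⟦ lookup b i ⟧
      ; indep = λ coef p i → ≈-trans (≈-sym (⟦code⟧ coef i)) (≈-trans (F.reflexive (cong (λ u → ⟦ u ⟧ i) (b-inj (code coef)
          (⟦⟧-inj _ _ (λ x → ≈-trans (≈-sym (lincomb-app b (code coef) x)) (≈-trans (lincomb-cong {c = ⟦ code coef ⟧} {coef} {λ i → ⟦ lookup b i ⟧} {λ i → ⟦ lookup b i ⟧} (⟦code⟧ coef) (λ _ _ → ≈-refl) x)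
            (≈-trans (p x) (≈-sym (⟦𝟎⟧ n x))))))))) (⟦𝟎⟧ k i)) }

    frame-toSpace : ∀ b b-inj → frame (toSpace b b-inj) ≡ b
    frame-toSpace b b-inj = trans (Vec.tabulate-cong (λ i → ⟦⟧-inj (code ⟦ lookup b i ⟧) (lookup b i) (⟦code⟧ ⟦ lookup b i ⟧))) (Vec.tabulate∘lookup b)

    meet⇒Meet : ∀ W W′ → meet (frame W) (frame W′) ≡ true → Meet F W W′
    meet⇒Meet W W′ m disj with meet-elim {frame W} {frame W′} m
    ... | u , u≢0 , r with ∈im-elim (frame W′) r
    ...   | w , s = u≢0 (frame-inj W u (⟦⟧-inj _ _ (λ x → ≈-trans (disj ⟦ frame W ⟨ u ⟩ ⟧ (∈-frame W u)
              (⟦ w ⟧ , λ x → ≈-trans (F.reflexive (cong (λ v → ⟦ v ⟧ x) (sym s))) (combination′ W′ w x)) x) (≈-sym (⟦𝟎⟧ n x)))))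

    disjoint⇒Disjoint : ∀ W W′ → meet (frame W) (frame W′) ≡ false → Disjoint F W W′
    disjoint⇒Disjoint W W′ m x p p′ i with frame-∈ W p | frame-∈ W′ p′
    ... | u , r | w , s with u ≟ replicate k 0′
    ...   | yes refl = ≈-trans (≈-sym (⟦code⟧ x i)) (≈-trans (F.reflexive (cong (λ v → ⟦ v ⟧ i) (trans (sym r) (Linear.app-0ʳ finiteField V (frame W))))) (⟦𝟎⟧ n i))
    ...   | no u≢0 = ⊥-elim (true≢false (meet-intro {frame W} {frame W′} u u≢0 (∈im-intro (frame W′) w (trans s (sym r)))) m)

lookup-distinct : ∀ {X : Set} {R : X → X → Set} {xs : List X} → (∀ {x y} → x ∈ xs → y ∈ xs → R x y → R y x) → AllPairs R xs →
                  ∀ i j → i ≢ j → R (List.lookup xs i) (List.lookup xs j)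
lookup-distinct R-sym (a ∷ ap) zero    zero    i≢j = ⊥-elim (i≢j refl)
lookup-distinct R-sym (a ∷ ap) zero    (suc j) i≢j = All.lookup a (∈-lookup j)
lookup-distinct R-sym (a ∷ ap) (suc i) zero    i≢j = R-sym (here refl) (there (∈-lookup i)) (All.lookup a (∈-lookup i))
lookup-distinct R-sym (a ∷ ap) (suc i) (suc j) i≢j = lookup-distinct (λ x∈ y∈ → R-sym (there x∈) (there y∈)) ap i j (λ p → i≢j (cong suc p))

-- Transfer between families of k-spaces and sets of tuples

module Reduction {c ℓ′ : Level} (F : CommutativeRing c ℓ′) (isField : IsField F) (q : ℕ) (hasCard : HasCard F q) (n′ k′ : ℕ) where
  open Counting
  open FieldModel F isField q hasCard
  open CommutativeRing F using () renaming (sym to ≈-sym; trans to ≈-trans; reflexive to ≈-reflexive)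
  open Linear finiteField using (𝕂; Pow; app; module VS; 1ᵏ; 0ᵏ; 0≢1; app-0ʳ; card-Vec)

  n k : ℕ
  n = suc n′
  k = suc k′

  V : Linear.VSpace finiteField
  V = Pow 𝕂 n

  open Spaces n k′
  open Moments finiteField V k′ using (M; U; _⟨_⟩; A; C; P; 0<A; 0<P; 0<C) renaming (q to Q)
  open Energy finiteField V k′ using (size)
  open Pairs finiteField V k′
  open Greedy finiteField V k′
  open Colour finiteField V k′
  open Lower finiteField V k′
  open Bases finiteField V k′
  private
    module W = VS V

  sub⇒⊆ : ∀ W W′ → sub (frame W) (frame W′) ≡ true → ∀ x → (_∈ₛ_) F x W → (_∈ₛ_) F x W′
  sub⇒⊆ W W′ p x x∈ = let u , r = frame-∈ W x∈
                          w , s = ∈im-elim (frame W′) (sub-elim (frame W) (frame W′) p u)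
                          coef , t = ∈-frame W′ w
    in coef , λ i → ≈-trans (≈-sym (⟦code⟧ x i)) (≈-trans (≈-reflexive (cong (λ v → ⟦ v ⟧ i) (sym (trans s r)))) (t i))

  ⊆⇒sub : ∀ W W′ → (∀ x → (_∈ₛ_) F x W → (_∈ₛ_) F x W′) → sub (frame W) (frame W′) ≡ true
  ⊆⇒sub W W′ h = sub-intro (frame W) (frame W′) (λ u → code-∈ W′ (h _ (∈-frame W u)))

  meet-sub : ∀ b d b′ d′ → Inj b → sub b b′ ≡ true → sub d d′ ≡ true → meet b d ≡ true → meet b′ d′ ≡ true
  meet-sub b d b′ d′ b-inj p p′ m =
    let u , u≢0 , r = meet-elim {b} {d} m
        w , s = ∈im-elim d r
        u′ , s′ = ∈im-elim b′ (sub-elim b b′ p u)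
    in meet-intro {b′} {d′} u′ (λ z → u≢0 (b-inj u (trans (sym s′) (trans (cong (b′ ⟨_⟩) z) (app-0ʳ V b′)))))
         (subst (λ v → (v ∈im d′) ≡ true) (trans s (sym s′)) (sub-elim d d′ p′ w))

  module _ {N : ℕ} (s : ℕ) (Y : Family F n k N) (largest : IsLargestEM F s Y) where
    private
      B : Fin N → M
      B i = frame (proj₁ Y i)

      B-inj : ∀ i → Inj (B i)
      B-inj i = frame-inj (proj₁ Y i)

    Ỹ : M → Bool
    Ỹ = allBases B

    Ỹ-inj : Injective Ỹ
    Ỹ-inj b p = injective-elim b (∧-elimˡ p)

    frame∈Ỹ : ∀ i → Ỹ (B i) ≡ true
    frame∈Ỹ i = ∧-intro (injective-intro (B i) (B-inj i)) (ex-intro (λ j → sub (B i) (B j)) i (sub-refl (B i)))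

    member : ∀ b → Ỹ b ≡ true → ∃ λ i → sub b (B i) ≡ true
    member b p = ex-elim (λ i → sub b (B i)) (∧-elimʳ {injective b} p)

    distinct : ∀ i j → sub (B i) (B j) ≡ true → i ≡ j
    distinct i j p = proj₂ Y i j (sub⇒⊆ (proj₁ Y i) (proj₁ Y j) p , sub⇒⊆ (proj₁ Y j) (proj₁ Y i) (sub-sym (B i) (B j) (B-inj i) p))

    -- Each tuple of the list is a basis of some member of `Y`. Different tuples give different
    -- members, since a repeated member would meet itself although its tuples are disjoint.
    matching-bound : MatchingBound s Ỹ
    matching-bound xs all ap with length xs ℕ.≤? s
    ... | yes le = le
    ... | no nle = ⊥-elim (proj₁ largest f f-inj f-disjoint)
      where
      x : Fin (suc s) → M
      x a = List.lookup xs (inject≤ a (ℕ.≰⇒> nle))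
      x∈ : ∀ a → Ỹ (x a) ≡ true
      x∈ a = All.lookup all (∈-lookup (inject≤ a (ℕ.≰⇒> nle)))
      f : Fin (suc s) → Fin N
      f a = proj₁ (member (x a) (x∈ a))
      x⊆ : ∀ a → sub (x a) (B (f a)) ≡ true
      x⊆ a = proj₂ (member (x a) (x∈ a))
      ⊆x : ∀ a → sub (B (f a)) (x a) ≡ true
      ⊆x a = sub-sym (x a) (B (f a)) (Ỹ-inj (x a) (x∈ a)) (x⊆ a)
      x-disjoint : ∀ a b → a ≢ b → meet (x a) (x b) ≡ false
      x-disjoint a b a≢b = lookup-distinct {R = DisjointT}
        (λ {y} {z} y∈ z∈ d → ≢true⇒false (λ m → true≢false (meet-sym z y (Ỹ-inj z (All.lookup all z∈)) m) d))
        ap (inject≤ a (ℕ.≰⇒> nle)) (inject≤ b (ℕ.≰⇒> nle)) (λ p → a≢b (Fin.inject≤-injective (ℕ.≰⇒> nle) (ℕ.≰⇒> nle) a b p))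
      B-disjoint : ∀ a b → a ≢ b → meet (B (f a)) (B (f b)) ≡ false
      B-disjoint a b a≢b = ≢true⇒false (λ m → true≢false
        (meet-sub (B (f a)) (B (f b)) (x a) (x b) (B-inj (f a)) (⊆x a) (⊆x b) m) (x-disjoint a b a≢b))
      f-inj : ∀ a b → f a ≡ f b → a ≡ b
      f-inj a b eq with a Fin.≟ b
      ... | yes p = p
      ... | no p = true≢false (subst (λ i → meet (B (f a)) (B i) ≡ true) eq (meet-refl (B (f a)))) (B-disjoint a b p)
      f-disjoint : ∀ a b → a ≢ b → Disjoint F (proj₁ Y (f a)) (proj₁ Y (f b))
      f-disjoint a b a≢b = disjoint⇒Disjoint (proj₁ Y (f a)) (proj₁ Y (f b)) (B-disjoint a b a≢b)

    module _ (vs : List (Vec (Fin q) n)) (vs-length : length vs ≡ s) (vs≢0 : All (λ v → ¬ v ≡ W.𝟎) vs) where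

      -- The spaces through one of the s points form an s-EM family, because by pigeonhole two of s
      -- + 1 members contain the same point. Maximality of `Y` compares the numbers of spaces, and
      -- both sides have equally many bases per space.
      hits-largest : size (hits vs) ≤ℤ size Ỹ
      hits-largest = from (representatives (hits vs) (hits-injective vs))
        where
        from : (∃ λ N′ → ∃ λ (R : Fin N′ → M) → (∀ i → hits vs (R i) ≡ true) × (∀ i j → sub (R i) (R j) ≡ true → i ≡ j) × size (hits vs) ≤ℤ pos N′ * bases) →
               size (hits vs) ≤ℤ size Ỹ
        from (N′ , R , R-hits , R-distinct , count) = ℤ.≤-trans count (ℤ.≤-trans (*-monoʳ 0≤bases (+≤+ (proj₂ largest N′ Z Z-EM)))
            (allBases-size B B-inj distinct))
          where
          R-inj : ∀ i → Inj (R i)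
          R-inj i = hits-injective vs (R i) (R-hits i)
          Z : Family F n k N′
          Z = (λ i → toSpace (R i) (R-inj i)) , λ i j same → R-distinct i j
            (subst₂ (λ b d → sub b d ≡ true) (frame-toSpace (R i) (R-inj i)) (frame-toSpace (R j) (R-inj j))
              (⊆⇒sub (toSpace (R i) (R-inj i)) (toSpace (R j) (R-inj j)) (proj₁ same)))
          Z-EM : IsEM F s Z
          Z-EM f f-inj disj = clash (Fin.pigeonhole (subst (ℕ._< suc s) (sym vs-length) ℕ.≤-refl) (λ a → Any.index (hit a)))
            where
            hit : ∀ a → Any (λ v → pencil v (R (f a)) ≡ true) vs
            hit a = hits-elim vs (R (f a)) (R-hits (f a))
            in-space : ∀ {v} a → pencil v (R (f a)) ≡ true → (_∈ₛ_) F ⟦ v ⟧ (proj₁ Z (f a))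
            in-space a p = let u , r = ∈im-elim (R (f a)) (∧-elimʳ {injective (R (f a))} p) in
              subst (λ v → (_∈ₛ_) F ⟦ v ⟧ (proj₁ Z (f a))) (trans (cong (_⟨ u ⟩) (frame-toSpace (R (f a)) (R-inj (f a)))) r)
                (∈-frame (proj₁ Z (f a)) u)
            clash : (∃ λ a → ∃ λ b → a Fin.< b × Any.index (hit a) ≡ Any.index (hit b)) → ⊥
            clash (a , b , a<b , eq) = All.lookup vs≢0 (∈-lookup (Any.index (hit a))) (⟦⟧-inj v W.𝟎 (λ i → ≈-trans
                (disj a b (Fin.<⇒≢ a<b) ⟦ v ⟧ (in-space a (lookup-index (hit a)))
                  (in-space b (subst (λ i → pencil (List.lookup vs i) (R (f b)) ≡ true) (sym eq) (lookup-index (hit b)))) i)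
                (≈-sym (⟦𝟎⟧ n i))))
              where
              v : Vec (Fin q) n
              v = List.lookup vs (Any.index (hit a))

    union : Colouring s Ỹ → UnionOfIntersecting F s Y
    union (col , small , proper) = (λ i → fromℕ< (small (B i) (frame∈Ỹ i))) , λ i j _ eq →
      meet⇒Meet (proj₁ Y i) (proj₁ Y j) (proper (B i) (B j) (frame∈Ỹ i) (frame∈Ỹ j) (Fin.fromℕ<-injective _ _ (small (B i) (frame∈Ỹ i)) (small (B j) (frame∈Ỹ j)) eq))

  private
    tail-eq : ∀ {X : Set} {m} {x y : X} {xs ys : Vec X m} → x ∷ xs ≡ y ∷ ys → xs ≡ ys
    tail-eq refl = refl
    head-eq : ∀ {X : Set} {m} {x y : X} {xs ys : Vec X m} → x ∷ xs ≡ y ∷ ys → x ≡ y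
    head-eq refl = refl

  -- Vectors with first coordinate 1 are nonzero and pairwise nonproportional, so distinct choices
  -- of the remaining n - 1 coordinates give distinct points.
  points : ∀ s → pos s ≤ℤ card (Vec (Fin q) n′) →
           ∃ λ (vs : List (Vec (Fin q) n)) → length vs ≡ s × All (λ v → ¬ v ≡ W.𝟎) vs × AllPairs (λ v v′ → W.mult v v′ ≡ false) vs
  points s le = let ws , ws-length , ws-distinct = distinct-elements s le in
    List.map (1ᵏ ∷_) ws , trans (List.length-map (1ᵏ ∷_) ws) ws-length ,
    All.map⁺ (All.universal (λ w p → 0≢1 (sym (head-eq p))) ws) ,
    AllPairs.map⁺ (AllPairs.map (λ {w} {w′} w≢w′ → ≢true⇒false (λ m → w≢w′ (proportional w w′ (W.mult-elim {1ᵏ ∷ w} {1ᵏ ∷ w′} m)))) ws-distinct)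
    where
    proportional : ∀ w w′ → (∃ λ c → 1ᵏ ∷ w′ ≡ c W.· (1ᵏ ∷ w)) → w ≡ w′
    proportional w w′ (c , eq) = sym (trans (tail-eq eq) (trans (cong (λ d → VSpace._·_ (Pow 𝕂 n′) d w) c≡1) (VSpace.·-identity (Pow 𝕂 n′) w)))
      where
      open Linear finiteField using (module VSpace; module K)
      c≡1 : c ≡ 1ᵏ
      c≡1 = trans (sym (K.*-identityʳ c)) (sym (head-eq eq))

  pos-^ : ∀ m → Linear._^_ finiteField (pos q) m ≡ pos (q ^ m)
  pos-^ zero    = refl
  pos-^ (suc m) = trans (cong (pos q *_) (pos-^ m)) (sym (pos-* q (q ^ m)))

  card-power : ∀ m → card (Vec (Fin q) m) ≡ pos (q ^ m)
  card-power m = trans (card-Vec (Fin q) m) (trans (cong (λ x → Linear._^_ finiteField x m) (card-Fin q)) (pos-^ m))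

  Q≡ : Q ≡ pos q
  Q≡ = card-Fin q

  A≡ : A ≡ pos (q ^ n)
  A≡ = card-power n

  C≡ : C ≡ pos (q ^ k)
  C≡ = card-power k

  module _ (s : ℕ) (2≤q : 2 ≤ q) (2≤s : 2 ≤ s) (2k≤n : k + k ≤ n)
           (few-points : 4096 ℕ.* (s ℕ.* s) ℕ.* q ^ k ≤ q ^ n)
           (few-meets : 256 ℕ.* (s ℕ.* s) ℕ.* (q ^ k ℕ.* q ^ k) ≤ q ℕ.* q ℕ.* q ^ n) where
    private
      D≡ : D ≡ pos (q ^ k ℕ.* q ^ k)
      D≡ = trans (cong₂ _*_ C≡ C≡) (sym (pos-* (q ^ k) (q ^ k)))

      instance
        q-nonzero : ℕ.NonZero q
        q-nonzero = ℕ.>-nonZero (ℕ.<-trans (s≤s z≤n) 2≤q)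

      D≤A : D ≤ℤ A
      D≤A = subst₂ _≤ℤ_ (sym D≡) (sym A≡) (+≤+ (subst (_≤ q ^ n) (ℕ.^-distribˡ-+-* q k k) (ℕ.^-monoʳ-≤ q 2k≤n)))

      slack : Slack Q A D (pos s)
      slack = subst (λ x → Slack x A D (pos s)) (sym Q≡) (SlackEstimate.slack-holds q s A D 2≤q 2≤s 0<A 0<D D≤A
        (subst₂ _≤ℤ_
          (trans (pos-* (256 ℕ.* (s ℕ.* s)) (q ^ k ℕ.* q ^ k)) (cong₂ _*_ (trans (pos-* 256 (s ℕ.* s)) (cong (pos 256 *_) (pos-* s s))) (sym D≡)))
          (trans (pos-* (q ℕ.* q) (q ^ n)) (cong₂ _*_ (pos-* q q) (sym A≡)))
          (+≤+ few-meets)))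

      few-points′ : pos 4096 * (pos s * pos s) * C ≤ℤ A
      few-points′ = subst₂ _≤ℤ_
        (trans (pos-* (4096 ℕ.* (s ℕ.* s)) (q ^ k)) (cong₂ _*_ (trans (pos-* 4096 (s ℕ.* s)) (cong (pos 4096 *_) (pos-* s s))) (sym C≡)))
        (sym A≡) (+≤+ few-points)

      enough-points : s ≤ q ^ n′
      enough-points = ℕ.*-cancelˡ-≤ q (ℕ.≤-trans (begin
        q ℕ.* s                               ≡⟨ ℕ.*-comm q s ⟩
        s ℕ.* q                               ≤⟨ ℕ.*-mono-≤ (ℕ.≤-trans (ℕ.m≤m*n s s) (ℕ.m≤n*m (s ℕ.* s) 4096)) (ℕ.m≤m*n q (q ^ k′) {{ℕ.m^n≢0 q k′}}) ⟩
        4096 ℕ.* (s ℕ.* s) ℕ.* q ^ k          ∎) few-points)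
        where
        open ℕ.≤-Reasoning
        instance
          s-nonzero : ℕ.NonZero s
          s-nonzero = ℕ.>-nonZero (ℕ.<-trans (s≤s z≤n) 2≤s)

    theorem : ∀ {N} (Y : Family F n k N) → IsLargestEM F s Y → UnionOfIntersecting F s Y
    theorem Y largest = from (points s (subst (pos s ≤ℤ_) (sym (card-power n′)) (+≤+ enough-points)))
      where
      from : (∃ λ (vs : List (Vec (Fin q) n)) → length vs ≡ s × All (λ v → ¬ v ≡ W.𝟎) vs × AllPairs (λ v v′ → W.mult v v′ ≡ false) vs) → UnionOfIntersecting F s Y
      from (vs , vs-length , vs≢0 , vs-indep) = union s Y largest (colouring D≤A s slack Δ Δ-small s (Ỹ s Y largest) ℕ.≤-refl (Ỹ-inj s Y largest) (matching-bound s Y largest) large)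
        where
        H : M → Bool
        H = hits vs
        -- `Δ` is the shortfall of the union of pencils against s P. Since `Ỹ` is at least as large
        -- as this union, it also bounds the deficit of `Ỹ`.
        S Δ : ℤ
        S = pos s
        Δ = S * P - size H
        large : S * P ≤ℤ size (Ỹ s Y largest) +ℤ Δ
        large = ≤-by (0≤diff (hits-largest s Y largest vs vs-length vs≢0)) (ar (size (Ỹ s Y largest)) (S * P) (size H))
          where
          opaque
            unfolding _*_
            ar : ∀ y p h → y +ℤ (p - h) - p ≡ y - h
            ar = solve-∀ ring
        size-H : A * (S * P) - S * S * (C * P) ≤ℤ A * size H
        size-H = subst (λ l → A * (pos l * P) - pos l * pos l * (C * P) ≤ℤ A * size H) vs-length (hits-size vs vs≢0 vs-indep)
        -- A Δ ≤ s² C P by `hits-size`, and 4096 s² C ≤ A.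
        Δ-small : pos 4096 * Δ ≤ℤ P
        Δ-small = *-cancelˡ 0<A (≤-by (0≤sum (0≤prod {pos 4096} 0≤pos (0≤diff size-H)) (0≤prod (<⇒0≤ 0<P) (0≤diff few-points′)))
            (ar (pos 4096) A S P C (size H)))
          where
          opaque
            unfolding _*_
            ar : ∀ e a s p c h → a * p - a * (e * (s * p - h)) ≡ e * (a * h - (a * (s * p) - s * s * (c * p))) +ℤ p * (a - e * (s * s) * c)
            ar = solve-∀ ring

-- Arithmetic of the hypotheses and the case s = 1

open import Data.Nat using (_*_)

1-EM-intersecting : ∀ {c ℓ′ : Level} (F : CommutativeRing c ℓ′) {n k N} (Y : Family F n k N) → IsEM F 1 Y → UnionOfIntersecting F 1 Y
1-EM-intersecting F {N = N} Y em = (λ _ → zero) , λ i j i≢j _ disj → em (pair i j) (pair-injective i j i≢j) (pair-disjoint i j disj)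
  where
  pair : Fin N → Fin N → Fin 2 → Fin N
  pair i j zero       = i
  pair i j (suc zero) = j
  pair-injective : ∀ i j → i ≢ j → ∀ a b → pair i j a ≡ pair i j b → a ≡ b
  pair-injective i j i≢j zero       zero       _  = refl
  pair-injective i j i≢j (suc zero) (suc zero) _  = refl
  pair-injective i j i≢j zero       (suc zero) eq = ⊥-elim (i≢j eq)
  pair-injective i j i≢j (suc zero) zero       eq = ⊥-elim (i≢j (sym eq))
  pair-disjoint : ∀ i j → Disjoint F (proj₁ Y i) (proj₁ Y j) → ∀ a b → a ≢ b → Disjoint F (proj₁ Y (pair i j a)) (proj₁ Y (pair i j b))
  pair-disjoint i j d zero       zero       a≢b = ⊥-elim (a≢b refl)
  pair-disjoint i j d (suc zero) (suc zero) a≢b = ⊥-elim (a≢b refl)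
  pair-disjoint i j d zero       (suc zero) _   = d
  pair-disjoint i j d (suc zero) zero       _   = λ x p r → d x r p

2≤card : ∀ {c ℓ′ : Level} (F : CommutativeRing c ℓ′) → IsField F → ∀ q → HasCard F q → 2 ≤ q
2≤card F isF zero          hc with FieldModel.0′ F isF zero hc
... | ()
2≤card F isF (suc zero)    hc = ⊥-elim (collapse (FieldModel.0′ F isF 1 hc) (FieldModel.1′ F isF 1 hc) (FiniteField.0≢1 (FieldModel.finiteField F isF 1 hc)))
  where
  open Counting using (module FiniteField)
  collapse : ∀ (i j : Fin 1) → ¬ i ≡ j → ⊥
  collapse zero zero h = h refl
2≤card F isF (suc (suc q)) hc = s≤s (s≤s z≤n)

*-^-distrib : ∀ x y m → (x * y) ^ m ≡ x ^ m * y ^ m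
*-^-distrib x y zero    = refl
*-^-distrib x y (suc m) = trans (cong (x * y *_) (*-^-distrib x y m)) (ℕ.[m*n]*[o*p]≡[m*o]*[n*p] x y (x ^ m) (y ^ m))

-- The origin of 4096 = 16³. The cubed bound is weakened twice: s³ is lowered to s², and the
-- exponent n - k - r is raised to n - k.
few-points : ∀ q n k r s .{{_ : ℕ.NonZero q}} .{{_ : ℕ.NonZero s}} → k ≤ n → (16 * s) ^ 3 ≤ q ^ (n ∸ (k + r)) → 4096 * (s * s) * q ^ k ≤ q ^ n
few-points q n k r s k≤n h = begin
  4096 * (s * s) * q ^ k             ≤⟨ ℕ.*-monoˡ-≤ (q ^ k) cube ⟩
  (16 * s) ^ 3 * q ^ k               ≤⟨ ℕ.*-monoˡ-≤ (q ^ k) (ℕ.≤-trans h (ℕ.^-monoʳ-≤ q (ℕ.∸-monoʳ-≤ n (ℕ.m≤m+n k r)))) ⟩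
  q ^ (n ∸ k) * q ^ k                ≡⟨ sym (ℕ.^-distribˡ-+-* q (n ∸ k) k) ⟩
  q ^ (n ∸ k + k)                    ≡⟨ cong (q ^_) (ℕ.m∸n+n≡m k≤n) ⟩
  q ^ n                              ∎
  where
  open ℕ.≤-Reasoning
  cube : 4096 * (s * s) ≤ (16 * s) ^ 3
  cube = begin
    4096 * (s * s)      ≤⟨ ℕ.*-monoʳ-≤ 4096 (ℕ.*-monoʳ-≤ s (ℕ.m≤m*n s (s * 1) {{ℕ.m*n≢0 s 1}})) ⟩
    16 ^ 3 * s ^ 3      ≡⟨ sym (*-^-distrib 16 s 3) ⟩
    (16 * s) ^ 3        ∎

-- The origin of 256 = 16²: the bound is squared, and the exponent n - 2k + 2 is twice n/2 - k + 1.
few-meets : ∀ q n k s .{{_ : ℕ.NonZero q}} → 2 * k ≤ n → (16 * s) ^ 2 ≤ q ^ (n + 2 ∸ 2 * k) → 256 * (s * s) * (q ^ k * q ^ k) ≤ q * q * q ^ n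
few-meets q n k s 2k≤n h = begin
  256 * (s * s) * (q ^ k * q ^ k)       ≡⟨ cong₂ (λ x y → 256 * (s * x) * y) (sym (ℕ.*-identityʳ s)) (sym (trans (cong (λ j → q ^ (k + j)) (ℕ.+-identityʳ k)) (ℕ.^-distribˡ-+-* q k k))) ⟩
  16 ^ 2 * s ^ 2 * q ^ (2 * k)          ≡⟨ cong (_* q ^ (2 * k)) (sym (*-^-distrib 16 s 2)) ⟩
  (16 * s) ^ 2 * q ^ (2 * k)            ≤⟨ ℕ.*-monoˡ-≤ (q ^ (2 * k)) h ⟩
  q ^ (n + 2 ∸ 2 * k) * q ^ (2 * k)     ≡⟨ sym (ℕ.^-distribˡ-+-* q (n + 2 ∸ 2 * k) (2 * k)) ⟩
  q ^ (n + 2 ∸ 2 * k + 2 * k)           ≡⟨ cong (q ^_) (trans (ℕ.m∸n+n≡m (ℕ.≤-trans 2k≤n (ℕ.m≤m+n n 2))) (ℕ.+-comm n 2)) ⟩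
  q * (q * q ^ n)                       ≡⟨ sym (ℕ.*-assoc q q (q ^ n)) ⟩
  q * q * q ^ n                         ∎
  where open ℕ.≤-Reasoning

theorem1p5 : ∀ {c ℓ' : Level} (F : CommutativeRing c ℓ') → IsField F →
    (q : ℕ) → IsPrimePower q → HasCard F q →
    (n k s m r ℓ : ℕ) → 1 ≤ n → 1 ≤ k → 1 ≤ s → 2 * k ≤ n →
    n ≡ m * k + r → r < k →
    [ ℓ ∸ 1 ] q < s → s ≤ [ ℓ ] q →
    (ℓ + k ≤ n + 2 × (16 * s) ^ 3 ≤ q ^ (n + 2 ∸ (k + ℓ))) →
    (16 * s) ^ 3 ≤ q ^ (n ∸ (k + r)) →
    (16 * s) ^ 2 ≤ q ^ (n + 2 ∸ 2 * k) →
    (N : ℕ) (Y : Family F n k N) → IsLargestEM F s Y →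
    UnionOfIntersecting F s Y
-- For s = 1 a family without two disjoint members is itself intersecting; the estimate
-- `slack-holds` starts at s = 2.
theorem1p5 F isF q _ hc n k (suc zero) m r ℓ _ _ _ _ _ _ _ _ _ _ _ N Y largest = 1-EM-intersecting F Y (proj₁ largest)
theorem1p5 F isF q _ hc (suc n′) (suc k′) (suc (suc s)) m r ℓ _ _ _ 2k≤n _ _ _ _ _ h₂ h₃ N Y largest =
  Reduction.theorem F isF q hc n′ k′ (suc (suc s)) 2≤q (s≤s (s≤s z≤n)) (subst (λ j → suc k′ + j ≤ suc n′) (ℕ.+-identityʳ (suc k′)) 2k≤n)
    (few-points q (suc n′) (suc k′) r (suc (suc s)) (ℕ.≤-trans (ℕ.m≤m+n (suc k′) _) 2k≤n) h₂)
    (few-meets q (suc n′) (suc k′) (suc (suc s)) 2k≤n h₃) Y largest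
  where
  2≤q : 2 ≤ q
  2≤q = 2≤card F isF q hc
  instance
    q-nonzero : ℕ.NonZero q
    q-nonzero = ℕ.>-nonZero (ℕ.<-trans (s≤s z≤n) 2≤q)
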